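{- Let $G$ be the triangular lattice on $N=n^2$ vertices. Then \[ \lim_{N\to\infty}\frac{\sup_{p\in(0,1)}\mathbb{E}[C_p]}{N}\in(0.09629,\,0.10107), \] where the limit is taken along $N=n^2$, $n\to\infty$.
   Context: The triangular lattice on $N=n^2$ vertices (a parallelogram-shaped piece of the infinite triangular lattice) is the graph with vertex set $\{1,\ldots,n\}^2$ in which $(i,j)$ is adjacent to $(i+1,j)$, $(i,j+1)$ and $(i+1,j-1)$ whenever these belong to the vertex set (and there are no other edges). For a graph $G$ and $p\in[0,1]$, each vertex of $G$ is declared open with probability $p$ and closed with probability $1-p$, independently of the other vertices; $G_p$ is the subgraph of $G$ induced by the open vertices, and $C_p$ is the number of connected components of $G_p$. -}

module Defs where

open import Data.Fin.Base using (Fin; zero; suc; toℕ; remQuot)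
open import Data.Fin.Properties using (any?)
open import Data.Fin.Subset using (Subset; Side; inside; outside; _∈_)
open import Data.Fin.Subset.Properties using (_∈?_)
import Data.Integer.Base as ℤ
open import Data.List.Base as List using (List; []; _∷_; _++_; length; filter; deduplicate; allFin)
open import Data.Nat.Base as ℕ using (ℕ; zero; suc)
import Data.Nat.Properties as ℕ
open import Data.Product.Base using (Σ-syntax; ∃-syntax; _×_; _,_)
open import Data.Rational.Base as ℚ using (ℚ; 0ℚ; 1ℚ; ½)
import Data.Rational.Properties as ℚ
open import Data.Rational.Solver using (module +-*-Solver)
open import Data.Sum.Base using (_⊎_; inj₁; inj₂; swap)
open import Data.Vec.Base as Vec using ([]; _∷_)
open import Level using (0ℓ)
open import Relation.Binary.Construct.Closure.ReflexiveTransitive using (Star; ε; _◅_; _◅◅_)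
open import Relation.Binary.Core using (Rel)
open import Relation.Binary.Definitions using (Decidable; Symmetric; Irreflexive)
open import Relation.Binary.PropositionalEquality
open import Relation.Nullary.Decidable using (yes; no; map′; _×-dec_; _⊎-dec_)
open import Relation.Nullary.Negation using (¬_)

infixl 6 _+ᵣ_ _-ᵣ_
infixl 7 _*ᵣ_
infix  8 -ᵣ_
infix  4 _<ᵣ_ _≤ᵣ_ _⟶_

------------------------------------------------------------------------
-- Real numbers: Cauchy sequences of rationals, with pointwise operations.
-- Two sequences may represent the same real; every notion below is
-- invariant under x ~ y :⇔ x n - y n → 0.

Cauchy : (ℕ → ℚ) → Set
Cauchy x = ∀ e → 0ℚ ℚ.< e →
  ∃[ M ] (∀ m n → M ℕ.≤ m → M ℕ.≤ n → ℚ.∣ x m ℚ.- x n ∣ ℚ.< e)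

record ℝ : Set where
  constructor mkℝ
  field
    seq    : ℕ → ℚ
    cauchy : Cauchy seq

open ℝ public

private
  0<½e : ∀ {e} → 0ℚ ℚ.< e → 0ℚ ℚ.< ½ ℚ.* e
  0<½e {e} 0<e = subst (ℚ._< ½ ℚ.* e) (ℚ.*-zeroʳ ½) (ℚ.*-monoʳ-<-pos ½ 0<e)

  ½e+½e≡e : ∀ e → ½ ℚ.* e ℚ.+ ½ ℚ.* e ≡ e
  ½e+½e≡e e = trans (sym (ℚ.*-distribʳ-+ e ½ ½)) (ℚ.*-identityˡ e)

  abstract
    cauchy-const : ∀ q → Cauchy (λ _ → q)
    cauchy-const q e 0<e = 0 , λ _ _ _ _ →
      subst (λ z → ℚ.∣ z ∣ ℚ.< e) (sym (ℚ.+-inverseʳ q)) 0<e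

  abstract
    cauchy-+ : ∀ x y → Cauchy x → Cauchy y → Cauchy (λ n → x n ℚ.+ y n)
    cauchy-+ x y cx cy e 0<e with cx (½ ℚ.* e) (0<½e 0<e) | cy (½ ℚ.* e) (0<½e 0<e)
    ... | M , hx | K , hy = M ℕ.⊔ K , λ m n le le′ →
      let open ℚ.≤-Reasoning in begin-strict
        ℚ.∣ (x m ℚ.+ y m) ℚ.- (x n ℚ.+ y n) ∣
          ≡⟨ cong ℚ.∣_∣ (rearrange (x m) (y m) (x n) (y n)) ⟩
        ℚ.∣ (x m ℚ.- x n) ℚ.+ (y m ℚ.- y n) ∣
          ≤⟨ ℚ.∣p+q∣≤∣p∣+∣q∣ (x m ℚ.- x n) (y m ℚ.- y n) ⟩
        ℚ.∣ x m ℚ.- x n ∣ ℚ.+ ℚ.∣ y m ℚ.- y n ∣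
          <⟨ ℚ.+-mono-< (hx m n (ℕ.m⊔n≤o⇒m≤o M K le) (ℕ.m⊔n≤o⇒m≤o M K le′))
                        (hy m n (ℕ.m⊔n≤o⇒n≤o M K le) (ℕ.m⊔n≤o⇒n≤o M K le′)) ⟩
        ½ ℚ.* e ℚ.+ ½ ℚ.* e
          ≡⟨ ½e+½e≡e e ⟩
        e ∎
      where
      open +-*-Solver
      rearrange : ∀ a b c d → (a ℚ.+ b) ℚ.- (c ℚ.+ d) ≡ (a ℚ.- c) ℚ.+ (b ℚ.- d)
      rearrange = solve 4 (λ a b c d → (a :+ b) :- (c :+ d) := (a :- c) :+ (b :- d)) refl

  abstract
    cauchy-neg : ∀ x → Cauchy x → Cauchy (λ n → ℚ.- x n)
    cauchy-neg x cx e 0<e with cx e 0<e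
    ... | M , hx = M , λ m n le le′ → subst (ℚ._< e)
        (trans (sym (ℚ.∣-p∣≡∣p∣ (x m ℚ.- x n))) (cong ℚ.∣_∣ (ℚ.neg-distrib-+ (x m) (ℚ.- x n))))
        (hx m n le le′)

  ∣p∣-∣q∣≤∣p-q∣ : ∀ p q → ℚ.∣ p ∣ ℚ.- ℚ.∣ q ∣ ℚ.≤ ℚ.∣ p ℚ.- q ∣
  ∣p∣-∣q∣≤∣p-q∣ p q = begin
    ℚ.∣ p ∣ ℚ.- ℚ.∣ q ∣
      ≡⟨ cong (λ z → ℚ.∣ z ∣ ℚ.- ℚ.∣ q ∣) (split p q) ⟩
    ℚ.∣ (p ℚ.- q) ℚ.+ q ∣ ℚ.- ℚ.∣ q ∣
      ≤⟨ ℚ.+-monoˡ-≤ (ℚ.- ℚ.∣ q ∣) (ℚ.∣p+q∣≤∣p∣+∣q∣ (p ℚ.- q) q) ⟩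
    ℚ.∣ p ℚ.- q ∣ ℚ.+ ℚ.∣ q ∣ ℚ.- ℚ.∣ q ∣
      ≡⟨ cancel ℚ.∣ p ℚ.- q ∣ ℚ.∣ q ∣ ⟩
    ℚ.∣ p ℚ.- q ∣ ∎
    where
    open ℚ.≤-Reasoning
    open +-*-Solver using (solve; _:+_; _:-_; _:=_)
    split : ∀ a b → a ≡ (a ℚ.- b) ℚ.+ b
    split = solve 2 (λ a b → a := (a :- b) :+ b) refl
    cancel : ∀ a b → a ℚ.+ b ℚ.- b ≡ a
    cancel = solve 2 (λ a b → a :+ b :- b := a) refl

  ∣p-q∣≡∣q-p∣ : ∀ p q → ℚ.∣ p ℚ.- q ∣ ≡ ℚ.∣ q ℚ.- p ∣
  ∣p-q∣≡∣q-p∣ p q = trans (sym (ℚ.∣-p∣≡∣p∣ (p ℚ.- q))) (cong ℚ.∣_∣ (flip p q))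
    where
    open +-*-Solver
    flip : ∀ a b → ℚ.- (a ℚ.- b) ≡ b ℚ.- a
    flip = solve 2 (λ a b → :- (a :- b) := b :- a) refl

  ∣∣p∣-∣q∣∣≤∣p-q∣ : ∀ p q → ℚ.∣ ℚ.∣ p ∣ ℚ.- ℚ.∣ q ∣ ∣ ℚ.≤ ℚ.∣ p ℚ.- q ∣
  ∣∣p∣-∣q∣∣≤∣p-q∣ p q with ℚ.∣p∣≡p∨∣p∣≡-p (ℚ.∣ p ∣ ℚ.- ℚ.∣ q ∣)
  ... | inj₁ eq = subst (ℚ._≤ ℚ.∣ p ℚ.- q ∣) (sym eq) (∣p∣-∣q∣≤∣p-q∣ p q)
  ... | inj₂ eq = subst₂ ℚ._≤_ (sym (trans eq (flip ℚ.∣ p ∣ ℚ.∣ q ∣))) (∣p-q∣≡∣q-p∣ q p)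
                    (∣p∣-∣q∣≤∣p-q∣ q p)
    where
    open +-*-Solver
    flip : ∀ a b → ℚ.- (a ℚ.- b) ≡ b ℚ.- a
    flip = solve 2 (λ a b → :- (a :- b) := b :- a) refl

  abstract
    cauchy-abs : ∀ x → Cauchy x → Cauchy (λ n → ℚ.∣ x n ∣)
    cauchy-abs x cx e 0<e with cx e 0<e
    ... | M , hx = M , λ m n le le′ →
      ℚ.≤-<-trans (∣∣p∣-∣q∣∣≤∣p-q∣ (x m) (x n)) (hx m n le le′)

  eventually-bounded : ∀ x → Cauchy x →
    Σ[ B ∈ ℚ ] 0ℚ ℚ.< B × ∃[ M ] (∀ n → M ℕ.≤ n → ℚ.∣ x n ∣ ℚ.≤ B)
  eventually-bounded x cx with cx 1ℚ (ℚ.positive⁻¹ 1ℚ)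
  ... | M , hx = 1ℚ ℚ.+ ℚ.∣ x M ∣ ,
    ℚ.+-mono-<-≤ (ℚ.positive⁻¹ 1ℚ) (ℚ.0≤∣p∣ (x M)) , M , λ n le →
    let open ℚ.≤-Reasoning in begin
      ℚ.∣ x n ∣                           ≡⟨ cong ℚ.∣_∣ (split (x n) (x M)) ⟩
      ℚ.∣ (x n ℚ.- x M) ℚ.+ x M ∣         ≤⟨ ℚ.∣p+q∣≤∣p∣+∣q∣ (x n ℚ.- x M) (x M) ⟩
      ℚ.∣ x n ℚ.- x M ∣ ℚ.+ ℚ.∣ x M ∣     ≤⟨ ℚ.+-monoˡ-≤ ℚ.∣ x M ∣ (ℚ.<⇒≤ (hx n M le ℕ.≤-refl)) ⟩
      1ℚ ℚ.+ ℚ.∣ x M ∣                    ∎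
    where
    open +-*-Solver
    split : ∀ a b → a ≡ (a ℚ.- b) ℚ.+ b
    split = solve 2 (λ a b → a := (a :- b) :+ b) refl

  divide : ∀ e B → 0ℚ ℚ.< e → 0ℚ ℚ.< B → Σ[ d ∈ ℚ ] 0ℚ ℚ.< d × B ℚ.* d ≡ e
  divide e B 0<e 0<B = 1/B ℚ.* e ,
    subst (ℚ._< 1/B ℚ.* e) (ℚ.*-zeroʳ 1/B) (ℚ.*-monoʳ-<-pos 1/B {{ℚ.1/pos⇒pos B {{B⁺}}}} 0<e) ,
    trans (sym (ℚ.*-assoc B 1/B e))
      (trans (cong (ℚ._* e) (ℚ.*-inverseʳ B {{B≢0}})) (ℚ.*-identityˡ e))
    where
    B⁺  = ℚ.positive 0<B
    B≢0 = ℚ.pos⇒nonZero B {{B⁺}}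
    1/B = ℚ.1/_ B {{B≢0}}

  ∣*∣≤ : ∀ p q {B d} → 0ℚ ℚ.< B → ℚ.∣ p ∣ ℚ.≤ B → ℚ.∣ q ∣ ℚ.< d → ℚ.∣ p ℚ.* q ∣ ℚ.< B ℚ.* d
  ∣*∣≤ p q {B} {d} 0<B p≤B q<d = begin-strict
    ℚ.∣ p ℚ.* q ∣          ≡⟨ ℚ.∣p*q∣≡∣p∣*∣q∣ p q ⟩
    ℚ.∣ p ∣ ℚ.* ℚ.∣ q ∣    ≤⟨ ℚ.*-monoʳ-≤-nonNeg ℚ.∣ q ∣ {{ℚ.nonNegative (ℚ.0≤∣p∣ q)}} p≤B ⟩
    B ℚ.* ℚ.∣ q ∣          <⟨ ℚ.*-monoʳ-<-pos B {{ℚ.positive 0<B}} q<d ⟩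
    B ℚ.* d                ∎
    where open ℚ.≤-Reasoning

  module _ {x y : ℕ → ℚ} {A B a b e : ℚ} (0<A : 0ℚ ℚ.< A) (0<B : 0ℚ ℚ.< B)
           (Ab≡½e : A ℚ.* b ≡ ½ ℚ.* e) (Ba≡½e : B ℚ.* a ≡ ½ ℚ.* e) where

    open +-*-Solver using (solve; _:+_; _:-_; _:*_; _:=_)

    rearrange-* : ∀ p q r s → p ℚ.* q ℚ.- r ℚ.* s ≡ p ℚ.* (q ℚ.- s) ℚ.+ s ℚ.* (p ℚ.- r)
    rearrange-* = solve 4 (λ p q r s → p :* q :- r :* s := p :* (q :- s) :+ s :* (p :- r)) refl

    product-close : ∀ m n → ℚ.∣ x m ∣ ℚ.≤ A → ℚ.∣ y n ∣ ℚ.≤ B →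
      ℚ.∣ x m ℚ.- x n ∣ ℚ.< a → ℚ.∣ y m ℚ.- y n ∣ ℚ.< b →
      ℚ.∣ x m ℚ.* y m ℚ.- x n ℚ.* y n ∣ ℚ.< e
    product-close m n x≤ y≤ Δx Δy = begin-strict
      ℚ.∣ x m ℚ.* y m ℚ.- x n ℚ.* y n ∣
        ≡⟨ cong ℚ.∣_∣ (rearrange-* (x m) (y m) (x n) (y n)) ⟩
      ℚ.∣ x m ℚ.* (y m ℚ.- y n) ℚ.+ y n ℚ.* (x m ℚ.- x n) ∣
        ≤⟨ ℚ.∣p+q∣≤∣p∣+∣q∣ (x m ℚ.* (y m ℚ.- y n)) (y n ℚ.* (x m ℚ.- x n)) ⟩
      ℚ.∣ x m ℚ.* (y m ℚ.- y n) ∣ ℚ.+ ℚ.∣ y n ℚ.* (x m ℚ.- x n) ∣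
        <⟨ ℚ.+-mono-< (∣*∣≤ (x m) (y m ℚ.- y n) 0<A x≤ Δy) (∣*∣≤ (y n) (x m ℚ.- x n) 0<B y≤ Δx) ⟩
      A ℚ.* b ℚ.+ B ℚ.* a
        ≡⟨ cong₂ ℚ._+_ Ab≡½e Ba≡½e ⟩
      ½ ℚ.* e ℚ.+ ½ ℚ.* e
        ≡⟨ ½e+½e≡e e ⟩
      e ∎
      where open ℚ.≤-Reasoning

  abstract
    cauchy-* : ∀ x y → Cauchy x → Cauchy y → Cauchy (λ n → x n ℚ.* y n)
    cauchy-* x y cx cy e 0<e =
      let A , 0<A , Mx , x≤A = eventually-bounded x cx
          B , 0<B , My , y≤B = eventually-bounded y cy
          a , 0<a , Ba≡½e    = divide (½ ℚ.* e) B (0<½e 0<e) 0<B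
          b , 0<b , Ab≡½e    = divide (½ ℚ.* e) A (0<½e 0<e) 0<A
          Kx , hx = cx a 0<a
          Ky , hy = cy b 0<b
      in (Mx ℕ.⊔ My) ℕ.⊔ (Kx ℕ.⊔ Ky) , λ m n le le′ →
      let l  = ℕ.m⊔n≤o⇒m≤o (Mx ℕ.⊔ My) (Kx ℕ.⊔ Ky) le
          l′ = ℕ.m⊔n≤o⇒m≤o (Mx ℕ.⊔ My) (Kx ℕ.⊔ Ky) le′
          k  = ℕ.m⊔n≤o⇒n≤o (Mx ℕ.⊔ My) (Kx ℕ.⊔ Ky) le
          k′ = ℕ.m⊔n≤o⇒n≤o (Mx ℕ.⊔ My) (Kx ℕ.⊔ Ky) le′
      in product-close {x} {y} 0<A 0<B Ab≡½e Ba≡½e m n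
           (x≤A m (ℕ.m⊔n≤o⇒m≤o Mx My l)) (y≤B n (ℕ.m⊔n≤o⇒n≤o Mx My l′))
           (hx m n (ℕ.m⊔n≤o⇒m≤o Kx Ky k) (ℕ.m⊔n≤o⇒m≤o Kx Ky k′))
           (hy m n (ℕ.m⊔n≤o⇒n≤o Kx Ky k) (ℕ.m⊔n≤o⇒n≤o Kx Ky k′))

fromℚ : ℚ → ℝ
fromℚ q = mkℝ (λ _ → q) (cauchy-const q)

fromℕ : ℕ → ℝ
fromℕ k = fromℚ (ℤ.+ k ℚ./ 1)

0ᵣ 1ᵣ : ℝ
0ᵣ = fromℚ 0ℚ
1ᵣ = fromℚ 1ℚ

_+ᵣ_ _*ᵣ_ : ℝ → ℝ → ℝ
x +ᵣ y = mkℝ (λ n → seq x n ℚ.+ seq y n) (cauchy-+ (seq x) (seq y) (cauchy x) (cauchy y))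
x *ᵣ y = mkℝ (λ n → seq x n ℚ.* seq y n) (cauchy-* (seq x) (seq y) (cauchy x) (cauchy y))

-ᵣ_ ∣_∣ᵣ : ℝ → ℝ
-ᵣ x   = mkℝ (λ n → ℚ.- seq x n) (cauchy-neg (seq x) (cauchy x))
∣ x ∣ᵣ = mkℝ (λ n → ℚ.∣ seq x n ∣) (cauchy-abs (seq x) (cauchy x))

_-ᵣ_ : ℝ → ℝ → ℝ
x -ᵣ y = x +ᵣ (-ᵣ y)

-- The gap e must be uniform: a pointwise eventual x n < y n would only
-- give x ≤ y in the limit.
_<ᵣ_ _≤ᵣ_ : ℝ → ℝ → Set
x <ᵣ y = ∃[ e ] 0ℚ ℚ.< e × ∃[ M ] (∀ n → M ℕ.≤ n → seq x n ℚ.+ e ℚ.≤ seq y n)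
x ≤ᵣ y = ¬ (y <ᵣ x)

_⟶_ : (ℕ → ℝ) → ℝ → Set
a ⟶ L = ∀ e → 0ᵣ <ᵣ e → ∃[ M ] (∀ n → M ℕ.≤ n → ∣ a n -ᵣ L ∣ᵣ <ᵣ e)

-- s is the supremum of f over D, in the usual constructive form: an upper
-- bound that is approached by values of f.  It entails that s is least
-- among the upper bounds.
IsSupremum : (D : ℝ → Set) (f : ℝ → ℝ) → ℝ → Set
IsSupremum D f s =
  (∀ p → D p → f p ≤ᵣ s) × (∀ t → t <ᵣ s → ∃[ p ] D p × t <ᵣ f p)

]0,1[ : ℝ → Set
]0,1[ p = 0ᵣ <ᵣ p × p <ᵣ 1ᵣ

------------------------------------------------------------------------
-- Reachability in a finite digraph is decidable, by eliminating vertices.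

private
  module _ {m} (R : Rel (Fin (suc m)) 0ℓ) where

    Elim : Rel (Fin m) 0ℓ
    Elim i j = R (suc i) (suc j) ⊎ (R (suc i) zero × R zero (suc j))

    elim  : ∀ {i j} → Star R (suc i) (suc j) → Star Elim i j
    elim₀ : ∀ {i j} → R (suc i) zero → Star R zero (suc j) → Star Elim i j
    elim ε                      = ε
    elim (_◅_ {j = zero}  r rs) = elim₀ r rs
    elim (_◅_ {j = suc _} r rs) = inj₁ r ◅ elim rs
    elim₀ r (_◅_ {j = zero}  _  rs) = elim₀ r rs
    elim₀ r (_◅_ {j = suc _} r′ rs) = inj₂ (r , r′) ◅ elim rs

    restore : ∀ {i j} → Star Elim i j → Star R (suc i) (suc j)
    restore ε                     = ε
    restore (inj₁ r ◅ rs)         = r ◅ restore rs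
    restore (inj₂ (r , r′) ◅ rs)  = r ◅ r′ ◅ restore rs

    leave : ∀ {j} → Star R zero (suc j) → ∃[ k ] R zero (suc k) × Star Elim k j
    leave (_◅_ {j = zero}  _ rs) = leave rs
    leave (_◅_ {j = suc k} r rs) = k , r , elim rs

    enter : ∀ {i} → Star R (suc i) zero → ∃[ k ] Star Elim i k × R (suc k) zero
    enter {i} (_◅_ {j = zero}  r rs) = i , ε , r
    enter     (_◅_ {j = suc _} r rs) with enter rs
    ... | k , es , r′ = k , inj₁ r ◅ es , r′

star? : ∀ {m} {R : Rel (Fin m) 0ℓ} → Decidable R → Decidable (Star R)
star? {suc m} {R} R? = go
  where
  elim? : Decidable (Elim R)
  elim? i j = R? (suc i) (suc j) ⊎-dec (R? (suc i) zero ×-dec R? zero (suc j))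

  go : Decidable (Star R)
  go zero    zero    = yes ε
  go zero    (suc j) = map′ (λ (k , r , rs) → r ◅ restore R rs) (leave R)
    (any? λ k → R? zero (suc k) ×-dec star? elim? k j)
  go (suc i) zero    = map′ (λ (k , rs , r) → restore R rs ◅◅ (r ◅ ε)) (enter R)
    (any? λ k → star? elim? i k ×-dec R? (suc k) zero)
  go (suc i) (suc j) = map′ (restore R) (elim R) (star? elim? i j)

record Graph : Set₁ where
  infix 4 _∼_ _∼?_
  field
    order    : ℕ
    _∼_      : Rel (Fin order) 0ℓ
    _∼?_     : Decidable _∼_
    ∼-sym    : Symmetric _∼_
    ∼-irrefl : Irreflexive _≡_ _∼_

module _ (G : Graph) where

  open Graph G

  -- A configuration is the set of its open vertices.
  Config : Set
  Config = Subset order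

  OpenEdge : Config → Rel (Fin order) 0ℓ
  OpenEdge S u v = u ∈ S × v ∈ S × u ∼ v

  Connected : Config → Rel (Fin order) 0ℓ
  Connected S = Star (OpenEdge S)

  connected? : ∀ S → Decidable (Connected S)
  connected? S = star? λ u v → (u ∈? S) ×-dec ((v ∈? S) ×-dec (u ∼? v))

  -- Deduplication keeps exactly one open vertex of each component.
  numComponents : Config → ℕ
  numComponents S = length (deduplicate (connected? S) (filter (_∈? S) (allFin order)))

configurations : ∀ m → List (Subset m)
configurations zero    = [] ∷ []
configurations (suc m) =
  List.map (inside ∷_) (configurations m) ++ List.map (outside ∷_) (configurations m)

probability : ℝ → ∀ {m} → Subset m → ℝ
probability p S = Vec.foldr _ _*ᵣ_ 1ᵣ (Vec.map factor S)
  where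
  factor : Side → ℝ
  factor inside  = p
  factor outside = 1ᵣ -ᵣ p

expectation : ℝ → ∀ {m} → (Subset m → ℝ) → ℝ
expectation p {m} X =
  List.foldr _+ᵣ_ 0ᵣ (List.map (λ S → probability p S *ᵣ X S) (configurations m))

𝔼[C_] : Graph → ℝ → ℝ
𝔼[C G ] p = expectation p (λ S → fromℕ (numComponents G S))

module _ (n : ℕ) where

  data Step : Rel (Fin n × Fin n) 0ℓ where
    right : ∀ {i j i′ j′} → toℕ i′ ≡ suc (toℕ i) → toℕ j′ ≡ toℕ j       → Step (i , j) (i′ , j′)
    up    : ∀ {i j i′ j′} → toℕ i′ ≡ toℕ i       → toℕ j′ ≡ suc (toℕ j) → Step (i , j) (i′ , j′)
    diag  : ∀ {i j i′ j′} → toℕ i′ ≡ suc (toℕ i) → suc (toℕ j′) ≡ toℕ j → Step (i , j) (i′ , j′)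

  private
    step? : Decidable Step
    step? (i , j) (i′ , j′) = map′
      (λ { (inj₁ (a , b)) → right a b ; (inj₂ (inj₁ (a , b))) → up a b ; (inj₂ (inj₂ (a , b))) → diag a b })
      (λ { (right a b) → inj₁ (a , b) ; (up a b) → inj₂ (inj₁ (a , b)) ; (diag a b) → inj₂ (inj₂ (a , b)) })
      (((toℕ i′ ℕ.≟ suc (toℕ i)) ×-dec (toℕ j′ ℕ.≟ toℕ j)) ⊎-dec
       (((toℕ i′ ℕ.≟ toℕ i) ×-dec (toℕ j′ ℕ.≟ suc (toℕ j))) ⊎-dec
        ((toℕ i′ ℕ.≟ suc (toℕ i)) ×-dec (suc (toℕ j′) ℕ.≟ toℕ j))))

    step-irrefl : ∀ {v} → ¬ Step v v
    step-irrefl (right e _) = ℕ.1+n≢n (sym e)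
    step-irrefl (up _ e)    = ℕ.1+n≢n (sym e)
    step-irrefl (diag e _)  = ℕ.1+n≢n (sym e)

  -- remQuot n is the bijection Fin (n * n) ↔ Fin n × Fin n; coordinates
  -- run over 0, …, n - 1.
  position : Fin (n ℕ.* n) → Fin n × Fin n
  position = remQuot n

  triangularLattice : Graph
  triangularLattice = record
    { order    = n ℕ.* n
    ; _∼_      = λ u v → Step (position u) (position v) ⊎ Step (position v) (position u)
    ; _∼?_     = λ u v → step? (position u) (position v) ⊎-dec step? (position v) (position u)
    ; ∼-sym    = swap
    ; ∼-irrefl = λ { refl (inj₁ s) → step-irrefl s ; refl (inj₂ s) → step-irrefl s }
    }

-- Add the vertices in lexicographic order.  A new open vertex v = (i , j) has
-- the earlier neighbours a = (i - 1 , j + 1), b = (i - 1 , j) and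
-- c = (i , j - 1), where b is adjacent to a and c.  Hence v starts a new
-- cluster when a, b, c are all closed, it may merge two clusters when only b
-- is closed, and otherwise the number of clusters does not change.  In the
-- second case a merger certainly occurs when the remaining earlier neighbours
-- d = (i , j - 2) and e = (i - 1 , j - 1) of c are closed, and certainly does
-- not occur when the rest of the hexagon around b, consisting of e,
-- f = (i - 2 , j + 1) and g = (i - 2 , j), is open.  With q = 1 - p this yields
--   p q³ - p³ q + p⁶ q - O(1/n) ≤ 𝔼[C_p] / n² ≤ p q³ - p³ q³ + O(1/n);
-- the right-hand side is below 0.101 for all p, and the left-hand side exceeds
-- 0.09629 at p = 0.212.
--
-- Cutting a box in two changes the number of clusters by at most the number of
-- vertices next to the cut.  Comparing boxes of sides m and n with their
-- common multiples gives 𝔼[C_p] / n² ≤ 𝔼[C_p] / m² + 4/n on the respective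
-- lattices, uniformly in p, so the suprema form a Cauchy sequence.  The
-- suprema exist constructively because 𝔼[C_p] is Lipschitz in p.
module Submission where

open import Defs
open import Data.Bool.Base using (Bool; true; false; _∧_; not; if_then_else_)
open import Data.Fin.Base as Fin using (Fin; zero; suc; toℕ; fromℕ<; combine; remQuot; splitAt; _↑ˡ_; _↑ʳ_)
import Data.Fin.Properties as Fin
open import Data.Fin.Subset using (Subset; inside; outside; _∈_)
open import Data.Fin.Subset.Properties using (_∈?_)
open import Data.Integer.Base as ℤ using (+_)
import Data.Integer.Properties as ℤ
open import Data.List.Base as List using (List; []; _∷_; _++_; length; deduplicate; allFin)
import Data.List.Properties as List
open import Data.List.Membership.Propositional using (find) renaming (_∈_ to _∈ˡ_)
import Data.List.Membership.Propositional.Properties as ∈ˡ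
open import Data.List.Relation.Binary.Permutation.Propositional using (_↭_; ↭⇒↭ₛ)
import Data.List.Relation.Binary.Permutation.Propositional.Properties as ↭
import Data.List.Relation.Binary.Permutation.Setoid.Properties as ↭ₛ
open import Data.List.Relation.Unary.All as All using (All; []; _∷_)
import Data.List.Relation.Unary.All.Properties as All
open import Data.List.Relation.Unary.AllPairs as AllPairs using (AllPairs; []; _∷_)
import Data.List.Relation.Unary.AllPairs.Properties as AllPairs
open import Data.List.Relation.Unary.Any as Any using (Any; here; there)
import Data.List.Relation.Unary.Any.Properties as Any
open import Data.Nat.Base using (ℕ; zero; suc; _+_; _*_; _≤_; _<_; _⊔_; _⊓_; _∸_; z≤n; s≤s)
import Data.Nat.Properties as ℕ
open import Data.Nat.Tactic.RingSolver using (solve-∀)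
open import Data.Product.Base using (Σ-syntax; ∃-syntax; _×_; _,_; proj₁; proj₂)
open import Data.Product.Properties using (≡-dec)
open import Data.Rational.Base as ℚ using (ℚ; 0ℚ; 1ℚ; ½; _/_)
import Data.Rational.Properties as ℚ
import Data.Rational.Unnormalised.Base as ℚᵘ
import Data.Rational.Unnormalised.Properties as ℚᵘ
open import Data.Rational.Solver using (module +-*-Solver)
open import Data.Sum.Base using (_⊎_; inj₁; inj₂; swap; [_,_])
open import Data.Vec.Base as Vec using ([]; _∷_; lookup; tabulate)
import Data.Vec.Properties as Vec
open import Function.Base using (_∘_; id)
open import Function.Definitions using (Injective)
open import Level using (0ℓ)
open import Relation.Binary.Construct.Closure.ReflexiveTransitive as Star using (Star; ε; _◅_; _◅◅_)
open import Relation.Binary.Core using (Rel)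
open import Relation.Binary.Definitions using (Decidable; DecidableEquality; Reflexive; Symmetric; Transitive)
open import Relation.Binary.PropositionalEquality hiding ([_])
open import Relation.Nullary.Decidable using (Dec; yes; no; does; _×-dec_; _⊎-dec_; _→-dec_; dec-true; dec-false; from-yes)
open import Relation.Nullary.Negation using (¬_; contradiction)
open +-*-Solver using (solve; con; _:+_; _:-_; :-_; _:*_; _:=_)

-- Systems of representatives and union-find

-- Both correction terms are essential. The maximum of `p q³` alone is 0.1054..., above the required
-- 0.10107, and that of `p q³ - p³ q` is 0.09622..., below the required 0.09629. The hexagon term
-- adds about 0.00007 near the optimum, which leaves a margin of only about 0.000006. The sweep does
-- not follow the set of clusters from vertex to vertex. It follows the Euler count, vertices minus
-- edges plus redundant edges, where an edge is redundant if the edges added before it already link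
-- its ends. The effect of a new vertex is then a finite case analysis on which of its at most three
-- links are redundant. The Euler count is identified with the number of clusters only once, for the
-- whole box. All these inequalities are arranged in natural numbers without subtraction.
-- Probability is done at rational parameters only: the expectation at a real `p` is computed
-- termwise from the approximations of `p`, so inequalities that hold on the rational unit interval
-- carry over to real parameters.

module _ {A : Set} {R : Rel A 0ℓ} (R-sym : Symmetric R) (R-trans : Transitive R) where

  -- Pigeonhole: two independent elements are never covered by the same y.
  independent≤covering : ∀ {xs} ys → AllPairs (λ x y → ¬ R x y) xs →
    All (λ x → Any (R x) ys) xs → length xs ≤ length ys
  independent≤covering ys []             []             = z≤n
  independent≤covering ys (x≁xs ∷ xs-ind) (x~ys ∷ xs~ys) with find x~ys
  ... | y , y∈ys , x~y with ∈ˡ.∈-∃++ y∈ys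
  ... | us , vs , refl = begin
    suc _                       ≤⟨ s≤s (independent≤covering (us ++ vs) xs-ind (avoid-y x≁xs xs~ys)) ⟩
    suc (length (us ++ vs))     ≡⟨ ↭.↭-length (↭.shift y us vs) ⟨
    length (us ++ y ∷ vs)       ∎
    where
    open ℕ.≤-Reasoning
    avoid : ∀ {z} → ¬ R _ z → Any (R z) (us ++ y ∷ vs) → Any (R z) (us ++ vs)
    avoid x≁z z~ys with ↭.Any-resp-↭ (↭.shift y us vs) z~ys
    ... | here z~y = contradiction (R-trans x~y (R-sym z~y)) x≁z
    ... | there z~ = z~
    avoid-y : ∀ {zs} → All (λ z → ¬ R _ z) zs → All (λ z → Any (R z) (us ++ y ∷ vs)) zs →
      All (λ z → Any (R z) (us ++ vs)) zs
    avoid-y []       []       = []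
    avoid-y (n ∷ ns) (c ∷ cs) = avoid n c ∷ avoid-y ns cs

-- The number of R-classes of P is witnessed by a system of representatives.
record Classes {A : Set} (P : A → Set) (R : Rel A 0ℓ) (n : ℕ) : Set where
  constructor mkClasses
  field
    reps        : List A
    reps∈P      : All P reps
    independent : AllPairs (λ x y → ¬ R x y) reps
    covering    : ∀ y → P y → Any (R y) reps
    #reps       : length reps ≡ n

open Classes

module _ {A : Set} {P Q : A → Set} {R T : Rel A 0ℓ} (T-sym : Symmetric T) (T-trans : Transitive T)
         (P⊆Q : ∀ {x} → P x → Q x) (T⊆R : ∀ {x y} → P x → P y → T x y → R x y) where

  -- Representatives for `R` stay inequivalent under the finer `T` and are covered by the
  -- representatives for `T`, so the pigeonhole applies. Used in both directions, this shows that
  -- the number of classes does not depend on the chosen representatives.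
  Classes-≤ : ∀ {m n} → Classes P R m → Classes Q T n → m ≤ n
  Classes-≤ c d = subst₂ _≤_ (#reps c) (#reps d)
    (independent≤covering T-sym T-trans (reps d) (lift (reps∈P c) (independent c))
      (All.map (λ {x} px → covering d x (P⊆Q px)) (reps∈P c)))
    where
    lift₁ : ∀ {x xs} → P x → All P xs → All (λ y → ¬ R x y) xs → All (λ y → ¬ T x y) xs
    lift₁ px []         []       = []
    lift₁ px (py ∷ pys) (n ∷ ns) = (λ t → n (T⊆R px py t)) ∷ lift₁ px pys ns
    lift : ∀ {xs} → All P xs → AllPairs (λ x y → ¬ R x y) xs → AllPairs (λ x y → ¬ T x y) xs
    lift []         []       = []
    lift (px ∷ pxs) (n ∷ ns) = lift₁ px pxs n ∷ lift pxs ns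

Classes-image : ∀ {A B : Set} {P : A → Set} {R : Rel A 0ℓ} {R′ : Rel B 0ℓ} (f : A → B) →
  (∀ {x y} → R x y → R′ (f x) (f y)) → (∀ {x y} → R′ (f x) (f y) → R x y) →
  ∀ {n} → Classes P R n → Classes (λ y → ∃[ x ] P x × f x ≡ y) R′ n
Classes-image f R⇒ R⇐ c = mkClasses (List.map f (reps c))
  (All.map⁺ (All.map (λ px → _ , px , refl) (reps∈P c)))
  (AllPairs.map⁺ (AllPairs.map (λ n r → n (R⇐ r)) (independent c)))
  (λ { _ (x , px , refl) → Any.map⁺ (Any.map R⇒ (covering c x px)) })
  (trans (List.length-map f (reps c)) (#reps c))

Classes-cong : ∀ {A : Set} {P Q : A → Set} {R T : Rel A 0ℓ} → (∀ {x} → P x → Q x) → (∀ {x} → Q x → P x) →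
  (∀ {x y} → R x y → T x y) → (∀ {x y} → T x y → R x y) → ∀ {n} → Classes P R n → Classes Q T n
Classes-cong P⇒Q Q⇒P R⇒T T⇒R c = mkClasses (reps c) (All.map P⇒Q (reps∈P c))
  (AllPairs.map (λ n t → n (T⇒R t)) (independent c)) (λ y qy → Any.map R⇒T (covering c y (Q⇒P qy))) (#reps c)

-- Components of a configuration

module _ (G : Graph) (S : Config G) where
  open Graph G

  Connected-sym : Symmetric (Connected G S)
  Connected-sym = Star.reverse (λ (u∈S , v∈S , u∼v) → v∈S , u∈S , ∼-sym u∼v)

  private
    deduplicate-independent : ∀ us →
      AllPairs (λ u v → ¬ Connected G S u v) (deduplicate (connected? G S) us)
    deduplicate-independent []       = []
    deduplicate-independent (u ∷ us) =
      All.all-filter _ (deduplicate (connected? G S) us) ∷ AllPairs.filter⁺ _ (deduplicate-independent us)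

  components : Classes (_∈ S) (Connected G S) (numComponents G S)
  components = mkClasses _
    (All.deduplicate⁺ (connected? G S) (All.all-filter (_∈? S) (allFin order)))
    (deduplicate-independent _)
    (λ u u∈S → Any.deduplicate⁺ (connected? G S) (λ x~y u~y → u~y ◅◅ Connected-sym x~y)
      (Any.map (λ { refl → ε }) (∈ˡ.∈-filter⁺ (_∈? S) (∈ˡ.∈-allFin u) u∈S)))
    refl

indicator : Bool → ℕ
indicator true  = 1
indicator false = 0

-- The equivalence relation generated by a list of edges

module _ {A : Set} where

  -- The equivalence closure of the edges, by recursion on the list. One crossing of the newest edge
  -- suffices, since a path that crosses it more often can be shortened. In this form the relation
  -- is decidable by recursion, and the effect of one new edge can be read off by matching.
  Linked : List (A × A) → Rel A 0ℓ
  Linked []            x y = x ≡ y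
  Linked ((u , v) ∷ E) x y =
    Linked E x y ⊎ (Linked E x u × Linked E v y) ⊎ (Linked E x v × Linked E u y)

  Linked-refl : ∀ E {x} → Linked E x x
  Linked-refl []      = refl
  Linked-refl (_ ∷ E) = inj₁ (Linked-refl E)

  Linked-sym : ∀ E {x y} → Linked E x y → Linked E y x
  Linked-sym []      refl                   = refl
  Linked-sym (_ ∷ E) (inj₁ r)               = inj₁ (Linked-sym E r)
  Linked-sym (_ ∷ E) (inj₂ (inj₁ (r , r′))) = inj₂ (inj₂ (Linked-sym E r′ , Linked-sym E r))
  Linked-sym (_ ∷ E) (inj₂ (inj₂ (r , r′))) = inj₂ (inj₁ (Linked-sym E r′ , Linked-sym E r))

  Linked-trans : ∀ E {x y z} → Linked E x y → Linked E y z → Linked E x z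
  Linked-trans []      refl refl = refl
  Linked-trans (_ ∷ E) (inj₁ r) (inj₁ s) = inj₁ (Linked-trans E r s)
  Linked-trans (_ ∷ E) (inj₁ r) (inj₂ (inj₁ (s , s′))) = inj₂ (inj₁ (Linked-trans E r s , s′))
  Linked-trans (_ ∷ E) (inj₁ r) (inj₂ (inj₂ (s , s′))) = inj₂ (inj₂ (Linked-trans E r s , s′))
  Linked-trans (_ ∷ E) (inj₂ (inj₁ (r , r′))) (inj₁ s) = inj₂ (inj₁ (r , Linked-trans E r′ s))
  Linked-trans (_ ∷ E) (inj₂ (inj₂ (r , r′))) (inj₁ s) = inj₂ (inj₂ (r , Linked-trans E r′ s))
  Linked-trans (_ ∷ E) (inj₂ (inj₁ (r , _))) (inj₂ (inj₁ (_ , s′))) = inj₂ (inj₁ (r , s′))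
  Linked-trans (_ ∷ E) (inj₂ (inj₁ (r , _))) (inj₂ (inj₂ (_ , s′))) = inj₁ (Linked-trans E r s′)
  Linked-trans (_ ∷ E) (inj₂ (inj₂ (r , _))) (inj₂ (inj₁ (_ , s′))) = inj₁ (Linked-trans E r s′)
  Linked-trans (_ ∷ E) (inj₂ (inj₂ (r , _))) (inj₂ (inj₂ (_ , s′))) = inj₂ (inj₂ (r , s′))

  Linked-∷ : ∀ {x y} E → Linked ((x , y) ∷ E) x y
  Linked-∷ E = inj₂ (inj₁ (Linked-refl E , Linked-refl E))

  edge⇒Linked : ∀ {x y} E → (x , y) ∈ˡ E → Linked E x y
  edge⇒Linked (_ ∷ E) (here refl) = Linked-∷ E
  edge⇒Linked (_ ∷ E) (there e∈E) = inj₁ (edge⇒Linked E e∈E)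

  -- Together with `edge⇒Linked` this characterises `Linked` as an equivalence closure; it is the
  -- way back from edge lists to lattice paths.
  Linked-minimal : ∀ {Q : Rel A 0ℓ} → Reflexive Q → Symmetric Q → Transitive Q → ∀ E →
    (∀ {x y} → (x , y) ∈ˡ E → Q x y) → ∀ {x y} → Linked E x y → Q x y
  Linked-minimal {Q} Q-refl Q-sym Q-trans = go
    where
    go : ∀ E → (∀ {x y} → (x , y) ∈ˡ E → Q x y) → ∀ {x y} → Linked E x y → Q x y
    go []      E⊆Q refl     = Q-refl
    go (_ ∷ E) E⊆Q (inj₁ r) = go E (E⊆Q ∘ there) r
    go (_ ∷ E) E⊆Q (inj₂ (inj₁ (r , r′))) =
      Q-trans (go E (E⊆Q ∘ there) r) (Q-trans (E⊆Q (here refl)) (go E (E⊆Q ∘ there) r′))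
    go (_ ∷ E) E⊆Q (inj₂ (inj₂ (r , r′))) =
      Q-trans (go E (E⊆Q ∘ there) r) (Q-trans (Q-sym (E⊆Q (here refl))) (go E (E⊆Q ∘ there) r′))

  Endpoint : A → A × A → Set
  Endpoint x (u , v) = x ≡ u ⊎ x ≡ v

  Linked-isolated : ∀ E {x y} → ¬ Any (Endpoint x) E → Linked E x y → x ≡ y
  Linked-isolated []      x∉E r = r
  Linked-isolated (_ ∷ E) x∉E (inj₁ r) = Linked-isolated E (x∉E ∘ there) r
  Linked-isolated (_ ∷ E) x∉E (inj₂ (inj₁ (r , _))) =
    contradiction (here (inj₁ (Linked-isolated E (x∉E ∘ there) r))) x∉E
  Linked-isolated (_ ∷ E) x∉E (inj₂ (inj₂ (r , _))) =
    contradiction (here (inj₂ (Linked-isolated E (x∉E ∘ there) r))) x∉E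

  module UnionFind (_≟_ : DecidableEquality A) where

    linked? : ∀ E → Decidable (Linked E)
    linked? []            x y = x ≟ y
    linked? ((u , v) ∷ E) x y =
      linked? E x y ⊎-dec ((linked? E x u ×-dec linked? E v y) ⊎-dec (linked? E x v ×-dec linked? E u y))

    -- The number of edges that close a cycle when the edges are added from
    -- the end of the list to its head.
    redundant : List (A × A) → ℕ
    redundant []            = 0
    redundant ((u , v) ∷ E) = indicator (does (linked? E u v)) + redundant E

    redundant-yes : ∀ {u v} E → Linked E u v → redundant ((u , v) ∷ E) ≡ suc (redundant E)
    redundant-yes {u} {v} E r with linked? E u v
    ... | yes _ = refl
    ... | no ¬r = contradiction r ¬r

    redundant-no : ∀ {u v} E → ¬ Linked E u v → redundant ((u , v) ∷ E) ≡ redundant E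
    redundant-no {u} {v} E ¬r with linked? E u v
    ... | yes r = contradiction r ¬r
    ... | no _  = refl

    module _ {P : A → Set} where

      private
        -- The representative `y` of the class of `v` is dropped, and its class is taken over by the
        -- representative of `u`, which is not `y` because `u≁v`. The remaining representatives stay
        -- independent: a link that uses the new edge has one end in the class of `y`.
        merge : ∀ E {u v n} → P u → P v → ¬ Linked E u v → Classes P (Linked E) (suc n) →
          Classes P (Linked ((u , v) ∷ E)) n
        merge E {u} {v} pu pv u≁v c with find (covering c v pv)
        ... | y , y∈c , v~y with ∈ˡ.∈-∃++ y∈c
        ... | xs , zs , eq = mkClasses (xs ++ zs)
          (All.tail all′) (weaken (AllPairs.head ind′) (AllPairs.tail ind′)) cover
          (ℕ.suc-injective (trans (sym (↭.↭-length perm)) (#reps c)))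
          where
          perm : reps c ↭ y ∷ (xs ++ zs)
          perm = subst (_↭ y ∷ (xs ++ zs)) (sym eq) (↭.shift y xs zs)
          all′ = ↭.All-resp-↭ perm (reps∈P c)
          ind′ = ↭ₛ.AllPairs-resp-↭ (setoid A) (λ n r → n (Linked-sym E r))
            ((λ { refl n → n }) , (λ { refl n → n })) (↭⇒↭ₛ perm) (independent c)
          T = Linked ((u , v) ∷ E)
          weaken₁ : ∀ {x ws} → ¬ Linked E y x → All (λ w → ¬ Linked E y w) ws →
            All (λ w → ¬ Linked E x w) ws → All (λ w → ¬ T x w) ws
          weaken₁ y≁x []         []         = []
          weaken₁ {x} y≁x (y≁w ∷ y≁) (x≁w ∷ x≁) = x≁w′ ∷ weaken₁ y≁x y≁ x≁
            where
            x≁w′ : ¬ T x _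
            x≁w′ (inj₁ r)              = x≁w r
            x≁w′ (inj₂ (inj₁ (_ , r))) = y≁w (Linked-trans E (Linked-sym E v~y) r)
            x≁w′ (inj₂ (inj₂ (r , _))) = y≁x (Linked-sym E (Linked-trans E r v~y))
          weaken : ∀ {ws} → All (λ w → ¬ Linked E y w) ws → AllPairs (λ x w → ¬ Linked E x w) ws →
            AllPairs (λ x w → ¬ T x w) ws
          weaken []         []         = []
          weaken (y≁x ∷ y≁) (x≁ ∷ ind) = weaken₁ y≁x y≁ x≁ ∷ weaken y≁ ind
          rep-u : Any (Linked E u) (xs ++ zs)
          rep-u with ↭.Any-resp-↭ perm (covering c u pu)
          ... | here u~y = contradiction (Linked-trans E u~y (Linked-sym E v~y)) u≁v
          ... | there r  = r
          cover : ∀ w → P w → Any (T w) (xs ++ zs)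
          cover w pw with ↭.Any-resp-↭ perm (covering c w pw)
          ... | here w~y = Any.map
            (λ u~x → inj₂ (inj₂ (Linked-trans E w~y (Linked-sym E v~y) , u~x))) rep-u
          ... | there r  = Any.map inj₁ r

        drop-edge : ∀ E {u v x y} → Linked E u v → Linked ((u , v) ∷ E) x y → Linked E x y
        drop-edge E u~v (inj₁ r) = r
        drop-edge E u~v (inj₂ (inj₁ (r , r′))) = Linked-trans E r (Linked-trans E u~v r′)
        drop-edge E u~v (inj₂ (inj₂ (r , r′))) = Linked-trans E r (Linked-trans E (Linked-sym E u~v) r′)

        nonempty : ∀ {n x} {R : Rel A 0ℓ} → P x → Classes P R n → ∃[ k ] n ≡ suc k
        nonempty {x = x} px (mkClasses (_ ∷ _) _ _ _ eq) = _ , sym eq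
        nonempty {x = x} px (mkClasses []      _ _ c _) with () ← c x px

      -- The Euler-type count of classes: every edge merges two classes
      -- unless it is redundant.
      union-find : ∀ {V} → All P V → AllPairs _≢_ V → (∀ x → P x → x ∈ˡ V) → ∀ E →
        All (λ (u , v) → P u × P v) E →
        ∃[ n ] Classes P (Linked E) n × n + length E ≡ length V + redundant E
      union-find {V} V⊆P V! P⊆V [] [] = length V , mkClasses V V⊆P V! P⊆V refl , refl
      union-find {V} V⊆P V! P⊆V ((u , v) ∷ E) ((pu , pv) ∷ E⊆P)
        with union-find V⊆P V! P⊆V E E⊆P | linked? E u v
      ... | n , c , eq | yes u~v = n ,
        mkClasses (reps c) (reps∈P c) (AllPairs.map (λ n r → n (drop-edge E u~v r)) (independent c))
          (λ y py → Any.map inj₁ (covering c y py)) (#reps c) ,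
        trans (ℕ.+-suc n _) (trans (cong suc eq) (sym (ℕ.+-suc (length V) _)))
      ... | n , c , eq | no u≁v with nonempty pu c
      ... | k , refl = k , merge E pu pv u≁v c , trans (ℕ.+-suc k _) eq

-- Rational arithmetic and finite expectations


≤-by : ∀ {x y} d → 0ℚ ℚ.≤ d → y ≡ x ℚ.+ d → x ℚ.≤ y
≤-by {x} {y} d 0≤d y≡x+d = begin
  x           ≡⟨ ℚ.+-identityʳ x ⟨
  x ℚ.+ 0ℚ    ≤⟨ ℚ.+-monoʳ-≤ x 0≤d ⟩
  x ℚ.+ d     ≡⟨ y≡x+d ⟨
  y           ∎
  where open ℚ.≤-Reasoning

x≤y⇒0≤y-x : ∀ {x y} → x ℚ.≤ y → 0ℚ ℚ.≤ y ℚ.- x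
x≤y⇒0≤y-x {x} {y} x≤y = subst (ℚ._≤ y ℚ.- x) (ℚ.+-inverseʳ x) (ℚ.+-monoˡ-≤ (ℚ.- x) x≤y)

0≤+ : ∀ {x y} → 0ℚ ℚ.≤ x → 0ℚ ℚ.≤ y → 0ℚ ℚ.≤ x ℚ.+ y
0≤+ = ℚ.+-mono-≤

0≤* : ∀ {x y} → 0ℚ ℚ.≤ x → 0ℚ ℚ.≤ y → 0ℚ ℚ.≤ x ℚ.* y
0≤* {x} {y} 0≤x 0≤y = subst (ℚ._≤ x ℚ.* y) (ℚ.*-zeroʳ x)
  (ℚ.*-monoˡ-≤-nonNeg x {{ℚ.nonNegative 0≤x}} 0≤y)

0<* : ∀ {x y} → 0ℚ ℚ.< x → 0ℚ ℚ.< y → 0ℚ ℚ.< x ℚ.* y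
0<* {x} {y} 0<x 0<y = subst (ℚ._< x ℚ.* y) (ℚ.*-zeroʳ x)
  (ℚ.*-monoʳ-<-pos x {{ℚ.positive 0<x}} 0<y)

*-monoˡ-≤ : ∀ {x y z} → 0ℚ ℚ.≤ z → x ℚ.≤ y → z ℚ.* x ℚ.≤ z ℚ.* y
*-monoˡ-≤ {z = z} 0≤z = ℚ.*-monoˡ-≤-nonNeg z {{ℚ.nonNegative 0≤z}}

⟪_⟫ : ℕ → ℚ
⟪ n ⟫ = + n / 1

private
  toℚᵘ-⟪⟫ : ∀ n → ℚ.toℚᵘ ⟪ n ⟫ ℚᵘ.≃ ℚᵘ.mkℚᵘ (+ n) 0
  toℚᵘ-⟪⟫ n = ℚ.toℚᵘ-fromℚᵘ (ℚᵘ.mkℚᵘ (+ n) 0)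

abstract
  ⟪⟫-+ : ∀ m n → ⟪ m + n ⟫ ≡ ⟪ m ⟫ ℚ.+ ⟪ n ⟫
  ⟪⟫-+ m n = ℚ.toℚᵘ-injective (begin
    ℚ.toℚᵘ ⟪ m + n ⟫                                ≈⟨ toℚᵘ-⟪⟫ (m + n) ⟩
    ℚᵘ.mkℚᵘ (+ (m + n)) 0                            ≈⟨ ℚᵘ.*≡* (cong (ℤ._* (+ 1))
                                                          (cong₂ ℤ._+_ (sym (ℤ.*-identityʳ (+ m))) (sym (ℤ.*-identityʳ (+ n))))) ⟩
    ℚᵘ.mkℚᵘ (+ m) 0 ℚᵘ.+ ℚᵘ.mkℚᵘ (+ n) 0            ≈⟨ ℚᵘ.+-cong (toℚᵘ-⟪⟫ m) (toℚᵘ-⟪⟫ n) ⟨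
    ℚ.toℚᵘ ⟪ m ⟫ ℚᵘ.+ ℚ.toℚᵘ ⟪ n ⟫                   ≈⟨ ℚ.toℚᵘ-homo-+ ⟪ m ⟫ ⟪ n ⟫ ⟨
    ℚ.toℚᵘ (⟪ m ⟫ ℚ.+ ⟪ n ⟫)                         ∎)
    where open ℚᵘ.≃-Reasoning

  ⟪⟫-* : ∀ m n → ⟪ m * n ⟫ ≡ ⟪ m ⟫ ℚ.* ⟪ n ⟫
  ⟪⟫-* zero    n = sym (ℚ.*-zeroˡ ⟪ n ⟫)
  ⟪⟫-* (suc m) n = begin
    ⟪ n + m * n ⟫                       ≡⟨ ⟪⟫-+ n (m * n) ⟩
    ⟪ n ⟫ ℚ.+ ⟪ m * n ⟫                 ≡⟨ cong₂ ℚ._+_ (sym (ℚ.*-identityˡ ⟪ n ⟫)) (⟪⟫-* m n) ⟩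
    1ℚ ℚ.* ⟪ n ⟫ ℚ.+ ⟪ m ⟫ ℚ.* ⟪ n ⟫    ≡⟨ ℚ.*-distribʳ-+ ⟪ n ⟫ 1ℚ ⟪ m ⟫ ⟨
    (1ℚ ℚ.+ ⟪ m ⟫) ℚ.* ⟪ n ⟫            ≡⟨ cong (ℚ._* ⟪ n ⟫) (⟪⟫-+ 1 m) ⟨
    ⟪ suc m ⟫ ℚ.* ⟪ n ⟫                 ∎
    where open ≡-Reasoning

  0≤⟪⟫ : ∀ n → 0ℚ ℚ.≤ ⟪ n ⟫
  0≤⟪⟫ zero    = ℚ.≤-refl
  0≤⟪⟫ (suc n) = subst (0ℚ ℚ.≤_) (sym (⟪⟫-+ 1 n)) (0≤+ (ℚ.nonNegative⁻¹ 1ℚ) (0≤⟪⟫ n))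

  ⟪⟫-mono : ∀ {m n} → m ≤ n → ⟪ m ⟫ ℚ.≤ ⟪ n ⟫
  ⟪⟫-mono {m} {n} m≤n = ≤-by ⟪ n ∸ m ⟫ (0≤⟪⟫ (n ∸ m))
    (trans (cong ⟪_⟫ (sym (ℕ.m+[n∸m]≡n m≤n))) (⟪⟫-+ m (n ∸ m)))

  0<⟪suc⟫ : ∀ n → 0ℚ ℚ.< ⟪ suc n ⟫
  0<⟪suc⟫ n = ℚ.<-≤-trans (ℚ.positive⁻¹ 1ℚ) (⟪⟫-mono (s≤s (z≤n {n})))

⟦0,1⟧ : ℚ → Set
⟦0,1⟧ p = 0ℚ ℚ.≤ p × p ℚ.≤ 1ℚ

-- Expectation over independent vertices at a rational parameter

sumℚ : ∀ {A : Set} → List A → (A → ℚ) → ℚ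
sumℚ []       f = 0ℚ
sumℚ (x ∷ xs) f = f x ℚ.+ sumℚ xs f

-- Conditioning on one vertex at a time, instead of summing over `configurations`, makes every
-- property of the expectation an induction on the number of vertices.
E : ℚ → ∀ {m} → (Subset m → ℚ) → ℚ
E p {zero}  X = X []
E p {suc m} X = p ℚ.* E p (λ S → X (inside ∷ S)) ℚ.+ (1ℚ ℚ.- p) ℚ.* E p (λ S → X (outside ∷ S))

E-cong : ∀ p {m} {X Y : Subset m → ℚ} → (∀ S → X S ≡ Y S) → E p X ≡ E p Y
E-cong p {zero}  X≗Y = X≗Y []
E-cong p {suc m} X≗Y = cong₂ (λ x y → p ℚ.* x ℚ.+ (1ℚ ℚ.- p) ℚ.* y)
  (E-cong p (λ S → X≗Y (inside ∷ S))) (E-cong p (λ S → X≗Y (outside ∷ S)))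

E-const : ∀ p m c → E p {m} (λ _ → c) ≡ c
E-const p zero    c = refl
E-const p (suc m) c = trans (cong (λ x → p ℚ.* x ℚ.+ (1ℚ ℚ.- p) ℚ.* x) (E-const p m c)) (lemma p c)
  where
  lemma : ∀ p c → p ℚ.* c ℚ.+ (1ℚ ℚ.- p) ℚ.* c ≡ c
  lemma = solve 2 (λ p c → p :* c :+ (con 1ℚ :- p) :* c := c) refl

E-+ : ∀ p {m} (X Y : Subset m → ℚ) → E p (λ S → X S ℚ.+ Y S) ≡ E p X ℚ.+ E p Y
E-+ p {zero}  X Y = refl
E-+ p {suc m} X Y = trans
  (cong₂ (λ x y → p ℚ.* x ℚ.+ (1ℚ ℚ.- p) ℚ.* y) (E-+ p (X ∘ (inside ∷_)) (Y ∘ (inside ∷_)))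
    (E-+ p (X ∘ (outside ∷_)) (Y ∘ (outside ∷_))))
  (lemma p (E p (X ∘ (inside ∷_))) (E p (Y ∘ (inside ∷_))) (E p (X ∘ (outside ∷_))) (E p (Y ∘ (outside ∷_))))
  where
  lemma : ∀ p a b c d → p ℚ.* (a ℚ.+ b) ℚ.+ (1ℚ ℚ.- p) ℚ.* (c ℚ.+ d) ≡
    (p ℚ.* a ℚ.+ (1ℚ ℚ.- p) ℚ.* c) ℚ.+ (p ℚ.* b ℚ.+ (1ℚ ℚ.- p) ℚ.* d)
  lemma = solve 5 (λ p a b c d → p :* (a :+ b) :+ (con 1ℚ :- p) :* (c :+ d) :=
    (p :* a :+ (con 1ℚ :- p) :* c) :+ (p :* b :+ (con 1ℚ :- p) :* d)) refl

E-sum : ∀ p {m} {A : Set} (xs : List A) (X : A → Subset m → ℚ) →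
  E p (λ S → sumℚ xs (λ x → X x S)) ≡ sumℚ xs (λ x → E p (X x))
E-sum p {m} []   X = E-const p m 0ℚ
E-sum p (x ∷ xs) X = trans (E-+ p (X x) _) (cong (E p (X x) ℚ.+_) (E-sum p xs X))

E-mono : ∀ {p} → ⟦0,1⟧ p → ∀ {m} {X Y : Subset m → ℚ} → (∀ S → X S ℚ.≤ Y S) → E p X ℚ.≤ E p Y
E-mono p∈          {zero}  X≤Y = X≤Y []
E-mono p∈@(0≤p , p≤1) {suc m} X≤Y = ℚ.+-mono-≤
  (*-monoˡ-≤ 0≤p (E-mono p∈ (λ S → X≤Y (inside ∷ S))))
  (*-monoˡ-≤ (x≤y⇒0≤y-x p≤1) (E-mono p∈ (λ S → X≤Y (outside ∷ S))))

select : ∀ {k m} → (Fin k → Fin m) → Subset m → Subset k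
select ι S = tabulate (λ i → lookup S (ι i))

private
  -- Conditioning on an arbitrary vertex `i` instead of the first one. Once the state of `i` is
  -- overwritten, averaging over its original state has no effect, because the weights `p` and
  -- `1ℚ - p` add up to 1.
  E-split : ∀ p {m} (i : Fin m) (X : Subset m → ℚ) → E p X ≡
    p ℚ.* E p (λ S → X (S Vec.[ i ]≔ inside)) ℚ.+ (1ℚ ℚ.- p) ℚ.* E p (λ S → X (S Vec.[ i ]≔ outside))
  E-split p {suc m} zero X = cong₂ (λ x y → p ℚ.* x ℚ.+ (1ℚ ℚ.- p) ℚ.* y)
    (sym (lemma p (E p (X ∘ (inside ∷_))))) (sym (lemma p (E p (X ∘ (outside ∷_)))))
    where
    lemma : ∀ p c → p ℚ.* c ℚ.+ (1ℚ ℚ.- p) ℚ.* c ≡ c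
    lemma = solve 2 (λ p c → p :* c :+ (con 1ℚ :- p) :* c := c) refl
  E-split p {suc m} (suc i) X = trans
    (cong₂ (λ x y → p ℚ.* x ℚ.+ (1ℚ ℚ.- p) ℚ.* y) (E-split p i (X ∘ (inside ∷_))) (E-split p i (X ∘ (outside ∷_))))
    (lemma p _ _ _ _)
    where
    lemma : ∀ p a b c d →
      p ℚ.* (p ℚ.* a ℚ.+ (1ℚ ℚ.- p) ℚ.* b) ℚ.+ (1ℚ ℚ.- p) ℚ.* (p ℚ.* c ℚ.+ (1ℚ ℚ.- p) ℚ.* d) ≡
      p ℚ.* (p ℚ.* a ℚ.+ (1ℚ ℚ.- p) ℚ.* c) ℚ.+ (1ℚ ℚ.- p) ℚ.* (p ℚ.* b ℚ.+ (1ℚ ℚ.- p) ℚ.* d)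
    lemma = solve 5 (λ p a b c d →
      p :* (p :* a :+ (con 1ℚ :- p) :* b) :+ (con 1ℚ :- p) :* (p :* c :+ (con 1ℚ :- p) :* d) :=
      p :* (p :* a :+ (con 1ℚ :- p) :* c) :+ (con 1ℚ :- p) :* (p :* b :+ (con 1ℚ :- p) :* d)) refl

-- Distinct vertices of a product configuration again form a product configuration. After
-- conditioning on vertex `ι zero`, injectivity keeps the other selected vertices away from the
-- overwritten one. This gives the law both of a part of a box and of a local pattern.
E-select : ∀ p {k m} (ι : Fin k → Fin m) → Injective _≡_ _≡_ ι → (X : Subset k → ℚ) →
  E p (λ S → X (select ι S)) ≡ E p X
E-select p {zero}  {m} ι ι-inj X = E-const p m (X [])
E-select p {suc k} ι ι-inj X = trans (E-split p (ι zero) (λ S → X (select ι S)))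
  (cong₂ (λ x y → p ℚ.* x ℚ.+ (1ℚ ℚ.- p) ℚ.* y) (condition inside) (condition outside))
  where
  condition : ∀ s → E p (λ S → X (select ι (S Vec.[ ι zero ]≔ s))) ≡ E p (λ S → X (s ∷ S))
  condition s = trans
    (E-cong p (λ S → cong X (cong₂ _∷_ (Vec.lookup∘update (ι zero) S s)
      (Vec.tabulate-cong (λ i → Vec.lookup∘update′ (λ eq → Fin.0≢1+n (sym (ι-inj eq))) S s)))))
    (E-select p (ι ∘ suc) (Fin.suc-injective ∘ ι-inj) (λ S → X (s ∷ S)))

private
  mix-close : ∀ {p p′ d b} x y → p ℚ.≤ p′ ℚ.+ d → p′ ℚ.≤ p ℚ.+ d → 0ℚ ℚ.≤ x → x ℚ.≤ b → 0ℚ ℚ.≤ y → y ℚ.≤ b →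
    (p ℚ.- p′) ℚ.* (x ℚ.- y) ℚ.≤ b ℚ.* d
  mix-close {p} {p′} {d} {b} x y p≤ p′≤ 0≤x x≤b 0≤y y≤b with ℚ.≤-total p′ p
  ... | inj₁ p′≤p = ≤-by ((b ℚ.- x ℚ.+ y) ℚ.* (p ℚ.- p′) ℚ.+ b ℚ.* (p′ ℚ.+ d ℚ.- p))
    (0≤+ (0≤* (0≤+ (x≤y⇒0≤y-x x≤b) 0≤y) (x≤y⇒0≤y-x p′≤p)) (0≤* (ℚ.≤-trans 0≤x x≤b) (x≤y⇒0≤y-x p≤)))
    (solve 6 (λ p p′ d b x y → b :* d := (p :- p′) :* (x :- y) :+
      ((b :- x :+ y) :* (p :- p′) :+ b :* (p′ :+ d :- p))) refl p p′ d b x y)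
  ... | inj₂ p≤p′ = ≤-by ((b ℚ.- y ℚ.+ x) ℚ.* (p′ ℚ.- p) ℚ.+ b ℚ.* (p ℚ.+ d ℚ.- p′))
    (0≤+ (0≤* (0≤+ (x≤y⇒0≤y-x y≤b) 0≤x) (x≤y⇒0≤y-x p≤p′)) (0≤* (ℚ.≤-trans 0≤x x≤b) (x≤y⇒0≤y-x p′≤)))
    (solve 6 (λ p p′ d b x y → b :* d := (p :- p′) :* (x :- y) :+
      ((b :- y :+ x) :* (p′ :- p) :+ b :* (p :+ d :- p′))) refl p p′ d b x y)

E-bounds : ∀ {p} → ⟦0,1⟧ p → ∀ {b m} (X : Subset m → ℚ) → (∀ S → 0ℚ ℚ.≤ X S × X S ℚ.≤ b) →
  0ℚ ℚ.≤ E p X × E p X ℚ.≤ b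
E-bounds {p} p∈ {b} {m} X X∈ =
  subst (ℚ._≤ E p X) (E-const p m 0ℚ) (E-mono p∈ (proj₁ ∘ X∈)) ,
  subst (E p X ℚ.≤_) (E-const p m b) (E-mono p∈ (proj₂ ∘ X∈))

-- Exchanging `p` for `p′` at one vertex changes the mean by `p - p′` times the difference of two
-- conditional means in the interval from 0 to `b`, hence by at most `b * d`; this happens once for
-- each of the `m` vertices.
E-lipschitz : ∀ {p p′ d b} → ⟦0,1⟧ p → ⟦0,1⟧ p′ → p ℚ.≤ p′ ℚ.+ d → p′ ℚ.≤ p ℚ.+ d →
  ∀ {m} (X : Subset m → ℚ) → (∀ S → 0ℚ ℚ.≤ X S × X S ℚ.≤ b) →
  E p X ℚ.≤ E p′ X ℚ.+ ⟪ m ⟫ ℚ.* (b ℚ.* d)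
E-lipschitz {d = d} {b = b} _ _ _ _ {zero} X X∈ = ℚ.≤-reflexive (lemma (X []) (b ℚ.* d))
  where
  lemma : ∀ x y → x ≡ x ℚ.+ 0ℚ ℚ.* y
  lemma = solve 2 (λ x y → x := x :+ con 0ℚ :* y) refl
E-lipschitz {p} {p′} {d} {b} p∈ p′∈ p≤ p′≤ {suc m} X X∈ =
  ≤-by (p ℚ.* (a′ ℚ.+ e ℚ.- a) ℚ.+ (1ℚ ℚ.- p) ℚ.* (c′ ℚ.+ e ℚ.- c)
        ℚ.+ (b ℚ.* d ℚ.- (p ℚ.- p′) ℚ.* (a′ ℚ.- c′)))
    (0≤+ (0≤+ (0≤* (proj₁ p∈) (x≤y⇒0≤y-x (E-lipschitz p∈ p′∈ p≤ p′≤ Xᵢ (X∈ ∘ (inside ∷_)))))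
              (0≤* (x≤y⇒0≤y-x (proj₂ p∈)) (x≤y⇒0≤y-x (E-lipschitz p∈ p′∈ p≤ p′≤ Xₒ (X∈ ∘ (outside ∷_))))))
         (x≤y⇒0≤y-x (mix-close {p} {p′} a′ c′ p≤ p′≤ (proj₁ a′∈) (proj₂ a′∈) (proj₁ c′∈) (proj₂ c′∈))))
    (trans (cong (λ z → p′ ℚ.* a′ ℚ.+ (1ℚ ℚ.- p′) ℚ.* c′ ℚ.+ z ℚ.* (b ℚ.* d)) (⟪⟫-+ 1 m))
      (solve 8 (λ p p′ a a′ c c′ M u →
        p′ :* a′ :+ (con 1ℚ :- p′) :* c′ :+ (con 1ℚ :+ M) :* u :=
        (p :* a :+ (con 1ℚ :- p) :* c) :+ (p :* (a′ :+ M :* u :- a) :+ (con 1ℚ :- p) :* (c′ :+ M :* u :- c)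
          :+ (u :- (p :- p′) :* (a′ :- c′)))) refl p p′ a a′ c c′ ⟪ m ⟫ (b ℚ.* d)))
  where
  Xᵢ = X ∘ (inside ∷_)
  Xₒ = X ∘ (outside ∷_)
  e  = ⟪ m ⟫ ℚ.* (b ℚ.* d)
  a  = E p Xᵢ
  a′ = E p′ Xᵢ
  c  = E p Xₒ
  c′ = E p′ Xₒ
  a′∈ = E-bounds p′∈ Xᵢ (X∈ ∘ (inside ∷_))
  c′∈ = E-bounds p′∈ Xₒ (X∈ ∘ (outside ∷_))

-- 𝔼 is evaluated termwise on the approximating sequence of p.
private
  weightedSum : ∀ p n {m} → (Subset m → ℝ) → List (Subset m) → ℚ
  weightedSum p n X Ss = seq (List.foldr _+ᵣ_ 0ᵣ (List.map (λ S → probability p S *ᵣ X S) Ss)) n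

  weightedSum-++ : ∀ p n {m} (X : Subset m → ℝ) Ss Ts →
    weightedSum p n X (Ss ++ Ts) ≡ weightedSum p n X Ss ℚ.+ weightedSum p n X Ts
  weightedSum-++ p n X []       Ts = sym (ℚ.+-identityˡ _)
  weightedSum-++ p n X (S ∷ Ss) Ts =
    trans (cong (w ℚ.+_) (weightedSum-++ p n X Ss Ts))
      (sym (ℚ.+-assoc w (weightedSum p n X Ss) (weightedSum p n X Ts)))
    where w = seq (probability p S *ᵣ X S) n

  weightedSum-∷ : ∀ p n {m} (X : Subset (suc m) → ℝ) s w →
    (∀ S → seq (probability p (s ∷ S)) n ≡ w ℚ.* seq (probability p S) n) → ∀ Ss →
    weightedSum p n X (List.map (s ∷_) Ss) ≡ w ℚ.* weightedSum p n (λ S → X (s ∷ S)) Ss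
  weightedSum-∷ p n X s w eq []       = sym (ℚ.*-zeroʳ w)
  weightedSum-∷ p n X s w eq (S ∷ Ss) = trans
    (cong₂ (λ x y → x ℚ.* seq (X (s ∷ S)) n ℚ.+ y) (eq S) (weightedSum-∷ p n X s w eq Ss))
    (solve 4 (λ w P x y → w :* P :* x :+ w :* y := w :* (P :* x :+ y)) refl
      w (seq (probability p S) n) (seq (X (s ∷ S)) n) (weightedSum p n (λ S → X (s ∷ S)) Ss))

expectation-E : ∀ p n {m} (X : Subset m → ℝ) →
  seq (expectation p X) n ≡ E (seq p n) (λ S → seq (X S) n)
expectation-E p n {zero}  X = trans (ℚ.+-identityʳ _) (ℚ.*-identityˡ _)
expectation-E p n {suc m} X = begin
  weightedSum p n X (List.map (inside ∷_) cs ++ List.map (outside ∷_) cs)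
    ≡⟨ weightedSum-++ p n X (List.map (inside ∷_) cs) (List.map (outside ∷_) cs) ⟩
  weightedSum p n X (List.map (inside ∷_) cs) ℚ.+ weightedSum p n X (List.map (outside ∷_) cs)
    ≡⟨ cong₂ ℚ._+_ (weightedSum-∷ p n X inside (seq p n) (probability-∷ inside) cs)
                   (weightedSum-∷ p n X outside (1ℚ ℚ.- seq p n) (probability-∷ outside) cs) ⟩
  seq p n ℚ.* weightedSum p n (X ∘ (inside ∷_)) cs ℚ.+ (1ℚ ℚ.- seq p n) ℚ.* weightedSum p n (X ∘ (outside ∷_)) cs
    ≡⟨ cong₂ (λ x y → seq p n ℚ.* x ℚ.+ (1ℚ ℚ.- seq p n) ℚ.* y)
         (expectation-E p n (X ∘ (inside ∷_))) (expectation-E p n (X ∘ (outside ∷_))) ⟩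
  E (seq p n) (λ S → seq (X S) n) ∎
  where
  open ≡-Reasoning
  cs = configurations m
  weight : Bool → ℚ
  weight inside  = seq p n
  weight outside = 1ℚ ℚ.- seq p n
  probability-∷ : ∀ s (S : Subset m) → seq (probability p (s ∷ S)) n ≡ weight s ℚ.* seq (probability p S) n
  probability-∷ inside  S = cong (λ fs → seq p n ℚ.* seq (Vec.foldr _ _*ᵣ_ 1ᵣ fs) n)
    (Vec.map-cong (λ { inside → refl ; outside → refl }) S)
  probability-∷ outside S = cong (λ fs → (1ℚ ℚ.- seq p n) ℚ.* seq (Vec.foldr _ _*ᵣ_ 1ᵣ fs) n)
    (Vec.map-cong (λ { inside → refl ; outside → refl }) S)

-- Almost additivity of the number of clusters

Position : Set
Position = ℕ × ℕ

-- The same three adjacencies as Step, on unbounded coordinates.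
Ahead : Rel Position 0ℓ
Ahead (i , j) (i′ , j′) =
  (i′ ≡ suc i × j′ ≡ j) ⊎ (i′ ≡ i × j′ ≡ suc j) ⊎ (i′ ≡ suc i × suc j′ ≡ j)

Near : Rel Position 0ℓ
Near x y = Ahead x y ⊎ Ahead y x

near? : Decidable Near
near? x y = ahead? x y ⊎-dec ahead? y x
  where
  ahead? : Decidable Ahead
  ahead? (i , j) (i′ , j′) = ((i′ ℕ.≟ suc i) ×-dec (j′ ℕ.≟ j)) ⊎-dec
    (((i′ ℕ.≟ i) ×-dec (j′ ℕ.≟ suc j)) ⊎-dec ((i′ ℕ.≟ suc i) ×-dec (suc j′ ℕ.≟ j)))

Near-irrefl : ∀ {x} → ¬ Near x x
Near-irrefl (inj₁ a) = ahead-irrefl a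
  where
  ahead-irrefl : ∀ {x} → ¬ Ahead x x
  ahead-irrefl (inj₁ (e , _))        = ℕ.1+n≢n (sym e)
  ahead-irrefl (inj₂ (inj₁ (_ , e))) = ℕ.1+n≢n (sym e)
  ahead-irrefl (inj₂ (inj₂ (e , _))) = ℕ.1+n≢n (sym e)
Near-irrefl {x} (inj₂ a) = Near-irrefl {x} (inj₁ a)

translate : ℕ → ℕ → Position → Position
translate a b (i , j) = a + i , b + j

translate-injective : ∀ a b {x y} → translate a b x ≡ translate a b y → x ≡ y
translate-injective a b {i , j} {i′ , j′} eq =
  cong₂ _,_ (ℕ.+-cancelˡ-≡ a i i′ (cong proj₁ eq)) (ℕ.+-cancelˡ-≡ b j j′ (cong proj₂ eq))

private
  +suc : ∀ a {i i′} → i′ ≡ suc i → a + i′ ≡ suc (a + i)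
  +suc a {i} refl = ℕ.+-suc a i

  +suc⁻ : ∀ a {i i′} → a + i′ ≡ suc (a + i) → i′ ≡ suc i
  +suc⁻ a {i} {i′} eq = ℕ.+-cancelˡ-≡ a i′ (suc i) (trans eq (sym (ℕ.+-suc a i)))

  ahead-translate : ∀ a b {x y} → Ahead x y → Ahead (translate a b x) (translate a b y)
  ahead-translate a b (inj₁ (p , q))        = inj₁ (+suc a p , cong (_+_ b) q)
  ahead-translate a b (inj₂ (inj₁ (p , q))) = inj₂ (inj₁ (cong (_+_ a) p , +suc b q))
  ahead-translate a b (inj₂ (inj₂ (p , q))) = inj₂ (inj₂ (+suc a p , sym (+suc b (sym q))))

  ahead-translate⁻ : ∀ a b {x y} → Ahead (translate a b x) (translate a b y) → Ahead x y
  ahead-translate⁻ a b {i , j} {i′ , j′} (inj₁ (p , q)) = inj₁ (+suc⁻ a p , ℕ.+-cancelˡ-≡ b j′ j q)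
  ahead-translate⁻ a b {i , j} {i′ , j′} (inj₂ (inj₁ (p , q))) = inj₂ (inj₁ (ℕ.+-cancelˡ-≡ a i′ i p , +suc⁻ b q))
  ahead-translate⁻ a b {i , j} {i′ , j′} (inj₂ (inj₂ (p , q))) = inj₂ (inj₂ (+suc⁻ a p , sym (+suc⁻ b (sym q))))

near-translate : ∀ a b {x y} → Near x y → Near (translate a b x) (translate a b y)
near-translate a b (inj₁ n) = inj₁ (ahead-translate a b n)
near-translate a b (inj₂ n) = inj₂ (ahead-translate a b n)

near-translate⁻ : ∀ a b {x y} → Near (translate a b x) (translate a b y) → Near x y
near-translate⁻ a b (inj₁ n) = inj₁ (ahead-translate⁻ a b n)
near-translate⁻ a b (inj₂ n) = inj₂ (ahead-translate⁻ a b n)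

OpenNear : (Position → Set) → Rel Position 0ℓ
OpenNear O x y = O x × O y × Near x y

Cluster : (Position → Set) → Rel Position 0ℓ
Cluster O = Star (OpenNear O)

Cluster-sym : ∀ O → Symmetric (Cluster O)
Cluster-sym O = Star.reverse (λ (ox , oy , n) → oy , ox , swap n)

-- Boxes of different sizes have unrelated vertex types. Placing all of them in one plane makes
-- their clusters relations on the same set, which `Classes` can compare.
record Embedding (G : Graph) : Set where
  open Graph G
  field
    at           : Fin order → Position
    at-injective : Injective _≡_ _≡_ at
    at-near      : ∀ {u v} → u ∼ v → Near (at u) (at v)
    at-near⁻     : ∀ {u v} → Near (at u) (at v) → u ∼ v

  Occupied : Config G → Position → Set
  Occupied S x = ∃[ u ] u ∈ S × at u ≡ x

  clusters : ∀ S → Classes (Occupied S) (Cluster (Occupied S)) (numComponents G S)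
  clusters S = Classes-image at
    (Star.gmap at (λ (u∈S , v∈S , u∼v) → (_ , u∈S , refl) , (_ , v∈S , refl) , at-near u∼v))
    (λ path → pull path refl refl) (components G S)
    where
    pull : ∀ {x y} → Cluster (Occupied S) x y → ∀ {u v} → at u ≡ x → at v ≡ y → Connected G S u v
    pull ε {u} {v} refl eq = subst (Connected G S u) (at-injective (sym eq)) ε
    pull (((_ , u∈S , eq) , (_ , w∈S , refl) , n) ◅ path) refl v≡ with at-injective eq
    ... | refl = (u∈S , w∈S , at-near⁻ n) ◅ pull path refl v≡

open Embedding

numComponents-cong : ∀ {G H : Graph} (e : Embedding G) (e′ : Embedding H) S T →
  (∀ x → Occupied e S x → Occupied e′ T x) → (∀ x → Occupied e′ T x → Occupied e S x) →
  numComponents G S ≡ numComponents H T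
numComponents-cong e e′ S T ⇒ ⇐ = ℕ.≤-antisym
  (Classes-≤ (Cluster-sym _) _◅◅_ (λ {x} → ⇒ x)
    (λ _ _ → Star.map (λ (a , b , n) → ⇐ _ a , ⇐ _ b , n)) (clusters e S) (clusters e′ T))
  (Classes-≤ (Cluster-sym _) _◅◅_ (λ {x} → ⇐ x)
    (λ _ _ → Star.map (λ (a , b , n) → ⇒ _ a , ⇒ _ b , n)) (clusters e′ T) (clusters e S))

module _ {O O₁ O₂ : Position → Set} (split : ∀ {x} → O x → O₁ x ⊎ O₂ x)
         (O₁⊆O : ∀ {x} → O₁ x → O x) (O₂⊆O : ∀ {x} → O₂ x → O x)
         (disjoint : ∀ {x} → O₁ x → ¬ O₂ x) where

  -- Edges across the cut can only join clusters, so the representatives of both parts together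
  -- cover those of `O`.
  clusters-subadditive : ∀ {n n₁ n₂} → Classes O (Cluster O) n →
    Classes O₁ (Cluster O₁) n₁ → Classes O₂ (Cluster O₂) n₂ → n ≤ n₁ + n₂
  clusters-subadditive c c₁ c₂ = subst₂ _≤_ (#reps c)
    (trans (List.length-++ (reps c₁)) (cong₂ _+_ (#reps c₁) (#reps c₂)))
    (independent≤covering (Cluster-sym O) _◅◅_ (reps c₁ ++ reps c₂) (independent c)
      (All.map (λ ox → cover (split ox)) (reps∈P c)))
    where
    cover : ∀ {x} → O₁ x ⊎ O₂ x → Any (Cluster O x) (reps c₁ ++ reps c₂)
    cover (inj₁ o) = Any.++⁺ˡ (Any.map (Star.map (λ (a , b , n) → O₁⊆O a , O₁⊆O b , n)) (covering c₁ _ o))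
    cover (inj₂ o) = Any.++⁺ʳ (reps c₁)
      (Any.map (Star.map (λ (a , b , n) → O₂⊆O a , O₂⊆O b , n)) (covering c₂ _ o))

  module _ (B : List Position) (boundary : ∀ {x y} → O₁ x → O₂ y → Near x y → x ∈ˡ B × y ∈ˡ B) where

    private
      Inner : Rel Position 0ℓ
      Inner x y = OpenNear O₁ x y ⊎ OpenNear O₂ x y

      Inner-sym : Symmetric (Star Inner)
      Inner-sym = Star.reverse λ
        { (inj₁ (a , b , n)) → inj₁ (b , a , swap n) ; (inj₂ (a , b , n)) → inj₂ (b , a , swap n) }

      stay₁ : ∀ {x y} → O₁ x → Star Inner x y → O₁ y × Cluster O₁ x y
      stay₁ o ε = o , ε
      stay₁ o (inj₁ s@(_ , b , _) ◅ path) = proj₁ (stay₁ b path) , s ◅ proj₂ (stay₁ b path)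
      stay₁ o (inj₂ (a , _ , _) ◅ path)   = contradiction a (disjoint o)

      stay₂ : ∀ {x y} → O₂ x → Star Inner x y → O₂ y × Cluster O₂ x y
      stay₂ o ε = o , ε
      stay₂ o (inj₂ s@(_ , b , _) ◅ path) = proj₁ (stay₂ b path) , s ◅ proj₂ (stay₂ b path)
      stay₂ o (inj₁ (a , _ , _) ◅ path)   = contradiction o (disjoint a)

      -- A path of O either stays inside one part or first leaves it
      -- through the boundary.
      walk : ∀ {x r} → Cluster O x r → Star Inner x r ⊎ Any (Star Inner x) B
      walk ε = inj₁ ε
      walk ((ox , oy , n) ◅ path) with split ox | split oy
      ... | inj₁ a | inj₂ b = inj₂ (Any.map (λ { refl → ε }) (proj₁ (boundary a b n)))
      ... | inj₂ a | inj₁ b = inj₂ (Any.map (λ { refl → ε }) (proj₂ (boundary b a (swap n))))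
      ... | inj₁ a | inj₁ b with walk path
      ...   | inj₁ p = inj₁ (inj₁ (a , b , n) ◅ p)
      ...   | inj₂ p = inj₂ (Any.map (inj₁ (a , b , n) ◅_) p)
      walk ((ox , oy , n) ◅ path) | inj₂ a | inj₂ b with walk path
      ...   | inj₁ p = inj₁ (inj₂ (a , b , n) ◅ p)
      ...   | inj₂ p = inj₂ (Any.map (inj₂ (a , b , n) ◅_) p)

    -- By `walk`, every vertex is joined within its own part to the representative of its
    -- `O`-cluster or to a vertex of `B`, so `reps c ++ B` covers the representatives of both parts.
    -- These are independent because an `Inner` path never changes parts.
    clusters-superadditive : ∀ {n n₁ n₂} → Classes O (Cluster O) n →
      Classes O₁ (Cluster O₁) n₁ → Classes O₂ (Cluster O₂) n₂ → n₁ + n₂ ≤ n + length B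
    clusters-superadditive c c₁ c₂ = subst₂ _≤_
      (trans (List.length-++ (reps c₁)) (cong₂ _+_ (#reps c₁) (#reps c₂)))
      (trans (List.length-++ (reps c)) (cong (_+ length B) (#reps c)))
      (independent≤covering Inner-sym _◅◅_ (reps c ++ B)
        (AllPairs.++⁺ (inner₁ (reps∈P c₁) (independent c₁)) (inner₂ (reps∈P c₂) (independent c₂))
          (All.map (λ o → All.map (λ o′ s → disjoint (proj₁ (stay₁ o s)) o′) (reps∈P c₂)) (reps∈P c₁)))
        (All.++⁺ (All.map (cover ∘ O₁⊆O) (reps∈P c₁)) (All.map (cover ∘ O₂⊆O) (reps∈P c₂))))
      where
      inner₁ : ∀ {xs} → All O₁ xs → AllPairs (λ x y → ¬ Cluster O₁ x y) xs → AllPairs (λ x y → ¬ Star Inner x y) xs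
      inner₁ []       []         = []
      inner₁ (o ∷ os) (x≁ ∷ ind) = All.map (λ n s → n (proj₂ (stay₁ o s))) x≁ ∷ inner₁ os ind
      inner₂ : ∀ {xs} → All O₂ xs → AllPairs (λ x y → ¬ Cluster O₂ x y) xs → AllPairs (λ x y → ¬ Star Inner x y) xs
      inner₂ []       []         = []
      inner₂ (o ∷ os) (x≁ ∷ ind) = All.map (λ n s → n (proj₂ (stay₂ o s))) x≁ ∷ inner₂ os ind
      cover : ∀ {x} → O x → Any (Star Inner x) (reps c ++ B)
      cover {x} o = go (covering c x o)
        where
        go : ∀ {ys} → Any (Cluster O x) ys → Any (Star Inner x) (ys ++ B)
        go (there p) = there (go p)
        go {_ ∷ ys} (here p) with walk p
        ... | inj₁ q = here q
        ... | inj₂ q = Any.++⁺ʳ (_ ∷ ys) q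

meanClusters : Graph → ℚ → ℚ
meanClusters G p = E p (λ S → ⟪ numComponents G S ⟫)

module _ {G G₁ G₂ : Graph} (e : Embedding G) (e₁ : Embedding G₁) (e₂ : Embedding G₂)
         (ι₁ : Fin (Graph.order G₁) → Fin (Graph.order G)) (ι₂ : Fin (Graph.order G₂) → Fin (Graph.order G))
         (at-ι₁ : ∀ u → at e (ι₁ u) ≡ at e₁ u) (at-ι₂ : ∀ u → at e (ι₂ u) ≡ at e₂ u)
         (cover : ∀ w → (∃[ u ] ι₁ u ≡ w) ⊎ (∃[ u ] ι₂ u ≡ w))
         (disjoint : ∀ u v → at e₁ u ≢ at e₂ v)
         (B : List Position)
         (boundary : ∀ u v → Near (at e₁ u) (at e₂ v) → at e₁ u ∈ˡ B × at e₂ v ∈ˡ B) where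

  private
    ∈-select⁺ : ∀ {k m} (ι : Fin k → Fin m) {S u} → ι u ∈ S → u ∈ select ι S
    ∈-select⁺ ι {S} {u} u∈S =
      Vec.lookup⇒[]= u _ (trans (Vec.lookup∘tabulate (λ i → lookup S (ι i)) u) (Vec.[]=⇒lookup u∈S))

    ∈-select⁻ : ∀ {k m} (ι : Fin k → Fin m) {S u} → u ∈ select ι S → ι u ∈ S
    ∈-select⁻ ι {S} {u} u∈ =
      Vec.lookup⇒[]= (ι u) S (trans (sym (Vec.lookup∘tabulate (λ i → lookup S (ι i)) u)) (Vec.[]=⇒lookup u∈))

    module _ (S : Config G) where

      split : ∀ {x} → Occupied e S x → Occupied e₁ (select ι₁ S) x ⊎ Occupied e₂ (select ι₂ S) x
      split (w , w∈S , refl) with cover w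
      ... | inj₁ (u , refl) = inj₁ (u , ∈-select⁺ ι₁ w∈S , sym (at-ι₁ u))
      ... | inj₂ (u , refl) = inj₂ (u , ∈-select⁺ ι₂ w∈S , sym (at-ι₂ u))

      from₁ : ∀ {x} → Occupied e₁ (select ι₁ S) x → Occupied e S x
      from₁ (u , u∈ , refl) = ι₁ u , ∈-select⁻ ι₁ u∈ , at-ι₁ u

      from₂ : ∀ {x} → Occupied e₂ (select ι₂ S) x → Occupied e S x
      from₂ (u , u∈ , refl) = ι₂ u , ∈-select⁻ ι₂ u∈ , at-ι₂ u

      apart : ∀ {x} → Occupied e₁ (select ι₁ S) x → ¬ Occupied e₂ (select ι₂ S) x
      apart (u , _ , refl) (v , _ , eq) = disjoint u v (sym eq)

      numComponents-subadditive :
        numComponents G S ≤ numComponents G₁ (select ι₁ S) + numComponents G₂ (select ι₂ S)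
      numComponents-subadditive = clusters-subadditive split from₁ from₂ apart
        (clusters e S) (clusters e₁ (select ι₁ S)) (clusters e₂ (select ι₂ S))

      numComponents-superadditive :
        numComponents G₁ (select ι₁ S) + numComponents G₂ (select ι₂ S) ≤ numComponents G S + length B
      numComponents-superadditive = clusters-superadditive split from₁ from₂ apart B
        (λ { (u , _ , refl) (v , _ , refl) n → boundary u v n })
        (clusters e S) (clusters e₁ (select ι₁ S)) (clusters e₂ (select ι₂ S))

    ι₁-injective : Injective _≡_ _≡_ ι₁
    ι₁-injective {u} {v} eq = at-injective e₁ (trans (sym (at-ι₁ u)) (trans (cong (at e) eq) (at-ι₁ v)))

    ι₂-injective : Injective _≡_ _≡_ ι₂
    ι₂-injective {u} {v} eq = at-injective e₂ (trans (sym (at-ι₂ u)) (trans (cong (at e) eq) (at-ι₂ v)))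

    -- Linearity of the expectation, with each restriction being a product configuration by
    -- `E-select`.
    E-parts : ∀ p → E p (λ S → ⟪ numComponents G₁ (select ι₁ S) + numComponents G₂ (select ι₂ S) ⟫) ≡
      meanClusters G₁ p ℚ.+ meanClusters G₂ p
    E-parts p = trans (E-cong p (λ S → ⟪⟫-+ (numComponents G₁ (select ι₁ S)) (numComponents G₂ (select ι₂ S))))
      (trans (E-+ p (λ S → ⟪ numComponents G₁ (select ι₁ S) ⟫) (λ S → ⟪ numComponents G₂ (select ι₂ S) ⟫))
        (cong₂ ℚ._+_ (E-select p ι₁ ι₁-injective (λ S → ⟪ numComponents G₁ S ⟫))
                     (E-select p ι₂ ι₂-injective (λ S → ⟪ numComponents G₂ S ⟫))))

  meanClusters-subadditive : ∀ {p} → ⟦0,1⟧ p →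
    meanClusters G p ℚ.≤ meanClusters G₁ p ℚ.+ meanClusters G₂ p
  meanClusters-subadditive {p} p∈ = subst (meanClusters G p ℚ.≤_) (E-parts p)
    (E-mono p∈ (λ S → ⟪⟫-mono (numComponents-subadditive S)))

  meanClusters-superadditive : ∀ {p} → ⟦0,1⟧ p →
    meanClusters G₁ p ℚ.+ meanClusters G₂ p ℚ.≤ meanClusters G p ℚ.+ ⟪ length B ⟫
  meanClusters-superadditive {p} p∈ = subst₂ ℚ._≤_ (E-parts p)
    (trans (E-cong p (λ S → ⟪⟫-+ (numComponents G S) (length B)))
      (trans (E-+ p (λ S → ⟪ numComponents G S ⟫) (λ _ → ⟪ length B ⟫))
        (cong (meanClusters G p ℚ.+_) (E-const p (Graph.order G) ⟪ length B ⟫))))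
    (E-mono p∈ (λ S → ⟪⟫-mono (numComponents-superadditive S)))

-- Rectangular boxes cut along a row or a column

rect : ℕ → ℕ → Graph
rect m k = record
  { order    = m * k
  ; _∼_      = λ u v → Near (coordinates u) (coordinates v)
  ; _∼?_     = λ u v → near? (coordinates u) (coordinates v)
  ; ∼-sym    = swap
  ; ∼-irrefl = λ { refl → Near-irrefl }
  }
  module Rect where
  coordinates : Fin (m * k) → Position
  coordinates u = toℕ (proj₁ (remQuot {m} k u)) , toℕ (proj₂ (remQuot {m} k u))

open Rect using (coordinates)

coordinates-combine : ∀ m k (i : Fin m) (j : Fin k) → coordinates m k (combine i j) ≡ (toℕ i , toℕ j)
coordinates-combine m k i j = cong (λ (i , j) → toℕ i , toℕ j) (Fin.remQuot-combine i j)

coordinates-injective : ∀ m k → Injective _≡_ _≡_ (coordinates m k)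
coordinates-injective m k {u} {v} eq = begin
  u                                             ≡⟨ Fin.combine-remQuot {m} k u ⟨
  (let i , j = remQuot {m} k u in combine i j)  ≡⟨ cong₂ combine (Fin.toℕ-injective (cong proj₁ eq))
                                                                 (Fin.toℕ-injective (cong proj₂ eq)) ⟩
  (let i , j = remQuot {m} k v in combine i j)  ≡⟨ Fin.combine-remQuot {m} k v ⟩
  v                                             ∎
  where open ≡-Reasoning

placed : ∀ a b m k → Embedding (rect m k)
placed a b m k = record
  { at           = λ u → translate a b (coordinates m k u)
  ; at-injective = λ eq → coordinates-injective m k (translate-injective a b eq)
  ; at-near      = near-translate a b
  ; at-near⁻     = near-translate⁻ a b
  }

private
  ahead⇒<suc : ∀ {i j i′ j′} → Ahead (i , j) (i′ , j′) → i ≤ i′ × i′ ≤ suc i × j ≤ suc j′ × j′ ≤ suc j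
  ahead⇒<suc (inj₁ (refl , refl))        = ℕ.n≤1+n _ , ℕ.≤-refl , ℕ.n≤1+n _ , ℕ.n≤1+n _
  ahead⇒<suc (inj₂ (inj₁ (refl , refl))) = ℕ.≤-refl , ℕ.n≤1+n _ , ℕ.≤-trans (ℕ.n≤1+n _) (ℕ.n≤1+n _) , ℕ.≤-refl
  ahead⇒<suc (inj₂ (inj₂ (refl , refl))) = ℕ.n≤1+n _ , ℕ.≤-refl , ℕ.≤-refl , ℕ.≤-trans (ℕ.n≤1+n _) (ℕ.n≤1+n _)

  near⇒≤suc : ∀ {i j i′ j′} → Near (i , j) (i′ , j′) → i′ ≤ suc i × j′ ≤ suc j
  near⇒≤suc (inj₁ a) = let _ , p , _ , q = ahead⇒<suc a in p , q
  near⇒≤suc (inj₂ a) = let p , _ , q , _ = ahead⇒<suc a in ℕ.≤-trans p (ℕ.n≤1+n _) , q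

  squeeze : ∀ {m x y} → x < m → y ≤ suc x → m ≤ y → x ≡ m ∸ 1 × y ≡ m
  squeeze {m} {x} {y} x<m y≤ m≤y = cong (_∸ 1) (sym m≡) , ℕ.≤-antisym (ℕ.≤-trans y≤ x<m) m≤y
    where m≡ = ℕ.≤-antisym (ℕ.≤-trans m≤y y≤) x<m

-- The two lines of vertices on either side of the cut. The truncation in `m ∸ 1` is harmless: for
-- `m = 0` the first part is empty.
rows columns : ℕ → ℕ → List Position
rows    m k = List.map (m ∸ 1 ,_) (List.upTo k) ++ List.map (m ,_) (List.upTo k)
columns m k = List.map (_, k ∸ 1) (List.upTo m) ++ List.map (_, k) (List.upTo m)

private
  ∈-rowsˡ : ∀ {m k i j} → i ≡ m ∸ 1 → j < k → (i , j) ∈ˡ rows m k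
  ∈-rowsˡ {m} refl j<k = ∈ˡ.∈-++⁺ˡ (∈ˡ.∈-map⁺ (m ∸ 1 ,_) (∈ˡ.∈-upTo⁺ j<k))

  ∈-rowsʳ : ∀ {m k i j} → i ≡ m → j < k → (i , j) ∈ˡ rows m k
  ∈-rowsʳ {m} {k} refl j<k = ∈ˡ.∈-++⁺ʳ (List.map (m ∸ 1 ,_) (List.upTo k)) (∈ˡ.∈-map⁺ (m ,_) (∈ˡ.∈-upTo⁺ j<k))

  ∈-columnsˡ : ∀ {m k i j} → j ≡ k ∸ 1 → i < m → (i , j) ∈ˡ columns m k
  ∈-columnsˡ {k = k} refl i<m = ∈ˡ.∈-++⁺ˡ (∈ˡ.∈-map⁺ (_, k ∸ 1) (∈ˡ.∈-upTo⁺ i<m))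

  ∈-columnsʳ : ∀ {m k i j} → j ≡ k → i < m → (i , j) ∈ˡ columns m k
  ∈-columnsʳ {m} {k} refl i<m = ∈ˡ.∈-++⁺ʳ (List.map (_, k ∸ 1) (List.upTo m)) (∈ˡ.∈-map⁺ (_, k) (∈ˡ.∈-upTo⁺ i<m))

  length-doubled : ∀ (f g : ℕ → Position) k →
    length (List.map f (List.upTo k) ++ List.map g (List.upTo k)) ≡ 2 * k
  length-doubled f g k = trans (List.length-++ (List.map f (List.upTo k))) (cong₂ _+_
    (trans (List.length-map f (List.upTo k)) (List.length-upTo k))
    (trans (trans (List.length-map g (List.upTo k)) (List.length-upTo k)) (sym (ℕ.+-identityʳ k))))

module _ (m m′ k : ℕ) where

  private
    ι₁ : Fin (m * k) → Fin ((m + m′) * k)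
    ι₁ u = let i , j = remQuot {m} k u in combine (i ↑ˡ m′) j

    ι₂ : Fin (m′ * k) → Fin ((m + m′) * k)
    ι₂ u = let i , j = remQuot {m′} k u in combine (m ↑ʳ i) j

    at-ι₁ : ∀ u → coordinates (m + m′) k (ι₁ u) ≡ coordinates m k u
    at-ι₁ u = trans (coordinates-combine (m + m′) k _ _) (cong (_, _) (Fin.toℕ-↑ˡ (proj₁ (remQuot {m} k u)) m′))

    at-ι₂ : ∀ u → coordinates (m + m′) k (ι₂ u) ≡ translate m 0 (coordinates m′ k u)
    at-ι₂ u = trans (coordinates-combine (m + m′) k _ _) (cong (_, _) (Fin.toℕ-↑ʳ m (proj₁ (remQuot {m′} k u))))

    cover : ∀ w → (∃[ u ] ι₁ u ≡ w) ⊎ (∃[ u ] ι₂ u ≡ w)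
    cover w with remQuot {m + m′} k w in eq
    ... | i , j with splitAt m i in eq′
    ... | inj₁ i₁ = inj₁ (combine i₁ j , trans
      (cong (λ (i , j) → combine (i ↑ˡ m′) j) (Fin.remQuot-combine i₁ j))
      (trans (cong (λ i → combine i j) (Fin.splitAt⁻¹-↑ˡ eq′))
        (trans (cong (λ (i , j) → combine i j) (sym eq)) (Fin.combine-remQuot {m + m′} k w))))
    ... | inj₂ i₂ = inj₂ (combine i₂ j , trans
      (cong (λ (i , j) → combine (m ↑ʳ i) j) (Fin.remQuot-combine i₂ j))
      (trans (cong (λ i → combine i j) (Fin.splitAt⁻¹-↑ʳ eq′))
        (trans (cong (λ (i , j) → combine i j) (sym eq)) (Fin.combine-remQuot {m + m′} k w))))

    disjoint : ∀ u v → coordinates m k u ≢ translate m 0 (coordinates m′ k v)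
    disjoint u v eq = ℕ.<⇒≱ (Fin.toℕ<n (proj₁ (remQuot {m} k u)))
      (subst (m ≤_) (sym (cong proj₁ eq)) (ℕ.m≤m+n m _))

    boundary : ∀ u v → Near (coordinates m k u) (translate m 0 (coordinates m′ k v)) →
      coordinates m k u ∈ˡ rows m k × translate m 0 (coordinates m′ k v) ∈ˡ rows m k
    boundary u v n with squeeze (Fin.toℕ<n (proj₁ (remQuot {m} k u))) (proj₁ (near⇒≤suc n)) (ℕ.m≤m+n m _)
    ... | p , q = ∈-rowsˡ p (Fin.toℕ<n (proj₂ (remQuot {m} k u))) , ∈-rowsʳ q (Fin.toℕ<n (proj₂ (remQuot {m′} k v)))

  rect-subadditiveˡ : ∀ {p} → ⟦0,1⟧ p →
    meanClusters (rect (m + m′) k) p ℚ.≤ meanClusters (rect m k) p ℚ.+ meanClusters (rect m′ k) p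
  rect-subadditiveˡ = meanClusters-subadditive (placed 0 0 (m + m′) k) (placed 0 0 m k) (placed m 0 m′ k)
    ι₁ ι₂ at-ι₁ at-ι₂ cover disjoint (rows m k) boundary

  rect-superadditiveˡ : ∀ {p} → ⟦0,1⟧ p →
    meanClusters (rect m k) p ℚ.+ meanClusters (rect m′ k) p ℚ.≤ meanClusters (rect (m + m′) k) p ℚ.+ ⟪ 2 * k ⟫
  rect-superadditiveˡ {p} p∈ = subst (λ l → meanClusters (rect m k) p ℚ.+ meanClusters (rect m′ k) p ℚ.≤ meanClusters (rect (m + m′) k) p ℚ.+ ⟪ l ⟫)
    (length-doubled (m ∸ 1 ,_) (m ,_) k)
    (meanClusters-superadditive (placed 0 0 (m + m′) k) (placed 0 0 m k) (placed m 0 m′ k)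
      ι₁ ι₂ at-ι₁ at-ι₂ cover disjoint (rows m k) boundary p∈)

module _ (m k k′ : ℕ) where

  private
    ι₁ : Fin (m * k) → Fin (m * (k + k′))
    ι₁ u = let i , j = remQuot {m} k u in combine i (j ↑ˡ k′)

    ι₂ : Fin (m * k′) → Fin (m * (k + k′))
    ι₂ u = let i , j = remQuot {m} k′ u in combine i (k ↑ʳ j)

    at-ι₁ : ∀ u → coordinates m (k + k′) (ι₁ u) ≡ coordinates m k u
    at-ι₁ u = trans (coordinates-combine m (k + k′) _ _) (cong (_ ,_) (Fin.toℕ-↑ˡ (proj₂ (remQuot {m} k u)) k′))

    at-ι₂ : ∀ u → coordinates m (k + k′) (ι₂ u) ≡ translate 0 k (coordinates m k′ u)
    at-ι₂ u = trans (coordinates-combine m (k + k′) _ _) (cong (_ ,_) (Fin.toℕ-↑ʳ k (proj₂ (remQuot {m} k′ u))))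

    cover : ∀ w → (∃[ u ] ι₁ u ≡ w) ⊎ (∃[ u ] ι₂ u ≡ w)
    cover w with remQuot {m} (k + k′) w in eq
    ... | i , j with splitAt k j in eq′
    ... | inj₁ j₁ = inj₁ (combine i j₁ , trans
      (cong (λ (i , j) → combine i (j ↑ˡ k′)) (Fin.remQuot-combine i j₁))
      (trans (cong (combine i) (Fin.splitAt⁻¹-↑ˡ eq′))
        (trans (cong (λ (i , j) → combine i j) (sym eq)) (Fin.combine-remQuot {m} (k + k′) w))))
    ... | inj₂ j₂ = inj₂ (combine i j₂ , trans
      (cong (λ (i , j) → combine i (k ↑ʳ j)) (Fin.remQuot-combine i j₂))
      (trans (cong (combine i) (Fin.splitAt⁻¹-↑ʳ eq′))
        (trans (cong (λ (i , j) → combine i j) (sym eq)) (Fin.combine-remQuot {m} (k + k′) w))))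

    disjoint : ∀ u v → coordinates m k u ≢ translate 0 k (coordinates m k′ v)
    disjoint u v eq = ℕ.<⇒≱ (Fin.toℕ<n (proj₂ (remQuot {m} k u)))
      (subst (k ≤_) (sym (cong proj₂ eq)) (ℕ.m≤m+n k _))

    boundary : ∀ u v → Near (coordinates m k u) (translate 0 k (coordinates m k′ v)) →
      coordinates m k u ∈ˡ columns m k × translate 0 k (coordinates m k′ v) ∈ˡ columns m k
    boundary u v n with squeeze (Fin.toℕ<n (proj₂ (remQuot {m} k u))) (proj₂ (near⇒≤suc n)) (ℕ.m≤m+n k _)
    ... | p , q = ∈-columnsˡ p (Fin.toℕ<n (proj₁ (remQuot {m} k u))) , ∈-columnsʳ q (Fin.toℕ<n (proj₁ (remQuot {m} k′ v)))

  rect-subadditiveʳ : ∀ {p} → ⟦0,1⟧ p →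
    meanClusters (rect m (k + k′)) p ℚ.≤ meanClusters (rect m k) p ℚ.+ meanClusters (rect m k′) p
  rect-subadditiveʳ = meanClusters-subadditive (placed 0 0 m (k + k′)) (placed 0 0 m k) (placed 0 k m k′)
    ι₁ ι₂ at-ι₁ at-ι₂ cover disjoint (columns m k) boundary

  rect-superadditiveʳ : ∀ {p} → ⟦0,1⟧ p →
    meanClusters (rect m k) p ℚ.+ meanClusters (rect m k′) p ℚ.≤ meanClusters (rect m (k + k′)) p ℚ.+ ⟪ 2 * m ⟫
  rect-superadditiveʳ {p} p∈ = subst (λ l → meanClusters (rect m k) p ℚ.+ meanClusters (rect m k′) p ℚ.≤ meanClusters (rect m (k + k′)) p ℚ.+ ⟪ l ⟫)
    (length-doubled (_, k ∸ 1) (_, k) m)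
    (meanClusters-superadditive (placed 0 0 m (k + k′)) (placed 0 0 m k) (placed 0 k m k′)
      ι₁ ι₂ at-ι₁ at-ι₂ cover disjoint (columns m k) boundary p∈)

triangularEmbedding : ∀ n → Embedding (triangularLattice n)
triangularEmbedding n = record
  { at           = coordinates n n
  ; at-injective = coordinates-injective n n
  ; at-near      = λ { (inj₁ s) → inj₁ (step⇒ahead s) ; (inj₂ s) → inj₂ (step⇒ahead s) }
  ; at-near⁻     = λ { (inj₁ a) → inj₁ (ahead⇒step a) ; (inj₂ a) → inj₂ (ahead⇒step a) }
  }
  where
  step⇒ahead : ∀ {i j i′ j′} → Step n (i , j) (i′ , j′) → Ahead (toℕ i , toℕ j) (toℕ i′ , toℕ j′)
  step⇒ahead (right p q) = inj₁ (p , q)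
  step⇒ahead (up p q)    = inj₂ (inj₁ (p , q))
  step⇒ahead (diag p q)  = inj₂ (inj₂ (p , q))
  ahead⇒step : ∀ {i j i′ j′} → Ahead (toℕ i , toℕ j) (toℕ i′ , toℕ j′) → Step n (i , j) (i′ , j′)
  ahead⇒step (inj₁ (p , q))        = right p q
  ahead⇒step (inj₂ (inj₁ (p , q))) = up p q
  ahead⇒step (inj₂ (inj₂ (p , q))) = diag p q

-- Both graphs have the same vertices at the same positions; only the adjacency is encoded
-- differently, by `Step` on bounded coordinates and by `Near` on natural numbers.
triangular≡rect : ∀ n p → meanClusters (triangularLattice n) p ≡ meanClusters (rect n n) p
triangular≡rect n p = E-cong p (λ S → cong ⟪_⟫
  (numComponents-cong (triangularEmbedding n) (placed 0 0 n n) S S (λ _ → id) (λ _ → id)))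

-- Additivity up to a bounded error determines a sequence up to linear terms:
-- compare both f m and f n with f (m * n).
module _ (f : ℕ → ℚ) (c : ℚ) (0≤c : 0ℚ ℚ.≤ c) (f0≡0 : f 0 ≡ 0ℚ)
         (sub : ∀ m n → f (m + n) ℚ.≤ f m ℚ.+ f n) (super : ∀ m n → f m ℚ.+ f n ℚ.≤ f (m + n) ℚ.+ c) where

  private
    multiple-≤ : ∀ a m → f (a * m) ℚ.≤ ⟪ a ⟫ ℚ.* f m
    multiple-≤ zero    m = ℚ.≤-reflexive (trans f0≡0 (sym (ℚ.*-zeroˡ (f m))))
    multiple-≤ (suc a) m = begin
      f (m + a * m)               ≤⟨ sub m (a * m) ⟩
      f m ℚ.+ f (a * m)           ≤⟨ ℚ.+-monoʳ-≤ (f m) (multiple-≤ a m) ⟩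
      f m ℚ.+ ⟪ a ⟫ ℚ.* f m       ≡⟨ solve 2 (λ a x → x :+ a :* x := (con 1ℚ :+ a) :* x) refl ⟪ a ⟫ (f m) ⟩
      (1ℚ ℚ.+ ⟪ a ⟫) ℚ.* f m      ≡⟨ cong (ℚ._* f m) (⟪⟫-+ 1 a) ⟨
      ⟪ suc a ⟫ ℚ.* f m           ∎
      where open ℚ.≤-Reasoning

    multiple-≥ : ∀ a m → ⟪ a ⟫ ℚ.* f m ℚ.≤ f (a * m) ℚ.+ ⟪ a ⟫ ℚ.* c
    multiple-≥ zero    m = ℚ.≤-reflexive (trans (ℚ.*-zeroˡ (f m))
      (sym (trans (cong₂ ℚ._+_ f0≡0 (ℚ.*-zeroˡ c)) (ℚ.+-identityˡ 0ℚ))))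
    multiple-≥ (suc a) m = begin
      ⟪ suc a ⟫ ℚ.* f m                            ≡⟨ cong (ℚ._* f m) (⟪⟫-+ 1 a) ⟩
      (1ℚ ℚ.+ ⟪ a ⟫) ℚ.* f m                       ≡⟨ solve 2 (λ a x → (con 1ℚ :+ a) :* x := x :+ a :* x) refl ⟪ a ⟫ (f m) ⟩
      f m ℚ.+ ⟪ a ⟫ ℚ.* f m                        ≤⟨ ℚ.+-monoʳ-≤ (f m) (multiple-≥ a m) ⟩
      f m ℚ.+ (f (a * m) ℚ.+ ⟪ a ⟫ ℚ.* c)          ≡⟨ ℚ.+-assoc (f m) (f (a * m)) (⟪ a ⟫ ℚ.* c) ⟨
      f m ℚ.+ f (a * m) ℚ.+ ⟪ a ⟫ ℚ.* c            ≤⟨ ℚ.+-monoˡ-≤ (⟪ a ⟫ ℚ.* c) (super m (a * m)) ⟩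
      f (m + a * m) ℚ.+ c ℚ.+ ⟪ a ⟫ ℚ.* c          ≡⟨ solve 3 (λ x c a → x :+ c :+ a :* c := x :+ (con 1ℚ :+ a) :* c) refl
                                                        (f (m + a * m)) c ⟪ a ⟫ ⟩
      f (m + a * m) ℚ.+ (1ℚ ℚ.+ ⟪ a ⟫) ℚ.* c       ≡⟨ cong (λ z → f (m + a * m) ℚ.+ z ℚ.* c) (⟪⟫-+ 1 a) ⟨
      f (m + a * m) ℚ.+ ⟪ suc a ⟫ ℚ.* c            ∎
      where open ℚ.≤-Reasoning

  almost-additive⇒almost-linear : ∀ m n → ⟪ m ⟫ ℚ.* f n ℚ.≤ ⟪ n ⟫ ℚ.* f m ℚ.+ ⟪ m ⟫ ℚ.* c
  almost-additive⇒almost-linear m n = ℚ.≤-trans (multiple-≥ m n)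
    (ℚ.+-monoˡ-≤ (⟪ m ⟫ ℚ.* c) (subst (λ l → f l ℚ.≤ ⟪ n ⟫ ℚ.* f m) (ℕ.*-comm n m) (multiple-≤ n m)))

private
  empty-mean : ∀ (G : Graph) p → Graph.order G ≡ 0 → meanClusters G p ≡ 0ℚ
  empty-mean G p order≡0 = trans (E-cong p (λ S → cong ⟪_⟫ (none S))) (E-const p (Graph.order G) 0ℚ)
    where
    none : ∀ S → numComponents G S ≡ 0
    none S with reps (components G S) | #reps (components G S)
    ... | []    | eq = sym eq
    ... | u ∷ _ | _  = contradiction (subst Fin order≡0 u) λ ()

-- The side lengths are exchanged one at a time, from n × n through m × n to m × m. Each exchange
-- contributes `2 * m * m * n` to the error, which becomes `4 / n` after division by the two areas.
square-comparison : ∀ {p} → ⟦0,1⟧ p → ∀ m n →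
  ⟪ m * m ⟫ ℚ.* meanClusters (rect n n) p ℚ.≤
  ⟪ n * n ⟫ ℚ.* meanClusters (rect m m) p ℚ.+ ⟪ 4 ⟫ ℚ.* (⟪ m * m ⟫ ℚ.* ⟪ n ⟫)
square-comparison {p} p∈ m n = begin
  ⟪ m * m ⟫ ℚ.* A n n                                             ≡⟨ cong (ℚ._* A n n) (⟪⟫-* m m) ⟩
  M ℚ.* M ℚ.* A n n                                               ≡⟨ ℚ.*-assoc M M (A n n) ⟩
  M ℚ.* (M ℚ.* A n n)                                             ≤⟨ *-monoˡ-≤ (0≤⟪⟫ m) (vertical n) ⟩
  M ℚ.* (N ℚ.* A m n ℚ.+ M ℚ.* (⟪ 2 ⟫ ℚ.* N))                     ≡⟨ solve 3 (λ M N x → M :* (N :* x :+ M :* (con ⟪ 2 ⟫ :* N)) :=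
                                                                       N :* (M :* x) :+ M :* M :* (con ⟪ 2 ⟫ :* N)) refl M N (A m n) ⟩
  N ℚ.* (M ℚ.* A m n) ℚ.+ M ℚ.* M ℚ.* (⟪ 2 ⟫ ℚ.* N)               ≤⟨ ℚ.+-monoˡ-≤ (M ℚ.* M ℚ.* (⟪ 2 ⟫ ℚ.* N))
                                                                       (*-monoˡ-≤ (0≤⟪⟫ n) (horizontal m)) ⟩
  N ℚ.* (N ℚ.* A m m ℚ.+ M ℚ.* (⟪ 2 ⟫ ℚ.* M)) ℚ.+ M ℚ.* M ℚ.* (⟪ 2 ⟫ ℚ.* N)
                                                                  ≡⟨ solve 3 (λ M N x → N :* (N :* x :+ M :* (con ⟪ 2 ⟫ :* M)) :+ M :* M :* (con ⟪ 2 ⟫ :* N) :=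
                                                                       N :* N :* x :+ con ⟪ 4 ⟫ :* (M :* M :* N)) refl M N (A m m) ⟩
  N ℚ.* N ℚ.* A m m ℚ.+ ⟪ 4 ⟫ ℚ.* (M ℚ.* M ℚ.* N)                 ≡⟨ cong₂ (λ x y → x ℚ.* A m m ℚ.+ ⟪ 4 ⟫ ℚ.* (y ℚ.* N))
                                                                       (sym (⟪⟫-* n n)) (sym (⟪⟫-* m m)) ⟩
  ⟪ n * n ⟫ ℚ.* A m m ℚ.+ ⟪ 4 ⟫ ℚ.* (⟪ m * m ⟫ ℚ.* N)             ∎
  where
  open ℚ.≤-Reasoning
  A : ℕ → ℕ → ℚ
  A m k = meanClusters (rect m k) p
  M = ⟪ m ⟫
  N = ⟪ n ⟫
  vertical : ∀ k → M ℚ.* A n k ℚ.≤ N ℚ.* A m k ℚ.+ M ℚ.* (⟪ 2 ⟫ ℚ.* ⟪ k ⟫)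
  vertical k = subst (λ c → M ℚ.* A n k ℚ.≤ N ℚ.* A m k ℚ.+ M ℚ.* c) (⟪⟫-* 2 k)
    (almost-additive⇒almost-linear (λ m → A m k) ⟪ 2 * k ⟫ (0≤⟪⟫ (2 * k)) (empty-mean (rect 0 k) p refl)
      (λ m m′ → rect-subadditiveˡ m m′ k p∈) (λ m m′ → rect-superadditiveˡ m m′ k p∈) m n)
  horizontal : ∀ k → M ℚ.* A k n ℚ.≤ N ℚ.* A k m ℚ.+ M ℚ.* (⟪ 2 ⟫ ℚ.* ⟪ k ⟫)
  horizontal k = subst (λ c → M ℚ.* A k n ℚ.≤ N ℚ.* A k m ℚ.+ M ℚ.* c) (⟪⟫-* 2 k)
    (almost-additive⇒almost-linear (A k) ⟪ 2 * k ⟫ (0≤⟪⟫ (2 * k)) (empty-mean (rect k 0) p (ℕ.*-zeroʳ k))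
      (λ l l′ → rect-subadditiveʳ k l l′ p∈) (λ l l′ → rect-superadditiveʳ k l l′ p∈) m n)

-- Adding vertices in lexicographic order

agree : Bool → Bool → Bool
agree inside  x = x
agree outside x = not x

match : ∀ {k} → Subset k → Subset k → Bool
match []       []       = true
match (s ∷ ss) (x ∷ xs) = agree s x ∧ match ss xs

link : ∀ {A : Set} → Bool → A → A → List (A × A)
link true  u w = (u , w) ∷ []
link false u w = []

module AddVertex {A : Set} (_≟_ : DecidableEquality A) (E : List (A × A)) {v b a c : A}
                 (fresh : ¬ Any (Endpoint v) E) (v≢b : v ≢ b) (v≢a : v ≢ a) (v≢c : v ≢ c) where

  open UnionFind _≟_

  -- Lists of edges grow at the head, so the link to `b` is added before those to `a` and `c`. If
  -- `b` is open it is already linked to every open one of `a` and `c`, and the later links are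
  -- redundant.
  newLinks : Bool → Bool → Bool → Bool → List (A × A)
  newLinks xv xb xa xc = link (xv ∧ xc) v c ++ link (xv ∧ xa) v a ++ link (xv ∧ xb) v b

  private
    new : ∀ {x} → v ≢ x → redundant ((v , x) ∷ E) ≡ redundant E
    new v≢x = redundant-no E (v≢x ∘ Linked-isolated E fresh)

    through-b : ∀ {x} → Linked E b x → Linked ((v , b) ∷ E) v x
    through-b b~x = inj₂ (inj₁ (Linked-refl E , b~x))

    b+a : Linked E b a → redundant ((v , a) ∷ (v , b) ∷ E) ≡ suc (redundant E)
    b+a b~a = trans (redundant-yes ((v , b) ∷ E) (through-b b~a)) (cong suc (new v≢b))

    b+c : Linked E b c → redundant ((v , c) ∷ (v , b) ∷ E) ≡ suc (redundant E)
    b+c b~c = trans (redundant-yes ((v , b) ∷ E) (through-b b~c)) (cong suc (new v≢b))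

    b+a+c : Linked E b a → Linked E b c →
      redundant ((v , c) ∷ (v , a) ∷ (v , b) ∷ E) ≡ suc (suc (redundant E))
    b+a+c b~a b~c = trans (redundant-yes ((v , a) ∷ (v , b) ∷ E) (inj₁ (through-b b~c))) (cong suc (b+a b~a))

    a+c : Linked E a c → redundant ((v , c) ∷ (v , a) ∷ E) ≡ suc (redundant E)
    a+c a~c = trans (redundant-yes ((v , a) ∷ E) (inj₂ (inj₁ (Linked-refl E , a~c)))) (cong suc (new v≢a))

    a+c-merge : ¬ Linked E a c → redundant ((v , c) ∷ (v , a) ∷ E) ≡ redundant E
    a+c-merge a≁c = trans (redundant-no ((v , a) ∷ E) λ
      { (inj₁ v~c)              → v≢c (Linked-isolated E fresh v~c)
      ; (inj₂ (inj₁ (_ , a~c))) → a≁c a~c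
      ; (inj₂ (inj₂ (v~a , _))) → v≢a (Linked-isolated E fresh v~a) }) (new v≢a)

    R : ℕ
    R = redundant ((v , c) ∷ (v , a) ∷ E)

    a+c-bounds : redundant E ≤ R × R ≤ suc (redundant E)
    a+c-bounds = either (linked? E a c)
      where
      either : Dec (Linked E a c) → redundant E ≤ R × R ≤ suc (redundant E)
      either (yes a~c) = subst (λ r → redundant E ≤ r × r ≤ suc (redundant E)) (sym (a+c a~c))
        (ℕ.n≤1+n _ , ℕ.≤-refl)
      either (no a≁c)  = subst (λ r → redundant E ≤ r × r ≤ suc (redundant E)) (sym (a+c-merge a≁c))
        (ℕ.≤-refl , ℕ.n≤1+n _)

  -- With subtraction, this bounds the change of the Euler count by the birth indicator minus the
  -- merger indicator. For open `v` the change is 1 if no neighbour is open, and 0 whenever all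
  -- links but one are redundant. Only when exactly `a` and `c` are open does it depend on the past:
  -- it is then 0 or -1, and `z` stands for a condition that forces -1.
  newLinks-upper : ∀ xv xb xa xc z →
    (xb ≡ true → xa ≡ true → Linked E b a) → (xb ≡ true → xc ≡ true → Linked E b c) →
    (xb ≡ false → z ≡ true → ¬ Linked E a c) →
    indicator xv + redundant (newLinks xv xb xa xc ++ E) + indicator (xv ∧ (not xb ∧ (xa ∧ (xc ∧ z)))) ≤
    indicator (xv ∧ (not xb ∧ (not xa ∧ (not xc ∧ true)))) + (length (newLinks xv xb xa xc) + redundant E)
  newLinks-upper false _     _     _     z b~a b~c a≁c = ℕ.≤-reflexive (ℕ.+-identityʳ _)
  newLinks-upper true  true  true  true  z b~a b~c a≁c =
    ℕ.≤-reflexive (trans (ℕ.+-identityʳ _) (cong suc (b+a+c (b~a refl refl) (b~c refl refl))))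
  newLinks-upper true  true  true  false z b~a b~c a≁c =
    ℕ.≤-reflexive (trans (ℕ.+-identityʳ _) (cong suc (b+a (b~a refl refl))))
  newLinks-upper true  true  false true  z b~a b~c a≁c =
    ℕ.≤-reflexive (trans (ℕ.+-identityʳ _) (cong suc (b+c (b~c refl refl))))
  newLinks-upper true  true  false false z b~a b~c a≁c =
    ℕ.≤-reflexive (trans (ℕ.+-identityʳ _) (cong suc (new v≢b)))
  newLinks-upper true  false true  false z b~a b~c a≁c =
    ℕ.≤-reflexive (trans (ℕ.+-identityʳ _) (cong suc (new v≢a)))
  newLinks-upper true  false false true  z b~a b~c a≁c =
    ℕ.≤-reflexive (trans (ℕ.+-identityʳ _) (cong suc (new v≢c)))
  newLinks-upper true  false false false z b~a b~c a≁c = ℕ.≤-reflexive (ℕ.+-identityʳ _)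
  newLinks-upper true  false true  true  false b~a b~c a≁c =
    subst (_≤ suc (suc (redundant E))) (sym (ℕ.+-identityʳ _)) (s≤s (proj₂ a+c-bounds))
  newLinks-upper true  false true  true  true  b~a b~c a≁c =
    ℕ.≤-reflexive (trans (ℕ.+-comm (suc R) 1) (cong (λ r → suc (suc r)) (a+c-merge (a≁c refl refl))))

  -- The change of the Euler count is at least birth plus hexagon minus meeting. At a meeting it is
  -- -1 at worst, and `h` stands for a condition that forces the second link to be redundant, which
  -- brings it to 0.
  newLinks-lower : ∀ xv xb xa xc h →
    (xb ≡ true → xa ≡ true → Linked E b a) → (xb ≡ true → xc ≡ true → Linked E b c) →
    (xb ≡ false → xa ≡ true → xc ≡ true → h ≡ true → Linked E a c) →
    indicator (xv ∧ (not xb ∧ (not xa ∧ (not xc ∧ true)))) + indicator (xv ∧ (not xb ∧ (xa ∧ (xc ∧ h))))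
      + (length (newLinks xv xb xa xc) + redundant E) ≤
    indicator xv + redundant (newLinks xv xb xa xc ++ E) + indicator (xv ∧ (not xb ∧ (xa ∧ (xc ∧ true))))
  newLinks-lower false _     _     _     h b~a b~c a~c = ℕ.≤-reflexive (sym (ℕ.+-identityʳ _))
  newLinks-lower true  true  true  true  h b~a b~c a~c =
    ℕ.≤-reflexive (sym (trans (ℕ.+-identityʳ _) (cong suc (b+a+c (b~a refl refl) (b~c refl refl)))))
  newLinks-lower true  true  true  false h b~a b~c a~c =
    ℕ.≤-reflexive (sym (trans (ℕ.+-identityʳ _) (cong suc (b+a (b~a refl refl)))))
  newLinks-lower true  true  false true  h b~a b~c a~c =
    ℕ.≤-reflexive (sym (trans (ℕ.+-identityʳ _) (cong suc (b+c (b~c refl refl)))))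
  newLinks-lower true  true  false false h b~a b~c a~c =
    ℕ.≤-reflexive (sym (trans (ℕ.+-identityʳ _) (cong suc (new v≢b))))
  newLinks-lower true  false true  false h b~a b~c a~c =
    ℕ.≤-reflexive (sym (trans (ℕ.+-identityʳ _) (cong suc (new v≢a))))
  newLinks-lower true  false false true  h b~a b~c a~c =
    ℕ.≤-reflexive (sym (trans (ℕ.+-identityʳ _) (cong suc (new v≢c))))
  newLinks-lower true  false false false h b~a b~c a~c = ℕ.≤-reflexive (sym (ℕ.+-identityʳ _))
  newLinks-lower true  false true  true  true  b~a b~c a~c =
    ℕ.≤-reflexive (sym (trans (ℕ.+-comm (suc R) 1) (cong (λ r → suc (suc r)) (a+c (a~c refl refl refl refl)))))
  newLinks-lower true  false true  true  false b~a b~c a~c =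
    subst (suc (suc (redundant E)) ≤_) (ℕ.+-comm 1 _) (s≤s (s≤s (proj₁ a+c-bounds)))

-- The cells (i′ , j′) with j′ < n that precede (i , j) lexicographically,
-- in decreasing order.
before : ℕ → ℕ → ℕ → List Position
before n zero    zero    = []
before n (suc i) zero    = before n i n
before n i       (suc j) = (i , j) ∷ before n i j

_≺_ : Rel Position 0ℓ
(i′ , j′) ≺ (i , j) = i′ < i ⊎ (i′ ≡ i × j′ < j)

∈-before⁻ : ∀ n i j {q} → q ∈ˡ before n i j → q ≺ (i , j)
∈-before⁻ n (suc i) zero q∈ with ∈-before⁻ n i n q∈
... | inj₁ i′<i       = inj₁ (ℕ.m<n⇒m<1+n i′<i)
... | inj₂ (refl , _) = inj₁ ℕ.≤-refl
∈-before⁻ n zero    (suc j) (here refl) = inj₂ (refl , ℕ.≤-refl)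
∈-before⁻ n (suc i) (suc j) (here refl) = inj₂ (refl , ℕ.≤-refl)
∈-before⁻ n zero    (suc j) (there q∈) with ∈-before⁻ n zero j q∈
... | inj₂ (i≡ , j<) = inj₂ (i≡ , ℕ.m<n⇒m<1+n j<)
∈-before⁻ n (suc i) (suc j) (there q∈) with ∈-before⁻ n (suc i) j q∈
... | inj₁ i<        = inj₁ i<
... | inj₂ (i≡ , j<) = inj₂ (i≡ , ℕ.m<n⇒m<1+n j<)

∈-before⁺ : ∀ n i j {i′ j′} → j′ < n → (i′ , j′) ≺ (i , j) → (i′ , j′) ∈ˡ before n i j
∈-before⁺ n zero    zero    j′<n (inj₁ ())
∈-before⁺ n zero    zero    j′<n (inj₂ (_ , ()))
∈-before⁺ n (suc i) zero    j′<n (inj₁ (s≤s i′≤i)) =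
  ∈-before⁺ n i n j′<n ([ inj₁ , (λ eq → inj₂ (eq , j′<n)) ] (ℕ.m≤n⇒m<n∨m≡n i′≤i))
∈-before⁺ n zero    (suc j) j′<n (inj₂ (eq , s≤s j′≤j)) =
  [ (λ j′<j → there (∈-before⁺ n zero j j′<n (inj₂ (eq , j′<j)))) , (λ eq′ → here (cong₂ _,_ eq eq′)) ]
  (ℕ.m≤n⇒m<n∨m≡n j′≤j)
∈-before⁺ n (suc i) (suc j) j′<n (inj₁ i′<) = there (∈-before⁺ n (suc i) j j′<n (inj₁ i′<))
∈-before⁺ n (suc i) (suc j) j′<n (inj₂ (eq , s≤s j′≤j)) =
  [ (λ j′<j → there (∈-before⁺ n (suc i) j j′<n (inj₂ (eq , j′<j)))) , (λ eq′ → here (cong₂ _,_ eq eq′)) ]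
  (ℕ.m≤n⇒m<n∨m≡n j′≤j)

≺-irrefl : ∀ {q} → ¬ q ≺ q
≺-irrefl (inj₁ i<i)       = ℕ.<-irrefl refl i<i
≺-irrefl (inj₂ (_ , j<j)) = ℕ.<-irrefl refl j<j

before-unique : ∀ n i j → AllPairs _≢_ (before n i j)
before-unique n zero    zero    = []
before-unique n (suc i) zero    = before-unique n i n
before-unique n zero    (suc j) =
  All.tabulate (λ q∈ eq → ≺-irrefl (subst (_≺ _) (sym eq) (∈-before⁻ n zero j q∈))) ∷ before-unique n zero j
before-unique n (suc i) (suc j) =
  All.tabulate (λ q∈ eq → ≺-irrefl (subst (_≺ _) (sym eq) (∈-before⁻ n (suc i) j q∈))) ∷ before-unique n (suc i) j

_≟ₚ_ : DecidableEquality Position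
_≟ₚ_ = ≡-dec ℕ._≟_ ℕ._≟_

open UnionFind _≟ₚ_ using (redundant; union-find)

-- The lattice cell (i , j) sits at position (2 + i , 2 + j), so that all
-- offsets below are natural numbers.
v-at b-at a-at c-at d-at e-at f-at g-at : Position → Position
v-at = translate 2 2
b-at = translate 1 2
a-at = translate 1 3
c-at = translate 2 1
d-at = translate 2 0
e-at = translate 1 1
f-at = translate 0 3
g-at = translate 0 2

event : ∀ {k} → Subset k → Vec.Vec Position k → (Position → Bool) → Position → Bool
event s offsets ω q = match s (Vec.map (λ (a , b) → ω (translate a b q)) offsets)

-- In the order v, b, a, c, so that the events below unfold to exactly the conjunctions in
-- `newLinks-upper` and `newLinks-lower`.
neighbours : Vec.Vec Position 4
neighbours = (2 , 2) ∷ (1 , 2) ∷ (1 , 3) ∷ (2 , 1) ∷ []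

-- Adding v starts a new cluster.
birth : (Position → Bool) → Position → Bool
birth = event (inside ∷ outside ∷ outside ∷ outside ∷ []) neighbours

-- Adding v may merge the clusters of a and c.
meeting : (Position → Bool) → Position → Bool
meeting = event (inside ∷ outside ∷ inside ∷ inside ∷ []) neighbours

-- A meeting where c was isolated, so that it does merge two clusters.
merger : (Position → Bool) → Position → Bool
merger = event (inside ∷ outside ∷ inside ∷ inside ∷ outside ∷ outside ∷ [])
  (neighbours Vec.++ (2 , 0) ∷ (1 , 1) ∷ [])

-- A meeting that closes the hexagon around b, so that it does not merge.
hexagon : (Position → Bool) → Position → Bool
hexagon = event (inside ∷ outside ∷ inside ∷ inside ∷ inside ∷ inside ∷ inside ∷ [])
  (neighbours Vec.++ (1 , 1) ∷ (0 , 3) ∷ (0 , 2) ∷ [])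

count : (Position → Bool) → List Position → ℕ
count P []       = 0
count P (q ∷ qs) = indicator (P q) + count P qs

private
  -- Telescoping: `r`, the redundancy of the earlier edges, occurs on both sides of the sum of the
  -- two hypotheses and cancels.
  upper-step : ∀ iv r r′ s bi ln L S B e → iv + r′ + s ≤ bi + (ln + r) → L + r + S ≤ B + e →
    iv + L + r′ + (s + S) ≤ bi + B + (ln + e)
  upper-step iv r r′ s bi ln L S B e h h′ = ℕ.+-cancelʳ-≤ r _ _
    (subst₂ _≤_ (lhs iv r r′ s L S) (rhs r bi ln B e) (ℕ.+-mono-≤ h h′))
    where
    lhs : ∀ iv r r′ s L S → iv + r′ + s + (L + r + S) ≡ iv + L + r′ + (s + S) + r
    lhs = solve-∀
    rhs : ∀ r bi ln B e → bi + (ln + r) + (B + e) ≡ bi + B + (ln + e) + r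
    rhs = solve-∀

  lower-step : ∀ iv r r′ m bi h ln L M B H e → bi + h + (ln + r) ≤ iv + r′ + m → B + H + e ≤ L + r + M →
    bi + B + (h + H) + (ln + e) ≤ iv + L + r′ + (m + M)
  lower-step iv r r′ m bi h ln L M B H e p p′ = ℕ.+-cancelʳ-≤ r _ _
    (subst₂ _≤_ (lhs r bi h ln B H e) (rhs iv r r′ m L M) (ℕ.+-mono-≤ p p′))
    where
    lhs : ∀ r bi h ln B H e → bi + h + (ln + r) + (B + H + e) ≡ bi + B + (h + H) + (ln + e) + r
    lhs = solve-∀
    rhs : ∀ iv r r′ m L M → iv + r′ + m + (L + r + M) ≡ iv + L + r′ + (m + M) + r
    rhs = solve-∀

  swap-last : ∀ a b c → a + b + c ≡ a + c + b
  swap-last = solve-∀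

  ∧-true : ∀ {x y} → x ∧ y ≡ true → x ≡ true × y ≡ true
  ∧-true {true} eq = refl , eq

  not-true : ∀ {x} → not x ≡ true → x ≢ true
  not-true {false} _ ()

-- The sweep of a fixed configuration

module Sweep (n : ℕ) (ω : Position → Bool)
             (in-box : ∀ {x} → ω x ≡ true → ∃[ i ] ∃[ j ] x ≡ (2 + i , 2 + j) × i < n × j < n) where

  newEdges : Position → List (Position × Position)
  newEdges q = link (ω (v-at q) ∧ ω (c-at q)) (v-at q) (c-at q)
    ++ link (ω (v-at q) ∧ ω (a-at q)) (v-at q) (a-at q)
    ++ link (ω (v-at q) ∧ ω (b-at q)) (v-at q) (b-at q)

  edges : List Position → List (Position × Position)
  edges []       = []
  edges (q ∷ qs) = newEdges q ++ edges qs

  vertices : List Position → List Position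
  vertices []       = []
  vertices (q ∷ qs) = if ω (v-at q) then v-at q ∷ vertices qs else vertices qs

  private
    ∈-link⁺ : ∀ {t} {x y : Position} → t ≡ true → (x , y) ∈ˡ link t x y
    ∈-link⁺ refl = here refl

    ∈-link⁻ : ∀ t {x y u w : Position} → (x , y) ∈ˡ link t u w → t ≡ true × x ≡ u × y ≡ w
    ∈-link⁻ true (here refl) = refl , refl , refl

    both : ∀ {x y} → ω x ≡ true → ω y ≡ true → ω x ∧ ω y ≡ true
    both p q rewrite p | q = refl

    ∈-newEdges⁻ : ∀ q {x y} → (x , y) ∈ˡ newEdges q → x ≡ v-at q × ω x ≡ true × ω y ≡ true ×
      (y ≡ c-at q ⊎ y ≡ a-at q ⊎ y ≡ b-at q)
    ∈-newEdges⁻ q e∈ with ∈ˡ.∈-++⁻ (link (ω (v-at q) ∧ ω (c-at q)) (v-at q) (c-at q)) e∈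
    ... | inj₁ e∈c with ∈-link⁻ _ e∈c
    ...   | t , refl , refl = refl , proj₁ (∧-true t) , proj₂ (∧-true t) , inj₁ refl
    ∈-newEdges⁻ q e∈ | inj₂ e∈ab with ∈ˡ.∈-++⁻ (link (ω (v-at q) ∧ ω (a-at q)) (v-at q) (a-at q)) e∈ab
    ... | inj₁ e∈a with ∈-link⁻ _ e∈a
    ...   | t , refl , refl = refl , proj₁ (∧-true t) , proj₂ (∧-true t) , inj₂ (inj₁ refl)
    ∈-newEdges⁻ q e∈ | inj₂ e∈ab | inj₂ e∈b with ∈-link⁻ _ e∈b
    ...   | t , refl , refl = refl , proj₁ (∧-true t) , proj₂ (∧-true t) , inj₂ (inj₂ refl)

    ∈-edges⁺ : ∀ {q qs e} → q ∈ˡ qs → e ∈ˡ newEdges q → e ∈ˡ edges qs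
    ∈-edges⁺ (here refl) e∈ = ∈ˡ.∈-++⁺ˡ e∈
    ∈-edges⁺ {qs = q ∷ _} (there q∈) e∈ = ∈ˡ.∈-++⁺ʳ (newEdges q) (∈-edges⁺ q∈ e∈)

    ∈-edges⁻ : ∀ qs {e} → e ∈ˡ edges qs → ∃[ q ] q ∈ˡ qs × e ∈ˡ newEdges q
    ∈-edges⁻ (q ∷ qs) e∈ with ∈ˡ.∈-++⁻ (newEdges q) e∈
    ... | inj₁ e∈q  = q , here refl , e∈q
    ... | inj₂ e∈qs = let q′ , q′∈ , e∈q′ = ∈-edges⁻ qs e∈qs in q′ , there q′∈ , e∈q′

    ∈-vertices⁺ : ∀ {q qs} → q ∈ˡ qs → ω (v-at q) ≡ true → v-at q ∈ˡ vertices qs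
    ∈-vertices⁺ (here refl) open′ rewrite open′ = here refl
    ∈-vertices⁺ {qs = q′ ∷ _} (there q∈) open′ with ω (v-at q′)
    ... | true  = there (∈-vertices⁺ q∈ open′)
    ... | false = ∈-vertices⁺ q∈ open′

    ∈-vertices⁻ : ∀ qs {x} → x ∈ˡ vertices qs → ω x ≡ true × ∃[ q ] q ∈ˡ qs × x ≡ v-at q
    ∈-vertices⁻ (q ∷ qs) x∈ with ω (v-at q) in eq
    ∈-vertices⁻ (q ∷ qs) (here refl) | true = eq , q , here refl , refl
    ∈-vertices⁻ (q ∷ qs) (there x∈)  | true  = let o , q′ , q′∈ , x≡ = ∈-vertices⁻ qs x∈ in o , q′ , there q′∈ , x≡
    ∈-vertices⁻ (q ∷ qs) x∈          | false = let o , q′ , q′∈ , x≡ = ∈-vertices⁻ qs x∈ in o , q′ , there q′∈ , x≡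

    vertices-unique : ∀ {qs} → AllPairs _≢_ qs → AllPairs _≢_ (vertices qs)
    vertices-unique [] = []
    vertices-unique {q ∷ qs} (q∉ ∷ qs!) with ω (v-at q)
    ... | false = vertices-unique qs!
    ... | true  = All.tabulate (λ x∈ eq → let _ , q′ , q′∈ , x≡ = ∈-vertices⁻ qs x∈ in
      All.lookup q∉ q′∈ (translate-injective 2 2 (trans eq x≡))) ∷ vertices-unique qs!

    edge-c : ∀ {q qs} → q ∈ˡ qs → ω (v-at q) ≡ true → ω (c-at q) ≡ true → (v-at q , c-at q) ∈ˡ edges qs
    edge-c q∈ v c = ∈-edges⁺ q∈ (∈ˡ.∈-++⁺ˡ (∈-link⁺ (both v c)))

    edge-a : ∀ {q qs} → q ∈ˡ qs → ω (v-at q) ≡ true → ω (a-at q) ≡ true → (v-at q , a-at q) ∈ˡ edges qs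
    edge-a {q} q∈ v a = ∈-edges⁺ q∈
      (∈ˡ.∈-++⁺ʳ (link (ω (v-at q) ∧ ω (c-at q)) (v-at q) (c-at q)) (∈ˡ.∈-++⁺ˡ (∈-link⁺ (both v a))))

    edge-b : ∀ {q qs} → q ∈ˡ qs → ω (v-at q) ≡ true → ω (b-at q) ≡ true → (v-at q , b-at q) ∈ˡ edges qs
    edge-b {q} q∈ v b = ∈-edges⁺ q∈
      (∈ˡ.∈-++⁺ʳ (link (ω (v-at q) ∧ ω (c-at q)) (v-at q) (c-at q))
        (∈ˡ.∈-++⁺ʳ (link (ω (v-at q) ∧ ω (a-at q)) (v-at q) (a-at q)) (∈-link⁺ (both v b))))

    module _ (i j : ℕ) where
      𝓔 : List (Position × Position)
      𝓔 = edges (before n i j)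
      q : Position
      q = i , j

      -- Every earlier edge joins a cell that precedes `q` to a neighbour that precedes that cell in
      -- turn, so `v` cannot be an endpoint.
      fresh : ¬ Any (Endpoint (v-at q)) 𝓔
      fresh v∈E with find v∈E
      ... | (x , y) , e∈E , v≡ with ∈-edges⁻ (before n i j) e∈E
      ... | (i′ , j′) , q′∈ , e∈ with ∈-newEdges⁻ (i′ , j′) e∈ | ∈-before⁻ n i j q′∈
      fresh v∈E | _ , _ , inj₁ refl | _ | refl , _ | q′≺q = ≺-irrefl q′≺q
      fresh v∈E | _ , _ , inj₂ refl | _ | _ , _ , _ , inj₁ refl | inj₁ i<i = ℕ.<-irrefl refl i<i
      fresh v∈E | _ , _ , inj₂ refl | _ | _ , _ , _ , inj₁ refl | inj₂ (_ , j<) = ℕ.<-asym j< ℕ.≤-refl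
      fresh v∈E | _ , _ , inj₂ refl | _ | _ , _ , _ , inj₂ (inj₁ refl) | inj₁ i< = ℕ.<-asym i< ℕ.≤-refl
      fresh v∈E | _ , _ , inj₂ refl | _ | _ , _ , _ , inj₂ (inj₁ refl) | inj₂ (i≡ , _) = ℕ.1+n≢n i≡
      fresh v∈E | _ , _ , inj₂ refl | _ | _ , _ , _ , inj₂ (inj₂ refl) | inj₁ i< = ℕ.<-asym i< ℕ.≤-refl
      fresh v∈E | _ , _ , inj₂ refl | _ | _ , _ , _ , inj₂ (inj₂ refl) | inj₂ (i≡ , _) = ℕ.1+n≢n i≡

      -- Seen from `a`, the vertex `b` is the neighbour of type c, so the edge was added together
      -- with `a`; likewise `b` is the neighbour of type a of `c` in `b~c`. Openness supplies,
      -- through `in-box`, the cell indices under which the edge is found.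
      b~a : ω (b-at q) ≡ true → ω (a-at q) ≡ true → Linked 𝓔 (b-at q) (a-at q)
      b~a b a with in-box a
      ... | _ , _ , refl , _ , j< = Linked-sym 𝓔
        (edge⇒Linked 𝓔 (edge-c (∈-before⁺ n i j j< (inj₁ ℕ.≤-refl)) a b))

      b~c : ω (b-at q) ≡ true → ω (c-at q) ≡ true → Linked 𝓔 (b-at q) (c-at q)
      b~c b c with in-box c
      ... | _ , _ , refl , _ , j< = Linked-sym 𝓔
        (edge⇒Linked 𝓔 (edge-a (∈-before⁺ n i j j< (inj₂ (refl , ℕ.≤-refl))) c b))

      -- The earlier neighbours of `c` are `d`, `b` and `e`, all closed here. A cell that has `c` as
      -- an earlier neighbour is `q` itself or comes after it, so it has not contributed edges yet.
      -- Hence `c` is an endpoint of no edge.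
      isolated-c : ω (b-at q) ≡ false → ω (d-at q) ≢ true → ω (e-at q) ≢ true → ¬ Linked 𝓔 (a-at q) (c-at q)
      isolated-c b d e a~c = contradiction (Linked-isolated 𝓔 c∉E (Linked-sym 𝓔 a~c)) λ ()
        where
        c∉E : ¬ Any (Endpoint (c-at q)) 𝓔
        c∉E c∈E with find c∈E
        ... | (x , y) , e∈E , c≡ with ∈-edges⁻ (before n i j) e∈E
        ... | (i′ , j′) , q′∈ , e∈ with ∈-newEdges⁻ (i′ , j′) e∈ | ∈-before⁻ n i j q′∈
        c∉E c∈E | _ , _ , inj₁ refl | _ | refl , _ , y , inj₁ refl | _ = d y
        c∉E c∈E | _ , _ , inj₁ refl | _ | refl , _ , y , inj₂ (inj₁ refl) | _ = contradiction (trans (sym b) y) λ ()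
        c∉E c∈E | _ , _ , inj₁ refl | _ | refl , _ , y , inj₂ (inj₂ refl) | _ = e y
        c∉E c∈E | _ , _ , inj₂ refl | _ | _ , _ , _ , inj₁ refl | q′≺q = ≺-irrefl q′≺q
        c∉E c∈E | _ , _ , inj₂ refl | _ | _ , _ , _ , inj₂ (inj₁ refl) | inj₁ i< = ℕ.<-asym i< ℕ.≤-refl
        c∉E c∈E | _ , _ , inj₂ refl | _ | _ , _ , _ , inj₂ (inj₁ refl) | inj₂ (i≡ , _) = ℕ.1+n≢n i≡
        c∉E c∈E | _ , _ , inj₂ refl | _ | _ , _ , _ , inj₂ (inj₂ refl) | inj₁ i< = ℕ.<-asym i< ℕ.≤-refl
        c∉E c∈E | _ , _ , inj₂ refl | _ | _ , _ , _ , inj₂ (inj₂ refl) | inj₂ (i≡ , _) = ℕ.1+n≢n i≡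

      -- The path a, f, g, e, c around b.
      around-b : ω (a-at q) ≡ true → ω (c-at q) ≡ true → ω (e-at q) ≡ true → ω (f-at q) ≡ true →
        ω (g-at q) ≡ true → Linked 𝓔 (a-at q) (c-at q)
      around-b a c e f g with in-box f | in-box e
      ... | i₀ , _ , refl , _ , 1+j<n | _ , j₀ , refl , _ , j₀<n =
        Linked-trans 𝓔 (edge⇒Linked 𝓔 (edge-b (∈-before⁺ n i j 1+j<n (inj₁ ℕ.≤-refl)) a f))
          (Linked-trans 𝓔 (edge⇒Linked 𝓔 (edge-c (∈-before⁺ n i j 1+j<n (inj₁ (ℕ.n≤1+n _))) f g))
            (Linked-trans 𝓔 (Linked-sym 𝓔 (edge⇒Linked 𝓔 (edge-a (∈-before⁺ n i j j₀<n (inj₁ ℕ.≤-refl)) e g)))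
              (Linked-sym 𝓔 (edge⇒Linked 𝓔 (edge-b (∈-before⁺ n i j j₀<n (inj₂ (refl , ℕ.≤-refl))) c e)))))

      open AddVertex _≟ₚ_ 𝓔 {v-at q} {b-at q} {a-at q} {c-at q} fresh (λ ()) (λ ()) (λ eq → ℕ.1+n≢n (cong proj₂ eq))

      Upper Lower : List Position → Set
      Upper qs = length (vertices qs) + redundant (edges qs) + count (merger ω) qs ≤
        count (birth ω) qs + length (edges qs)
      Lower qs = count (birth ω) qs + count (hexagon ω) qs + length (edges qs) ≤
        length (vertices qs) + redundant (edges qs) + count (meeting ω) qs

      length-vertices : length (vertices (q ∷ before n i j)) ≡
        indicator (ω (v-at q)) + length (vertices (before n i j))
      length-vertices with ω (v-at q)
      ... | true  = refl
      ... | false = refl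

      upper-∷ : Upper (before n i j) → Upper (q ∷ before n i j)
      upper-∷ ih = subst₂ (λ l m → l + redundant (newEdges q ++ 𝓔) + count (merger ω) (q ∷ before n i j) ≤
          count (birth ω) (q ∷ before n i j) + m) (sym length-vertices) (sym (List.length-++ (newEdges q)))
        (upper-step (indicator (ω (v-at q))) (redundant 𝓔) (redundant (newEdges q ++ 𝓔)) (indicator (merger ω q))
          (indicator (birth ω q)) (length (newEdges q)) (length (vertices (before n i j)))
          (count (merger ω) (before n i j)) (count (birth ω) (before n i j)) (length 𝓔)
          (newLinks-upper (ω (v-at q)) (ω (b-at q)) (ω (a-at q)) (ω (c-at q))
            (not (ω (d-at q)) ∧ (not (ω (e-at q)) ∧ true)) b~a b~c
            (λ b z → isolated-c b (not-true (proj₁ (∧-true z)))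
              (not-true (proj₁ (∧-true (proj₂ (∧-true {not (ω (d-at q))} z)))))))
          ih)

      lower-∷ : Lower (before n i j) → Lower (q ∷ before n i j)
      lower-∷ ih = subst₂ (λ l m → count (birth ω) (q ∷ before n i j) + count (hexagon ω) (q ∷ before n i j) + m ≤
          l + redundant (newEdges q ++ 𝓔) + count (meeting ω) (q ∷ before n i j))
          (sym length-vertices) (sym (List.length-++ (newEdges q)))
        (lower-step (indicator (ω (v-at q))) (redundant 𝓔) (redundant (newEdges q ++ 𝓔)) (indicator (meeting ω q))
          (indicator (birth ω q)) (indicator (hexagon ω q)) (length (newEdges q)) (length (vertices (before n i j)))
          (count (meeting ω) (before n i j)) (count (birth ω) (before n i j)) (count (hexagon ω) (before n i j)) (length 𝓔)
          (newLinks-lower (ω (v-at q)) (ω (b-at q)) (ω (a-at q)) (ω (c-at q))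
            (ω (e-at q) ∧ (ω (f-at q) ∧ (ω (g-at q) ∧ true))) b~a b~c
            (λ _ a c h → let e , h′ = ∧-true h ; f , h″ = ∧-true h′ in around-b a c e f (proj₁ (∧-true h″))))
          ih)

    bounds : ∀ i j → Upper i j (before n i j) × Lower i j (before n i j)
    bounds zero    zero    = z≤n , z≤n
    bounds (suc i) zero    = bounds i n
    bounds zero    (suc j) = let u , l = bounds zero j in upper-∷ zero j u , lower-∷ zero j l
    bounds (suc i) (suc j) = let u , l = bounds (suc i) j in upper-∷ (suc i) j u , lower-∷ (suc i) j l

  cells : List Position
  cells = before n n 0

  private
    Open : Position → Set
    Open x = ω x ≡ true

    open⇒cell : ∀ {x} → Open x → ∃[ q ] q ∈ˡ cells × x ≡ v-at q
    open⇒cell o = let i , j , x≡ , i<n , j<n = in-box o in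
      (i , j) , ∈-before⁺ n n 0 j<n (inj₁ i<n) , x≡

    classes = union-find {P = Open} {V = vertices cells}
      (All.tabulate (λ x∈ → proj₁ (∈-vertices⁻ cells x∈)))
      (vertices-unique (before-unique n n 0))
      (λ x o → let q , q∈ , x≡ = open⇒cell o in
        subst (_∈ˡ vertices cells) (sym x≡) (∈-vertices⁺ q∈ (subst Open x≡ o)))
      (edges cells)
      (All.tabulate (λ e∈ → let q , _ , e∈q = ∈-edges⁻ cells e∈ ; _ , u , w , _ = ∈-newEdges⁻ q e∈q in u , w))

    ahead⇒edge : ∀ {x y} → Open x → Open y → Ahead x y → Linked (edges cells) x y
    ahead⇒edge ox oy ah with open⇒cell ox | open⇒cell oy
    ahead⇒edge ox oy (inj₁ (refl , refl)) | _ , _ , refl | _ , q∈ , refl =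
      Linked-sym (edges cells) (edge⇒Linked (edges cells) (edge-b q∈ oy ox))
    ahead⇒edge ox oy (inj₂ (inj₁ (refl , refl))) | _ , _ , refl | _ , q∈ , refl =
      Linked-sym (edges cells) (edge⇒Linked (edges cells) (edge-c q∈ oy ox))
    ahead⇒edge ox oy (inj₂ (inj₂ (refl , refl))) | _ , _ , refl | _ , q∈ , refl =
      Linked-sym (edges cells) (edge⇒Linked (edges cells) (edge-a q∈ oy ox))

    cluster⇒linked : ∀ {x y} → Cluster Open x y → Linked (edges cells) x y
    cluster⇒linked ε = Linked-refl (edges cells)
    cluster⇒linked ((ox , oy , inj₁ a) ◅ path) =
      Linked-trans (edges cells) (ahead⇒edge ox oy a) (cluster⇒linked path)
    cluster⇒linked ((ox , oy , inj₂ a) ◅ path) =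
      Linked-trans (edges cells) (Linked-sym (edges cells) (ahead⇒edge oy ox a)) (cluster⇒linked path)

    edge⇒near : ∀ {x y} → (x , y) ∈ˡ edges cells → Cluster Open x y
    edge⇒near e∈ with ∈-edges⁻ cells e∈
    ... | q , _ , e∈q with ∈-newEdges⁻ q e∈q
    ... | refl , ox , oy , inj₁ refl        = (ox , oy , inj₂ (inj₂ (inj₁ (refl , refl)))) ◅ ε
    ... | refl , ox , oy , inj₂ (inj₁ refl) = (ox , oy , inj₂ (inj₂ (inj₂ (refl , refl)))) ◅ ε
    ... | refl , ox , oy , inj₂ (inj₂ refl) = (ox , oy , inj₂ (inj₁ (refl , refl))) ◅ ε

    linked⇒cluster : ∀ {x y} → Linked (edges cells) x y → Cluster Open x y
    linked⇒cluster = Linked-minimal ε (Cluster-sym Open) _◅◅_ (edges cells) edge⇒near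

  module _ {N : ℕ} (c : Classes Open (Cluster Open) N) where

    private
      -- Clusters and linked classes are the same classes, so `N` agrees with the number produced by
      -- `union-find` and inherits its Euler count.
      N≡ : N + length (edges cells) ≡ length (vertices cells) + redundant (edges cells)
      N≡ with classes
      ... | k , d , eq = trans (cong (_+ length (edges cells)) (ℕ.≤-antisym
        (Classes-≤ (Linked-sym (edges cells)) (Linked-trans (edges cells)) id (λ _ _ → linked⇒cluster) c d)
        (Classes-≤ (Cluster-sym Open) _◅◅_ id (λ _ _ → cluster⇒linked) d c))) eq

    clusters+mergers≤births : N + count (merger ω) cells ≤ count (birth ω) cells
    clusters+mergers≤births = ℕ.+-cancelʳ-≤ (length (edges cells)) _ _
      (subst (_≤ count (birth ω) cells + length (edges cells))
        (trans (cong (_+ count (merger ω) cells) (sym N≡)) (swap-last N (length (edges cells)) (count (merger ω) cells)))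
        (proj₁ (bounds n 0)))

    births+hexagons≤clusters+meetings :
      count (birth ω) cells + count (hexagon ω) cells ≤ N + count (meeting ω) cells
    births+hexagons≤clusters+meetings = ℕ.+-cancelʳ-≤ (length (edges cells)) _ _
      (subst (count (birth ω) cells + count (hexagon ω) cells + length (edges cells) ≤_)
        (trans (cong (_+ count (meeting ω) cells) (sym N≡)) (swap-last N (length (edges cells)) (count (meeting ω) cells)))
        (proj₂ (bounds n 0)))

-- Expected local counts

indicator≤1 : ∀ b → indicator b ≤ 1
indicator≤1 true  = ℕ.≤-refl
indicator≤1 false = z≤n

weight : ℚ → ∀ {k} → Subset k → ℚ
weight p []            = 1ℚ
weight p (inside ∷ s)  = p ℚ.* weight p s
weight p (outside ∷ s) = (1ℚ ℚ.- p) ℚ.* weight p s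

E-match : ∀ p {k} (s : Subset k) → E p (λ S → ⟪ indicator (match s S) ⟫) ≡ weight p s
E-match p []                    = refl
E-match p {suc k} (inside ∷ s)  = trans
  (cong₂ (λ x y → p ℚ.* x ℚ.+ (1ℚ ℚ.- p) ℚ.* y) (E-match p s) (E-const p k 0ℚ))
  (solve 2 (λ p w → p :* w :+ (con 1ℚ :- p) :* con 0ℚ := p :* w) refl p (weight p s))
E-match p {suc k} (outside ∷ s) = trans
  (cong₂ (λ x y → p ℚ.* x ℚ.+ (1ℚ ℚ.- p) ℚ.* y) (E-const p k 0ℚ) (E-match p s))
  (solve 2 (λ p w → p :* con 0ℚ :+ (con 1ℚ :- p) :* w := (con 1ℚ :- p) :* w) refl p (weight p s))

E-indicator : ∀ {p} → ⟦0,1⟧ p → ∀ {m} (P : Subset m → Bool) →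
  0ℚ ℚ.≤ E p (λ S → ⟪ indicator (P S) ⟫) × E p (λ S → ⟪ indicator (P S) ⟫) ℚ.≤ 1ℚ
E-indicator p∈ P = E-bounds p∈ _ (λ S → 0≤⟪⟫ (indicator (P S)) , ⟪⟫-mono {n = 1} (indicator≤1 (P S)))

module OpenPositions (n : ℕ) where

  private
    e = placed 2 2 n n

  occupied? : ∀ S x → Dec (Occupied e S x)
  occupied? S x = Fin.any? (λ u → (u ∈? S) ×-dec (at e u ≟ₚ x))

  -- Positions outside the box count as closed, so the local events are defined at border cells as
  -- well.
  openAt : Subset (n * n) → Position → Bool
  openAt S x = does (occupied? S x)

  openAt⁺ : ∀ S {x} → Occupied e S x → openAt S x ≡ true
  openAt⁺ S {x} o = dec-true (occupied? S x) o

  openAt⁻ : ∀ S {x} → openAt S x ≡ true → Occupied e S x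
  openAt⁻ S {x} eq with occupied? S x
  ... | yes o = o

  openAt-lookup : ∀ S u → openAt S (at e u) ≡ lookup S u
  openAt-lookup S u with lookup S u in eq
  ... | true  = openAt⁺ S (u , Vec.lookup⇒[]= u S eq , refl)
  ... | false = dec-false (occupied? S (at e u)) closed
    where
    closed : ¬ Occupied e S (at e u)
    closed (w , w∈S , at≡) with at-injective e {w} {u} at≡
    ... | refl = contradiction (trans (sym eq) (Vec.[]=⇒lookup w∈S)) λ ()

  in-box : ∀ S {x} → openAt S x ≡ true → ∃[ i ] ∃[ j ] x ≡ (2 + i , 2 + j) × i < n × j < n
  in-box S eq with openAt⁻ S eq
  ... | u , _ , refl = toℕ (proj₁ (remQuot {n} n u)) , toℕ (proj₂ (remQuot {n} n u)) , refl ,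
    Fin.toℕ<n (proj₁ (remQuot {n} n u)) , Fin.toℕ<n (proj₂ (remQuot {n} n u))

  openClusters : ∀ S → Classes (λ x → openAt S x ≡ true) (Cluster (λ x → openAt S x ≡ true)) (numComponents (rect n n) S)
  openClusters S = Classes-cong (openAt⁺ S) (openAt⁻ S)
    (Star.map (λ (a , b , n) → openAt⁺ S a , openAt⁺ S b , n))
    (Star.map (λ (a , b , n) → openAt⁻ S a , openAt⁻ S b , n)) (clusters e S)

  reach : ∀ {x y} → 2 ≤ x → x < 2 + n → 2 ≤ y → y < 2 + n → ∃[ u ] at e u ≡ (x , y)
  reach (s≤s (s≤s (z≤n {i}))) (s≤s (s≤s i<n)) (s≤s (s≤s (z≤n {j}))) (s≤s (s≤s j<n)) =
    combine (fromℕ< i<n) (fromℕ< j<n) ,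
    trans (cong (translate 2 2) (coordinates-combine n n (fromℕ< i<n) (fromℕ< j<n)))
      (cong₂ (λ i j → (2 + i , 2 + j)) (Fin.toℕ-fromℕ< i<n) (Fin.toℕ-fromℕ< j<n))

  -- Distinctness makes the observed vertices independent, and the bounds 2 and 3 keep the pattern
  -- inside the box at interior cells. Being decidable, both are checked by evaluation for each
  -- concrete pattern.
  Near-offsets : ∀ {k} → Vec.Vec Position k → Set
  Near-offsets {k} offsets =
    (∀ (a b : Fin k) → lookup offsets a ≡ lookup offsets b → a ≡ b) ×
    (∀ (a : Fin k) → proj₁ (lookup offsets a) ≤ 2 × proj₂ (lookup offsets a) ≤ 3)

  near-offsets? : ∀ {k} (offsets : Vec.Vec Position k) → Dec (Near-offsets offsets)
  near-offsets? offsets =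
    Fin.all? (λ a → Fin.all? (λ b → (lookup offsets a ≟ₚ lookup offsets b) →-dec (a Fin.≟ b))) ×-dec
    Fin.all? (λ a → (proj₁ (lookup offsets a) ℕ.≤? 2) ×-dec (proj₂ (lookup offsets a) ℕ.≤? 3))

  -- The box occupies the coordinates from 2 to `n + 1`, and offsets range over 0 to 2 and 0 to 3.
  -- Offset 0 forces the two lower bounds; offsets 2 and 3 force `i < n` and `suc j < n`.
  Interior : Position → Set
  Interior (i , j) = 2 ≤ i × i < n × 2 ≤ j × suc j < n

  E-event : ∀ p {k} (s : Subset k) (offsets : Vec.Vec Position k) → Near-offsets offsets →
    ∀ q → Interior q → E p (λ S → ⟪ indicator (event s offsets (openAt S) q) ⟫) ≡ weight p s
  E-event p {k} s offsets (distinct , near) (i , j) (2≤i , i<n , 2≤j , 1+j<n) = begin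
    E p (λ S → ⟪ indicator (event s offsets (openAt S) (i , j)) ⟫)
      ≡⟨ E-cong p (λ S → cong (λ xs → ⟪ indicator (match s xs) ⟫) (seen S)) ⟩
    E p (λ S → ⟪ indicator (match s (select ι S)) ⟫)
      ≡⟨ E-select p ι ι-injective (λ S → ⟪ indicator (match s S) ⟫) ⟩
    E p (λ S → ⟪ indicator (match s S) ⟫)
      ≡⟨ E-match p s ⟩
    weight p s ∎
    where
    open ≡-Reasoning
    target : Fin k → Position
    target a = proj₁ (lookup offsets a) + i , proj₂ (lookup offsets a) + j
    reached : ∀ a → ∃[ u ] at e u ≡ target a
    reached a = reach (ℕ.≤-trans 2≤i (ℕ.m≤n+m i _)) (s≤s (ℕ.≤-trans (ℕ.+-monoˡ-≤ i (proj₁ (near a)))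
        (subst (_≤ suc n) (ℕ.+-suc 1 i) (s≤s i<n))))
      (ℕ.≤-trans 2≤j (ℕ.m≤n+m j _)) (s≤s (ℕ.≤-trans (ℕ.+-monoˡ-≤ j (proj₂ (near a))) (s≤s 1+j<n)))
    ι : Fin k → Fin (n * n)
    ι a = proj₁ (reached a)
    ι-injective : Injective _≡_ _≡_ ι
    ι-injective {a} {b} eq = distinct a b (cong₂ _,_
      (ℕ.+-cancelʳ-≡ i _ _ (cong proj₁ same)) (ℕ.+-cancelʳ-≡ j _ _ (cong proj₂ same)))
      where
      same : target a ≡ target b
      same = trans (sym (proj₂ (reached a))) (trans (cong (at e) eq) (proj₂ (reached b)))
    seen : ∀ S → Vec.map (λ (a , b) → openAt S (translate a b (i , j))) offsets ≡ select ι S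
    seen S = trans (cong (Vec.map _) (sym (Vec.tabulate∘lookup offsets)))
      (trans (sym (Vec.tabulate-∘ _ (lookup offsets)))
        (Vec.tabulate-cong (λ a → trans (cong (openAt S) (sym (proj₂ (reached a)))) (openAt-lookup S (ι a)))))

sumℚ-count : ∀ (P : Position → Bool) qs → sumℚ qs (λ q → ⟪ indicator (P q) ⟫) ≡ ⟪ count P qs ⟫
sumℚ-count P []       = refl
sumℚ-count P (q ∷ qs) = trans (cong (⟪ indicator (P q) ⟫ ℚ.+_) (sumℚ-count P qs))
  (sym (⟪⟫-+ (indicator (P q)) (count P qs)))

E-count : ∀ p {m} (P : Subset m → Position → Bool) qs →
  E p (λ S → ⟪ count (P S) qs ⟫) ≡ sumℚ qs (λ q → E p (λ S → ⟪ indicator (P S q) ⟫))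
E-count p P qs = trans (E-cong p (λ S → sym (sumℚ-count (P S) qs)))
  (E-sum p qs (λ q S → ⟪ indicator (P S q) ⟫))

sumℚ-+ : ∀ {A : Set} (xs : List A) (f g : A → ℚ) → sumℚ xs (λ x → f x ℚ.+ g x) ≡ sumℚ xs f ℚ.+ sumℚ xs g
sumℚ-+ []       f g = refl
sumℚ-+ (x ∷ xs) f g = trans (cong (f x ℚ.+ g x ℚ.+_) (sumℚ-+ xs f g))
  (solve 4 (λ a b c d → (a :+ b) :+ (c :+ d) := (a :+ c) :+ (b :+ d)) refl (f x) (g x) (sumℚ xs f) (sumℚ xs g))

sumℚ-mono : ∀ {A : Set} (xs : List A) {f g : A → ℚ} → (∀ {x} → x ∈ˡ xs → f x ℚ.≤ g x) → sumℚ xs f ℚ.≤ sumℚ xs g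
sumℚ-mono []       f≤g = ℚ.≤-refl
sumℚ-mono (x ∷ xs) f≤g = ℚ.+-mono-≤ (f≤g (here refl)) (sumℚ-mono xs (f≤g ∘ there))

sumℚ-affine : ∀ {A : Set} (xs : List A) c d (f : A → ℚ) →
  sumℚ xs (λ x → c ℚ.+ d ℚ.* f x) ≡ ⟪ length xs ⟫ ℚ.* c ℚ.+ d ℚ.* sumℚ xs f
sumℚ-affine []       c d f = solve 2 (λ c d → con 0ℚ := con 0ℚ :* c :+ d :* con 0ℚ) refl c d
sumℚ-affine (x ∷ xs) c d f = trans (cong (c ℚ.+ d ℚ.* f x ℚ.+_) (sumℚ-affine xs c d f))
  (trans (solve 5 (λ c d y l s → (c :+ d :* y) :+ (l :* c :+ d :* s) := (con 1ℚ :+ l) :* c :+ d :* (y :+ s)) refl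
      c d (f x) ⟪ length xs ⟫ (sumℚ xs f))
    (cong (λ l → l ℚ.* c ℚ.+ d ℚ.* (f x ℚ.+ sumℚ xs f)) (sym (⟪⟫-+ 1 (length xs)))))

-- Border cells and sums over the box

module _ (n : ℕ) where

  north west east : Position → Bool
  north (zero , _)        = true
  north (suc zero , _)    = true
  north (suc (suc _) , _) = false
  west (_ , zero)         = true
  west (_ , suc zero)     = true
  west (_ , suc (suc _))  = false
  east (_ , j)            = does (n ℕ.≤? suc j)

  private
    count-north : ∀ i j → j ≤ n → count north (before n i j) ≤ n + n
    count-north₀ : ∀ j → count north (before n 0 j) ≤ j
    count-north₀ zero    = z≤n
    count-north₀ (suc j) = s≤s (count-north₀ j)
    count-north₁ : ∀ j → count north (before n 1 j) ≤ j + n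
    count-north₁ zero    = count-north₀ n
    count-north₁ (suc j) = s≤s (count-north₁ j)
    count-north zero    j j≤n = ℕ.≤-trans (count-north₀ j) (ℕ.≤-trans j≤n (ℕ.m≤m+n n n))
    count-north (suc zero) j j≤n = ℕ.≤-trans (count-north₁ j) (ℕ.+-monoˡ-≤ n j≤n)
    count-north (suc (suc i)) zero    _    = count-north (suc i) n ℕ.≤-refl
    count-north (suc (suc i)) (suc j) j<n = count-north (suc (suc i)) j (ℕ.<⇒≤ j<n)

    west-step : ∀ i j → indicator (west (i , j)) + (j ⊓ 2) ≤ suc j ⊓ 2
    west-step i zero          = ℕ.≤-refl
    west-step i (suc zero)    = ℕ.≤-refl
    west-step i (suc (suc j)) = s≤s (s≤s (ℕ.≤-reflexive (ℕ.⊓-zeroʳ j)))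

    count-west : ∀ i j → count west (before n i j) ≤ 2 * i + (j ⊓ 2)
    count-west-suc : ∀ i j {c} → c ≤ 2 * i + (j ⊓ 2) → indicator (west (i , j)) + c ≤ 2 * i + (suc j ⊓ 2)
    count-west-suc i j {c} c≤ = begin
      indicator (west (i , j)) + c                    ≤⟨ ℕ.+-monoʳ-≤ (indicator (west (i , j))) c≤ ⟩
      indicator (west (i , j)) + (2 * i + (j ⊓ 2))    ≡⟨ swap-first (indicator (west (i , j))) (2 * i) (j ⊓ 2) ⟩
      2 * i + (indicator (west (i , j)) + (j ⊓ 2))    ≤⟨ ℕ.+-monoʳ-≤ (2 * i) (west-step i j) ⟩
      2 * i + (suc j ⊓ 2)                             ∎
      where
      open ℕ.≤-Reasoning
      swap-first : ∀ a b c → a + (b + c) ≡ b + (a + c)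
      swap-first = solve-∀
    count-west zero    zero    = z≤n
    count-west (suc i) zero    = ℕ.≤-trans (count-west i n)
      (ℕ.≤-trans (ℕ.+-monoʳ-≤ (2 * i) (ℕ.m⊓n≤n n 2)) (ℕ.≤-reflexive (double i)))
      where
      double : ∀ i → 2 * i + 2 ≡ 2 * suc i + 0
      double = solve-∀
    count-west zero    (suc j) = count-west-suc zero j (count-west zero j)
    count-west (suc i) (suc j) = count-west-suc (suc i) j (count-west (suc i) j)

    east-false : ∀ {j} → j < n → does (n ℕ.≤? j) ≡ false
    east-false {j} j<n = dec-false (n ℕ.≤? j) (ℕ.<⇒≱ j<n)

    -- A row meets the east border in its last cell only, so the partial row of length `j`
    -- contributes only when it is complete.
    count-east : ∀ i j → j ≤ n → count east (before n i j) ≤ i + indicator (does (n ℕ.≤? j))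
    count-east-suc : ∀ i j {c} → j < n → c ≤ i + indicator (does (n ℕ.≤? j)) →
      indicator (does (n ℕ.≤? suc j)) + c ≤ i + indicator (does (n ℕ.≤? suc j))
    count-east-suc i j {c} j<n c≤ rewrite east-false j<n | ℕ.+-identityʳ i =
      subst (x + c ≤_) (ℕ.+-comm x i) (ℕ.+-monoʳ-≤ x c≤)
      where x = indicator (does (n ℕ.≤? suc j))
    count-east zero    zero    _   = z≤n
    count-east (suc i) zero    _   = ℕ.≤-trans (count-east i n ℕ.≤-refl)
      (ℕ.≤-trans (ℕ.+-monoʳ-≤ i (indicator≤1 (does (n ℕ.≤? n))))
        (ℕ.≤-trans (ℕ.≤-reflexive (ℕ.+-comm i 1)) (ℕ.m≤m+n (suc i) _)))
    count-east zero    (suc j) j<n = count-east-suc zero j j<n (count-east zero j (ℕ.<⇒≤ j<n))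
    count-east (suc i) (suc j) j<n = count-east-suc (suc i) j j<n (count-east (suc i) j (ℕ.<⇒≤ j<n))

    length-before : ∀ i j → length (before n i j) ≡ j + i * n
    length-before zero    zero    = refl
    length-before (suc i) zero    = length-before i n
    length-before zero    (suc j) = cong suc (length-before zero j)
    length-before (suc i) (suc j) = cong suc (length-before (suc i) j)

  border : Position → ℕ
  border q = indicator (north q) + (indicator (west q) + indicator (east q))

  private
    sumℚ-border : ∀ qs → sumℚ qs (λ q → ⟪ border q ⟫) ≡ ⟪ count north qs + (count west qs + count east qs) ⟫
    sumℚ-border []       = refl
    sumℚ-border (q ∷ qs) = trans (cong (⟪ border q ⟫ ℚ.+_) (sumℚ-border qs))
      (trans (sym (⟪⟫-+ (border q) (count north qs + (count west qs + count east qs))))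
        (cong ⟪_⟫ (regroup (indicator (north q)) (indicator (west q)) (indicator (east q))
          (count north qs) (count west qs) (count east qs))))
      where
      regroup : ∀ a b c x y z → a + (b + c) + (x + (y + z)) ≡ a + x + (b + y + (c + z))
      regroup = solve-∀

    border-total : count north (before n n 0) + (count west (before n n 0) + count east (before n n 0)) ≤ suc (5 * n)
    border-total = ℕ.≤-trans
      (ℕ.+-mono-≤ (count-north n 0 z≤n) (ℕ.+-mono-≤ (count-west n 0)
        -- The 1 in `suc (5 * n)` bounds this indicator, which is nonzero only for `n = 0`.
        (ℕ.≤-trans (count-east n 0 z≤n) (ℕ.+-monoʳ-≤ n (indicator≤1 (does (n ℕ.≤? 0)))))))
      (ℕ.≤-reflexive (total n))
      where
      total : ∀ n → n + n + (2 * n + 0 + (n + 1)) ≡ suc (5 * n)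
      total = solve-∀

    north-false : ∀ {i j} → indicator (north (i , j)) ≡ 0 → 2 ≤ i
    north-false {suc (suc i)} _ = s≤s (s≤s z≤n)

    west-false : ∀ {i j} → indicator (west (i , j)) ≡ 0 → 2 ≤ j
    west-false {j = suc (suc j)} _ = s≤s (s≤s z≤n)

    east-false⁻ : ∀ {i j} → indicator (east (i , j)) ≡ 0 → suc j < n
    east-false⁻ {j = j} eq = ℕ.≰⇒> λ n≤1+j →
      contradiction (trans (cong indicator (sym (dec-true (n ℕ.≤? suc j) n≤1+j))) eq) λ ()

    off-border⇒interior : ∀ {q} → q ∈ˡ before n n 0 → border q ≡ 0 → OpenPositions.Interior n q
    off-border⇒interior {i , j} q∈ eq with ∈-before⁻ n n 0 q∈
    ... | inj₁ i<n = north-false {i} {j} (ℕ.m+n≡0⇒m≡0 (indicator (north (i , j))) eq) , i<n ,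
      west-false {i} (ℕ.m+n≡0⇒m≡0 (indicator (west (i , j))) rest) ,
      east-false⁻ {i} (ℕ.m+n≡0⇒n≡0 (indicator (west (i , j))) rest)
      where rest = ℕ.m+n≡0⇒n≡0 (indicator (north (i , j))) eq

  -- A cell off the interior has `border` at least 1, so adding `K` times `border` to `c` dominates
  -- `t` everywhere, and the total of `border` is only linear in `n`.
  sum-cells-≤ : ∀ (t : Position → ℚ) c K → 0ℚ ℚ.≤ K → (∀ q → OpenPositions.Interior n q → t q ℚ.≤ c) →
    (∀ q → t q ℚ.≤ c ℚ.+ K) → sumℚ (before n n 0) t ℚ.≤ ⟪ n * n ⟫ ℚ.* c ℚ.+ K ℚ.* ⟪ suc (5 * n) ⟫
  sum-cells-≤ t c K 0≤K inside≤ all≤ = begin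
    sumℚ cells t
      ≤⟨ sumℚ-mono cells (λ {q} q∈ → pointwise q q∈ (border q) refl) ⟩
    sumℚ cells (λ q → c ℚ.+ K ℚ.* ⟪ border q ⟫)
      ≡⟨ sumℚ-affine cells c K (λ q → ⟪ border q ⟫) ⟩
    ⟪ length cells ⟫ ℚ.* c ℚ.+ K ℚ.* sumℚ cells (λ q → ⟪ border q ⟫)
      ≡⟨ cong₂ (λ l s → ⟪ l ⟫ ℚ.* c ℚ.+ K ℚ.* s) (length-before n 0) (sumℚ-border cells) ⟩
    ⟪ n * n ⟫ ℚ.* c ℚ.+ K ℚ.* ⟪ count north cells + (count west cells + count east cells) ⟫
      ≤⟨ ℚ.+-monoʳ-≤ (⟪ n * n ⟫ ℚ.* c) (*-monoˡ-≤ 0≤K (⟪⟫-mono border-total)) ⟩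
    ⟪ n * n ⟫ ℚ.* c ℚ.+ K ℚ.* ⟪ suc (5 * n) ⟫ ∎
    where
    open ℚ.≤-Reasoning
    cells = before n n 0
    pointwise : ∀ q → q ∈ˡ cells → ∀ b → border q ≡ b → t q ℚ.≤ c ℚ.+ K ℚ.* ⟪ border q ⟫
    pointwise q q∈ zero    eq = subst (λ b → t q ℚ.≤ c ℚ.+ K ℚ.* ⟪ b ⟫) (sym eq)
      (subst (t q ℚ.≤_) (solve 2 (λ c K → c := c :+ K :* con 0ℚ) refl c K)
        (inside≤ q (off-border⇒interior q∈ eq)))
    pointwise q q∈ (suc b) eq = subst (λ b → t q ℚ.≤ c ℚ.+ K ℚ.* ⟪ b ⟫) (sym eq)
      (ℚ.≤-trans (all≤ q) (ℚ.+-monoʳ-≤ c (subst (ℚ._≤ K ℚ.* ⟪ suc b ⟫) (ℚ.*-identityʳ K)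
        (*-monoˡ-≤ 0≤K (⟪⟫-mono {1} {suc b} (s≤s z≤n))))))

-- Bounds on the mean number of clusters by local rates

birthRate mergerRate meetingRate hexagonRate : ℚ → ℚ
birthRate p   = weight p (inside ∷ outside ∷ outside ∷ outside ∷ [])
meetingRate p = weight p (inside ∷ outside ∷ inside ∷ inside ∷ [])
mergerRate p  = weight p (inside ∷ outside ∷ inside ∷ inside ∷ outside ∷ outside ∷ [])
hexagonRate p = weight p (inside ∷ outside ∷ inside ∷ inside ∷ inside ∷ inside ∷ inside ∷ [])

module _ (n : ℕ) {p : ℚ} (p∈ : ⟦0,1⟧ p) where

  open OpenPositions n

  private
    cells = before n n 0

    mean : ((Position → Bool) → Position → Bool) → Position → ℚ
    mean P q = E p (λ S → ⟪ indicator (P (openAt S) q) ⟫)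

    mean∈ : ∀ P q → 0ℚ ℚ.≤ mean P q × mean P q ℚ.≤ 1ℚ
    mean∈ P q = E-indicator p∈ (λ S → P (openAt S) q)

    total : ((Position → Bool) → Position → Bool) → ℚ
    total P = E p (λ S → ⟪ count (P (openAt S)) cells ⟫)

    total≡ : ∀ P → total P ≡ sumℚ cells (mean P)
    total≡ P = E-count p (λ S → P (openAt S)) cells

    C : ℚ
    C = meanClusters (rect n n) p

    E-sum₂ : ∀ (X Y : Subset (n * n) → ℕ) →
      E p (λ S → ⟪ X S + Y S ⟫) ≡ E p (λ S → ⟪ X S ⟫) ℚ.+ E p (λ S → ⟪ Y S ⟫)
    E-sum₂ X Y = trans (E-cong p (λ S → ⟪⟫-+ (X S) (Y S))) (E-+ p (λ S → ⟪ X S ⟫) (λ S → ⟪ Y S ⟫))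

    upper : C ℚ.+ total merger ℚ.≤ total birth
    upper = subst (ℚ._≤ total birth)
      (E-sum₂ (numComponents (rect n n)) (λ S → count (merger (openAt S)) cells))
      (E-mono p∈ (λ S → ⟪⟫-mono (Sweep.clusters+mergers≤births n (openAt S) (in-box S) (openClusters S))))

    lower : total birth ℚ.+ total hexagon ℚ.≤ C ℚ.+ total meeting
    lower = subst₂ ℚ._≤_
      (E-sum₂ (λ S → count (birth (openAt S)) cells) (λ S → count (hexagon (openAt S)) cells))
      (E-sum₂ (numComponents (rect n n)) (λ S → count (meeting (openAt S)) cells))
      (E-mono p∈ (λ S → ⟪⟫-mono (Sweep.births+hexagons≤clusters+meetings n (openAt S) (in-box S) (openClusters S))))

    sumℚ-neg : ∀ (f : Position → ℚ) → sumℚ cells (λ q → ℚ.- f q) ≡ ℚ.- sumℚ cells f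
    sumℚ-neg f = go cells
      where
      go : ∀ qs → sumℚ qs (λ q → ℚ.- f q) ≡ ℚ.- sumℚ qs f
      go []       = refl
      go (q ∷ qs) = trans (cong (ℚ.- f q ℚ.+_) (go qs)) (sym (ℚ.neg-distrib-+ (f q) (sumℚ qs f)))

    nb₄ = from-yes (near-offsets? neighbours)

  meanClusters-upper : ∀ {c} → 0ℚ ℚ.≤ c → birthRate p ℚ.- mergerRate p ℚ.≤ c →
    meanClusters (rect n n) p ℚ.≤ ⟪ n * n ⟫ ℚ.* c ℚ.+ 1ℚ ℚ.* ⟪ suc (5 * n) ⟫
  meanClusters-upper {c} 0≤c rate≤c = begin
    C                                                           ≤⟨ ≤-by (total birth ℚ.- (C ℚ.+ total merger)) (x≤y⇒0≤y-x upper)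
                                                                     (solve 3 (λ b c m → b :- m := c :+ (b :- (c :+ m))) refl (total birth) C (total merger)) ⟩
    total birth ℚ.- total merger                                ≡⟨ cong₂ ℚ._-_ (total≡ birth) (total≡ merger) ⟩
    sumℚ cells (mean birth) ℚ.- sumℚ cells (mean merger)        ≡⟨ cong (sumℚ cells (mean birth) ℚ.+_) (sumℚ-neg (mean merger)) ⟨
    sumℚ cells (mean birth) ℚ.+ sumℚ cells (ℚ.-_ ∘ mean merger) ≡⟨ sumℚ-+ cells (mean birth) (ℚ.-_ ∘ mean merger) ⟨
    sumℚ cells (λ q → mean birth q ℚ.- mean merger q)           ≤⟨ sum-cells-≤ n _ c 1ℚ (ℚ.nonNegative⁻¹ 1ℚ) interior anywhere ⟩
    ⟪ n * n ⟫ ℚ.* c ℚ.+ 1ℚ ℚ.* ⟪ suc (5 * n) ⟫                  ∎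
    where
    open ℚ.≤-Reasoning
    interior : ∀ q → Interior q → mean birth q ℚ.- mean merger q ℚ.≤ c
    interior q q∈ = subst (ℚ._≤ c) (sym (cong₂ ℚ._-_
      (E-event p (inside ∷ outside ∷ outside ∷ outside ∷ []) neighbours nb₄ q q∈)
      (E-event p (inside ∷ outside ∷ inside ∷ inside ∷ outside ∷ outside ∷ []) (neighbours Vec.++ (2 , 0) ∷ (1 , 1) ∷ [])
        (from-yes (near-offsets? (neighbours Vec.++ (2 , 0) ∷ (1 , 1) ∷ []))) q q∈))) rate≤c
    anywhere : ∀ q → mean birth q ℚ.- mean merger q ℚ.≤ c ℚ.+ 1ℚ
    anywhere q = ≤-by ((1ℚ ℚ.- mean birth q) ℚ.+ mean merger q ℚ.+ c)
      (0≤+ (0≤+ (x≤y⇒0≤y-x (proj₂ (mean∈ birth q))) (proj₁ (mean∈ merger q))) 0≤c)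
      (solve 3 (λ c b m → c :+ con 1ℚ := (b :- m) :+ ((con 1ℚ :- b) :+ m :+ c)) refl c (mean birth q) (mean merger q))

  -- The border estimate is applied to meeting minus birth minus hexagon, whose interior value is at
  -- most `- c`. Anywhere else this difference is at most 1, hence exceeds `- c` by at most 2
  -- because `c ≤ 1`.
  meanClusters-lower : ∀ {c} → c ℚ.≤ 1ℚ → c ℚ.≤ birthRate p ℚ.+ hexagonRate p ℚ.- meetingRate p →
    ⟪ n * n ⟫ ℚ.* c ℚ.≤ meanClusters (rect n n) p ℚ.+ ⟪ 2 ⟫ ℚ.* ⟪ suc (5 * n) ⟫
  meanClusters-lower {c} c≤1 c≤rate = begin
    ⟪ n * n ⟫ ℚ.* c                                           ≤⟨ ≤-by
      (⟪ n * n ⟫ ℚ.* (ℚ.- c) ℚ.+ ⟪ 2 ⟫ ℚ.* w ℚ.- D ℚ.+ (C ℚ.+ total meeting ℚ.- (total birth ℚ.+ total hexagon)))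
      (0≤+ (x≤y⇒0≤y-x (sum-cells-≤ n _ (ℚ.- c) ⟪ 2 ⟫ (0≤⟪⟫ 2) interior anywhere)) (x≤y⇒0≤y-x lower))
      (trans (solve 7 (λ N c W C b h m → C :+ W := N :* c :+ ((N :* ((:- c)) :+ W :- (m :- b :- h)) :+ (C :+ m :- (b :+ h)))) refl
        ⟪ n * n ⟫ c (⟪ 2 ⟫ ℚ.* w) C (total birth) (total hexagon) (total meeting))
        (cong (λ y → ⟪ n * n ⟫ ℚ.* c ℚ.+ ((⟪ n * n ⟫ ℚ.* (ℚ.- c) ℚ.+ ⟪ 2 ⟫ ℚ.* w ℚ.- y) ℚ.+ (C ℚ.+ total meeting ℚ.- (total birth ℚ.+ total hexagon))))
          D≡)) ⟩
    C ℚ.+ ⟪ 2 ⟫ ℚ.* w                                         ∎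
    where
    open ℚ.≤-Reasoning
    w = ⟪ suc (5 * n) ⟫
    D = sumℚ cells (λ q → mean meeting q ℚ.- mean birth q ℚ.- mean hexagon q)
    D≡ : total meeting ℚ.- total birth ℚ.- total hexagon ≡ D
    D≡ = trans (cong₂ ℚ._-_ (cong₂ ℚ._-_ (total≡ meeting) (total≡ birth)) (total≡ hexagon))
      (trans (cong₂ ℚ._+_ (trans (cong (sumℚ cells (mean meeting) ℚ.+_) (sym (sumℚ-neg (mean birth))))
            (sym (sumℚ-+ cells (mean meeting) (ℚ.-_ ∘ mean birth))))
          (sym (sumℚ-neg (mean hexagon))))
        (sym (sumℚ-+ cells (λ q → mean meeting q ℚ.- mean birth q) (ℚ.-_ ∘ mean hexagon))))
    interior : ∀ q → Interior q → mean meeting q ℚ.- mean birth q ℚ.- mean hexagon q ℚ.≤ ℚ.- c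
    interior q q∈ = ≤-by (birthRate p ℚ.+ hexagonRate p ℚ.- meetingRate p ℚ.- c) (x≤y⇒0≤y-x c≤rate)
      (trans (solve 4 (λ b h m c → (:- c) := (m :- b :- h) :+ (b :+ h :- m :- c)) refl
          (birthRate p) (hexagonRate p) (meetingRate p) c) (cong (ℚ._+ (birthRate p ℚ.+ hexagonRate p ℚ.- meetingRate p ℚ.- c))
        (sym (cong₂ ℚ._-_ (cong₂ ℚ._-_
          (E-event p (inside ∷ outside ∷ inside ∷ inside ∷ []) neighbours nb₄ q q∈)
          (E-event p (inside ∷ outside ∷ outside ∷ outside ∷ []) neighbours nb₄ q q∈))
          (E-event p (inside ∷ outside ∷ inside ∷ inside ∷ inside ∷ inside ∷ inside ∷ [])
            (neighbours Vec.++ (1 , 1) ∷ (0 , 3) ∷ (0 , 2) ∷ [])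
            (from-yes (near-offsets? (neighbours Vec.++ (1 , 1) ∷ (0 , 3) ∷ (0 , 2) ∷ []))) q q∈)))))
    anywhere : ∀ q → mean meeting q ℚ.- mean birth q ℚ.- mean hexagon q ℚ.≤ ℚ.- c ℚ.+ ⟪ 2 ⟫
    anywhere q = ≤-by ((1ℚ ℚ.- mean meeting q) ℚ.+ mean birth q ℚ.+ mean hexagon q ℚ.+ (1ℚ ℚ.- c))
      (0≤+ (0≤+ (0≤+ (x≤y⇒0≤y-x (proj₂ (mean∈ meeting q))) (proj₁ (mean∈ birth q))) (proj₁ (mean∈ hexagon q))) (x≤y⇒0≤y-x c≤1))
      (solve 4 (λ c m b h → (:- c) :+ con ⟪ 2 ⟫ := (m :- b :- h) :+ ((con 1ℚ :- m) :+ b :+ h :+ (con 1ℚ :- c))) refl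
        c (mean meeting q) (mean birth q) (mean hexagon q))

-- Maxima of Lipschitz functions

∣x-y∣≤ : ∀ {x y d} → x ℚ.≤ y ℚ.+ d → y ℚ.≤ x ℚ.+ d → ℚ.∣ x ℚ.- y ∣ ℚ.≤ d
∣x-y∣≤ {x} {y} {d} x≤ y≤ with ℚ.∣p∣≡p∨∣p∣≡-p (x ℚ.- y)
... | inj₁ eq = subst (ℚ._≤ d) (sym eq) (≤-by (y ℚ.+ d ℚ.- x) (x≤y⇒0≤y-x x≤)
  (solve 3 (λ x y d → d := (x :- y) :+ (y :+ d :- x)) refl x y d))
... | inj₂ eq = subst (ℚ._≤ d) (sym eq) (≤-by (x ℚ.+ d ℚ.- y) (x≤y⇒0≤y-x y≤)
  (solve 3 (λ x y d → d := (:- (x :- y)) :+ (x :+ d :- y)) refl x y d))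

<⇒0<y-x : ∀ {x y} → x ℚ.< y → 0ℚ ℚ.< y ℚ.- x
<⇒0<y-x {x} {y} x<y = subst (ℚ._< y ℚ.- x) (ℚ.+-inverseʳ x) (ℚ.+-monoˡ-< (ℚ.- x) x<y)

⟪⟫*1/ : ∀ n → ⟪ suc n ⟫ ℚ.* (+ 1 / suc n) ≡ 1ℚ
⟪⟫*1/ n = ℚ.toℚᵘ-injective (begin
  ℚ.toℚᵘ (⟪ suc n ⟫ ℚ.* (+ 1 / suc n))                  ≈⟨ ℚ.toℚᵘ-homo-* ⟪ suc n ⟫ (+ 1 / suc n) ⟩
  ℚ.toℚᵘ ⟪ suc n ⟫ ℚᵘ.* ℚ.toℚᵘ (+ 1 / suc n)            ≈⟨ ℚᵘ.*-cong (ℚ.toℚᵘ-fromℚᵘ (ℚᵘ.mkℚᵘ (+ suc n) 0))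
                                                              (ℚ.toℚᵘ-fromℚᵘ (ℚᵘ.mkℚᵘ (+ 1) n)) ⟩
  ℚᵘ.mkℚᵘ (+ suc n) 0 ℚᵘ.* ℚᵘ.mkℚᵘ (+ 1) n               ≈⟨ ℚᵘ.*≡* (cong +_ (lemma (suc n))) ⟩
  ℚᵘ.1ℚᵘ                                                 ∎)
  where
  open ℚᵘ.≃-Reasoning
  lemma : ∀ n → n * 1 * 1 ≡ 1 * (1 * n)
  lemma = solve-∀

abstract
  δ : ℕ → ℚ
  δ n = + 1 / suc n

  δ≡ : ∀ n → δ n ≡ + 1 / suc n
  δ≡ n = refl

  ⟪suc⟫*δ : ∀ n → ⟪ suc n ⟫ ℚ.* δ n ≡ 1ℚ
  ⟪suc⟫*δ = ⟪⟫*1/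

  0<δ : ∀ n → 0ℚ ℚ.< δ n
  0<δ n = ℚ.*-cancelˡ-<-nonNeg ⟪ suc n ⟫ {{ℚ.nonNegative (0≤⟪⟫ (suc n))}}
    (subst₂ ℚ._<_ (sym (ℚ.*-zeroʳ ⟪ suc n ⟫)) (sym (⟪suc⟫*δ n)) (ℚ.positive⁻¹ 1ℚ))

  0≤δ : ∀ n → 0ℚ ℚ.≤ δ n
  0≤δ n = ℚ.<⇒≤ (0<δ n)

  δ≤⇐ : ∀ n {x} → 1ℚ ℚ.≤ ⟪ suc n ⟫ ℚ.* x → δ n ℚ.≤ x
  δ≤⇐ n {x} h = ℚ.*-cancelˡ-≤-pos ⟪ suc n ⟫ {{ℚ.positive (0<⟪suc⟫ n)}} (subst (ℚ._≤ ⟪ suc n ⟫ ℚ.* x) (sym (⟪suc⟫*δ n)) h)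

  ≤δ⇐ : ∀ n {x} → ⟪ suc n ⟫ ℚ.* x ℚ.≤ 1ℚ → x ℚ.≤ δ n
  ≤δ⇐ n {x} h = ℚ.*-cancelˡ-≤-pos ⟪ suc n ⟫ {{ℚ.positive (0<⟪suc⟫ n)}} (subst (⟪ suc n ⟫ ℚ.* x ℚ.≤_) (sym (⟪suc⟫*δ n)) h)

  δ≤1 : ∀ n → δ n ℚ.≤ 1ℚ
  δ≤1 n = δ≤⇐ n (subst (1ℚ ℚ.≤_) (sym (ℚ.*-identityʳ ⟪ suc n ⟫)) (⟪⟫-mono {1} {suc n} (s≤s z≤n)))

  δ-denominator : ∀ {e} → 0ℚ ℚ.< e → ∃[ d ] δ d ℚ.≤ e
  δ-denominator {ℚ.mkℚ (+ suc a) d _} _ = d , ℚ.toℚᵘ-cancel-≤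
    (ℚᵘ.≤-respˡ-≃ (ℚᵘ.≃-sym (ℚ.toℚᵘ-fromℚᵘ (ℚᵘ.mkℚᵘ (+ 1) d)))
      (ℚᵘ.*≤* (ℤ.*-monoʳ-≤-nonNeg (+ suc d) {+ 1} {+ suc a} (ℤ.+≤+ (s≤s z≤n)))))
  δ-denominator {ℚ.mkℚ (+ zero) d c} 0<e = contradiction (ℚ.drop-*<* 0<e) (ℤ.<-irrefl refl)
  δ-denominator {ℚ.mkℚ (ℤ.-[1+ a ]) d c} 0<e = contradiction (ℚ.drop-*<* 0<e) λ ()

  archimedean : ∀ c {e} → 0ℚ ℚ.< e → ∃[ M ] (∀ j → M ≤ j → ⟪ c ⟫ ℚ.* δ j ℚ.< e)
  archimedean c {e} 0<e with δ-denominator 0<e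
  ... | d , δd≤e = c * suc d , λ j M≤j → ℚ.<-≤-trans (bound j M≤j) δd≤e
    where
    bound : ∀ j → c * suc d ≤ j → ⟪ c ⟫ ℚ.* δ j ℚ.< δ d
    bound j M≤j = ℚ.*-cancelˡ-<-nonNeg (⟪ suc j ⟫ ℚ.* ⟪ suc d ⟫)
      {{ℚ.nonNegative (0≤* (0≤⟪⟫ (suc j)) (0≤⟪⟫ (suc d)))}} (begin-strict
      ⟪ suc j ⟫ ℚ.* ⟪ suc d ⟫ ℚ.* (⟪ c ⟫ ℚ.* δ j)
        ≡⟨ solve 4 (λ J D c x → J :* D :* (c :* x) := (c :* D) :* (J :* x)) refl ⟪ suc j ⟫ ⟪ suc d ⟫ ⟪ c ⟫ (δ j) ⟩
      ⟪ c ⟫ ℚ.* ⟪ suc d ⟫ ℚ.* (⟪ suc j ⟫ ℚ.* δ j)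
        ≡⟨ trans (cong₂ ℚ._*_ (sym (⟪⟫-* c (suc d))) (⟪suc⟫*δ j)) (ℚ.*-identityʳ ⟪ c * suc d ⟫) ⟩
      ⟪ c * suc d ⟫
        <⟨ ℚ.<-≤-trans (subst (ℚ._< 1ℚ ℚ.+ ⟪ c * suc d ⟫) (ℚ.+-identityˡ ⟪ c * suc d ⟫)
             (ℚ.+-monoˡ-< ⟪ c * suc d ⟫ (ℚ.positive⁻¹ 1ℚ)))
             (subst (ℚ._≤ ⟪ suc j ⟫) (⟪⟫-+ 1 (c * suc d)) (⟪⟫-mono (s≤s M≤j))) ⟩
      ⟪ suc j ⟫
        ≡⟨ trans (cong (⟪ suc j ⟫ ℚ.*_) (⟪suc⟫*δ d)) (ℚ.*-identityʳ ⟪ suc j ⟫) ⟨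
      ⟪ suc j ⟫ ℚ.* (⟪ suc d ⟫ ℚ.* δ d)
        ≡⟨ ℚ.*-assoc ⟪ suc j ⟫ ⟪ suc d ⟫ (δ d) ⟨
      ⟪ suc j ⟫ ℚ.* ⟪ suc d ⟫ ℚ.* δ d ∎)
      where open ℚ.≤-Reasoning

½^ : ℕ → ℚ
½^ zero    = 1ℚ
½^ (suc d) = ½ ℚ.* ½^ d

0≤½^ : ∀ d → 0ℚ ℚ.≤ ½^ d
0≤½^ zero    = ℚ.nonNegative⁻¹ 1ℚ
0≤½^ (suc d) = 0≤* (ℚ.nonNegative⁻¹ ½) (0≤½^ d)

-- This is `d + 1 ≤ 2 ^ d`. It converts a number of bisections into an accuracy of the form 1 over a
-- natural number.
⟪suc⟫*½^≤1 : ∀ d → ⟪ suc d ⟫ ℚ.* ½^ d ℚ.≤ 1ℚ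
⟪suc⟫*½^≤1 zero    = ℚ.≤-refl
⟪suc⟫*½^≤1 (suc d) = ℚ.≤-trans
  (≤-by (½ ℚ.* ⟪ d ⟫ ℚ.* ½^ d) (0≤* (0≤* (ℚ.nonNegative⁻¹ ½) (0≤⟪⟫ d)) (0≤½^ d))
    (trans (cong (ℚ._* ½^ d) (⟪⟫-+ 1 d))
      (trans (solve 2 (λ D x → (con 1ℚ :+ D) :* x := (con ⟪ 2 ⟫ :+ D) :* (con ½ :* x) :+ con ½ :* D :* x) refl ⟪ d ⟫ (½^ d))
        (cong (λ z → z ℚ.* (½ ℚ.* ½^ d) ℚ.+ ½ ℚ.* ⟪ d ⟫ ℚ.* ½^ d) (sym (⟪⟫-+ 2 d))))))
  (⟪suc⟫*½^≤1 d)

module ApproximateMaximum (f : ℚ → ℚ) (K : ℕ)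
  (lipschitz : ∀ {p q d} → ⟦0,1⟧ p → ⟦0,1⟧ q → p ℚ.≤ q ℚ.+ d → q ℚ.≤ p ℚ.+ d → f p ℚ.≤ f q ℚ.+ ⟪ K ⟫ ℚ.* d) where

  private
    mid : ℚ → ℚ → ℚ
    mid a b = ½ ℚ.* (a ℚ.+ b)

    a<mid : ∀ {a b} → a ℚ.< b → a ℚ.< mid a b
    a<mid {a} {b} a<b = subst₂ ℚ._<_
      (solve 1 (λ a → con ½ :* (a :+ a) := a) refl a) refl
      (ℚ.*-monoʳ-<-pos ½ (ℚ.+-monoʳ-< a a<b))

    mid<b : ∀ {a b} → a ℚ.< b → mid a b ℚ.< b
    mid<b {a} {b} a<b = subst₂ ℚ._<_ refl
      (solve 1 (λ a → con ½ :* (a :+ a) := a) refl b)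
      (ℚ.*-monoʳ-<-pos ½ (ℚ.+-monoˡ-< b a<b))

    better : ℚ → ℚ → ℚ
    better x y with f x ℚ.≤? f y
    ... | yes _ = y
    ... | no  _ = x

    better-elim : ∀ (P : ℚ → Set) {x y} → P x → P y → P (better x y)
    better-elim P {x} {y} px py with f x ℚ.≤? f y
    ... | yes _ = py
    ... | no  _ = px

    betterˡ : ∀ x y → f x ℚ.≤ f (better x y)
    betterˡ x y with f x ℚ.≤? f y
    ... | yes x≤y = x≤y
    ... | no  _   = ℚ.≤-refl

    betterʳ : ∀ x y → f y ℚ.≤ f (better x y)
    betterʳ x y with f x ℚ.≤? f y
    ... | yes _   = ℚ.≤-refl
    ... | no  x≰y = ℚ.<⇒≤ (ℚ.≰⇒> x≰y)

    -- The best midpoint among the dyadic subintervals of depth `d`. Values at rational points can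
    -- be compared decidably, and midpoints stay off the ends, as the supremum over an open interval
    -- requires.
    peak : ℕ → ℚ → ℚ → ℚ
    peak zero    a b = mid a b
    peak (suc d) a b = better (peak d a (mid a b)) (peak d (mid a b) b)

    peak∈ : ∀ d {a b} → a ℚ.< b → a ℚ.< peak d a b × peak d a b ℚ.< b
    peak∈ zero    a<b = a<mid a<b , mid<b a<b
    peak∈ (suc d) {a} {b} a<b = better-elim (λ x → a ℚ.< x × x ℚ.< b)
      (let l , r = peak∈ d (a<mid a<b) in l , ℚ.<-trans r (mid<b a<b))
      (let l , r = peak∈ d (mid<b a<b) in ℚ.<-trans (a<mid a<b) l , r)

    -- The point `q` shares a dyadic subinterval with one of the midpoints, so the Lipschitz bound
    -- applies on the length of that subinterval; the comparisons between midpoints only raise the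
    -- value.
    peak-max : ∀ d {a b} → 0ℚ ℚ.≤ a → a ℚ.< b → b ℚ.≤ 1ℚ → ∀ q → a ℚ.≤ q → q ℚ.≤ b →
      f q ℚ.≤ f (peak d a b) ℚ.+ ⟪ K ⟫ ℚ.* (½^ d ℚ.* (b ℚ.- a))
    peak-max zero {a} {b} 0≤a a<b b≤1 q a≤q q≤b = lipschitz
      (ℚ.≤-trans 0≤a a≤q , ℚ.≤-trans q≤b b≤1)
      (ℚ.≤-trans 0≤a (ℚ.<⇒≤ (a<mid a<b)) , ℚ.≤-trans (ℚ.<⇒≤ (mid<b a<b)) b≤1)
      (≤-by ((mid a b ℚ.- a) ℚ.+ (b ℚ.- q)) (0≤+ (x≤y⇒0≤y-x (ℚ.<⇒≤ (a<mid a<b))) (x≤y⇒0≤y-x q≤b))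
        (solve 4 (λ a b q m → m :+ con 1ℚ :* (b :- a) := q :+ ((m :- a) :+ (b :- q))) refl a b q (mid a b)))
      (≤-by ((b ℚ.- mid a b) ℚ.+ (q ℚ.- a)) (0≤+ (x≤y⇒0≤y-x (ℚ.<⇒≤ (mid<b a<b))) (x≤y⇒0≤y-x a≤q))
        (solve 4 (λ a b q m → q :+ con 1ℚ :* (b :- a) := m :+ ((b :- m) :+ (q :- a))) refl a b q (mid a b)))
    peak-max (suc d) {a} {b} 0≤a a<b b≤1 q a≤q q≤b with ℚ.≤-total q (mid a b)
    ... | inj₁ q≤m = ℚ.≤-trans (peak-max d 0≤a (a<mid a<b) (ℚ.≤-trans (ℚ.<⇒≤ (mid<b a<b)) b≤1) q a≤q q≤m)
      (ℚ.+-mono-≤ (betterˡ (peak d a (mid a b)) (peak d (mid a b) b))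
        (ℚ.≤-reflexive (solve 4 (λ K h a b → K :* (h :* (con ½ :* (a :+ b) :- a)) := K :* (con ½ :* h :* (b :- a))) refl
          ⟪ K ⟫ (½^ d) a b)))
    ... | inj₂ m≤q = ℚ.≤-trans (peak-max d (ℚ.≤-trans 0≤a (ℚ.<⇒≤ (a<mid a<b))) (mid<b a<b) b≤1 q m≤q q≤b)
      (ℚ.+-mono-≤ (betterʳ (peak d a (mid a b)) (peak d (mid a b) b))
        (ℚ.≤-reflexive (solve 4 (λ K h a b → K :* (h :* (b :- con ½ :* (a :+ b))) := K :* (con ½ :* h :* (b :- a))) refl
          ⟪ K ⟫ (½^ d) a b)))

    0<1 : 0ℚ ℚ.< 1ℚ
    0<1 = ℚ.positive⁻¹ 1ℚ

  abstract
    -- With `D = K * suc j` bisections, `2 ^ D ≥ D + 1` pushes the Lipschitz error `K * ½^ D` below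
    -- `1 / suc j`.
    argmax : ℕ → ℚ
    argmax j = peak (K * suc j) 0ℚ 1ℚ

    argmax∈ : ∀ j → 0ℚ ℚ.< argmax j × argmax j ℚ.< 1ℚ
    argmax∈ j = peak∈ (K * suc j) 0<1

    argmax-max : ∀ j q → ⟦0,1⟧ q → f q ℚ.≤ f (argmax j) ℚ.+ δ j
    argmax-max j q (0≤q , q≤1) = ℚ.≤-trans (peak-max D ℚ.≤-refl 0<1 ℚ.≤-refl q 0≤q q≤1)
      (ℚ.+-monoʳ-≤ (f (peak D 0ℚ 1ℚ)) (≤δ⇐ j (begin
        ⟪ suc j ⟫ ℚ.* (⟪ K ⟫ ℚ.* (½^ D ℚ.* (1ℚ ℚ.- 0ℚ)))
          ≡⟨ solve 3 (λ J K h → J :* (K :* (h :* con 1ℚ)) := (K :* J) :* h) refl ⟪ suc j ⟫ ⟪ K ⟫ (½^ D) ⟩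
        ⟪ K ⟫ ℚ.* ⟪ suc j ⟫ ℚ.* ½^ D
          ≡⟨ cong (ℚ._* ½^ D) (⟪⟫-* K (suc j)) ⟨
        ⟪ D ⟫ ℚ.* ½^ D
          ≤⟨ ℚ.*-monoʳ-≤-nonNeg (½^ D) {{ℚ.nonNegative (0≤½^ D)}} (⟪⟫-mono (ℕ.n≤1+n D)) ⟩
        ⟪ suc D ⟫ ℚ.* ½^ D
          ≤⟨ ⟪suc⟫*½^≤1 D ⟩
        1ℚ ∎)))
      where
      open ℚ.≤-Reasoning
      D : ℕ
      D = K * suc j

  maximum : ℕ → ℚ
  maximum j = f (argmax j)

  private
    argmax∈⟦⟧ : ∀ j → ⟦0,1⟧ (argmax j)
    argmax∈⟦⟧ j = ℚ.<⇒≤ (proj₁ (argmax∈ j)) , ℚ.<⇒≤ (proj₂ (argmax∈ j))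

    maximum-cauchy : Cauchy maximum
    maximum-cauchy e 0<e with archimedean 1 0<e
    ... | M , small = M , λ i j M≤i M≤j → ℚ.≤-<-trans
      (∣x-y∣≤ (ℚ.≤-trans (argmax-max j (argmax i) (argmax∈⟦⟧ i))
                (ℚ.+-monoʳ-≤ (maximum j) (ℚ.p≤q⊔p (δ i) (δ j))))
              (ℚ.≤-trans (argmax-max i (argmax j) (argmax∈⟦⟧ j))
                (ℚ.+-monoʳ-≤ (maximum i) (ℚ.p≤p⊔q (δ i) (δ j)))))
      (below (δ i) (δ j) (subst (ℚ._< e) (ℚ.*-identityˡ (δ i)) (small i M≤i))
                         (subst (ℚ._< e) (ℚ.*-identityˡ (δ j)) (small j M≤j)))
      where
      below : ∀ x y → x ℚ.< e → y ℚ.< e → x ℚ.⊔ y ℚ.< e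
      below x y x<e y<e with ℚ.⊔-sel x y
      ... | inj₁ eq = subst (ℚ._< e) (sym eq) x<e
      ... | inj₂ eq = subst (ℚ._< e) (sym eq) y<e

  supremum : ℝ
  supremum = mkℝ maximum maximum-cauchy

  -- As `F` acts termwise, its value at `p` is compared with `maximum` stage by stage, once the
  -- approximations of `p` lie in the unit interval; a uniform gap `e` would contradict `argmax-max`
  -- as soon as `δ n < e`. Conversely, a single rational maximiser of accuracy below `e`, taken as a
  -- constant real, already exceeds `t`.
  isSupremum : (F : ℝ → ℝ) → (∀ p n → seq (F p) n ≡ f (seq p n)) → IsSupremum ]0,1[ F supremum
  isSupremum F F≡ = bound , approached
    where
    bound : ∀ p → ]0,1[ p → F p ≤ᵣ supremum
    bound p ((e₀ , 0<e₀ , M₀ , p≥) , (e₁ , 0<e₁ , M₁ , p≤)) (e , 0<e , M , gap) with archimedean 1 0<e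
    ... | M₂ , small = ℚ.<-irrefl refl (ℚ.<-≤-trans (ℚ.+-monoʳ-< (maximum n) (small n M₂≤n)) (begin
      maximum n ℚ.+ e                 ≤⟨ gap n M≤n ⟩
      seq (F p) n                     ≡⟨ F≡ p n ⟩
      f (seq p n)                     ≤⟨ argmax-max n (seq p n) (0≤p , p≤1) ⟩
      maximum n ℚ.+ δ n               ≡⟨ cong (maximum n ℚ.+_) (ℚ.*-identityˡ (δ n)) ⟨
      maximum n ℚ.+ ⟪ 1 ⟫ ℚ.* δ n     ∎))
      where
      open ℚ.≤-Reasoning
      n = (M ⊔ M₂) ⊔ (M₀ ⊔ M₁)
      M≤n  = ℕ.≤-trans (ℕ.m≤m⊔n M M₂) (ℕ.m≤m⊔n (M ⊔ M₂) (M₀ ⊔ M₁))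
      M₂≤n = ℕ.≤-trans (ℕ.m≤n⊔m M M₂) (ℕ.m≤m⊔n (M ⊔ M₂) (M₀ ⊔ M₁))
      M₀≤n = ℕ.≤-trans (ℕ.m≤m⊔n M₀ M₁) (ℕ.m≤n⊔m (M ⊔ M₂) (M₀ ⊔ M₁))
      M₁≤n = ℕ.≤-trans (ℕ.m≤n⊔m M₀ M₁) (ℕ.m≤n⊔m (M ⊔ M₂) (M₀ ⊔ M₁))
      0≤p : 0ℚ ℚ.≤ seq p n
      0≤p = ℚ.≤-trans (ℚ.<⇒≤ 0<e₀) (subst (ℚ._≤ seq p n) (ℚ.+-identityˡ e₀) (p≥ n M₀≤n))
      p≤1 : seq p n ℚ.≤ 1ℚ
      p≤1 = ℚ.≤-trans (≤-by e₁ (ℚ.<⇒≤ 0<e₁) refl) (p≤ n M₁≤n)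

    approached : ∀ t → t <ᵣ supremum → ∃[ p ] ]0,1[ p × t <ᵣ F p
    approached t (e , 0<e , M , gap) with archimedean 1 0<e
    ... | M₁ , small = fromℚ x ,
      ((x , proj₁ (argmax∈ M₁) , 0 , λ _ _ → ℚ.≤-reflexive (ℚ.+-identityˡ x)) ,
       (1ℚ ℚ.- x , <⇒0<y-x (proj₂ (argmax∈ M₁)) , 0 , λ _ _ → ℚ.≤-reflexive
         (solve 1 (λ x → x :+ (con 1ℚ :- x) := con 1ℚ) refl x))) ,
      (e ℚ.- δ M₁ , <⇒0<y-x (subst (ℚ._< e) (ℚ.*-identityˡ (δ M₁)) (small M₁ ℕ.≤-refl)) , M , λ n M≤n →
        subst (seq t n ℚ.+ (e ℚ.- δ M₁) ℚ.≤_) (sym (F≡ (fromℚ x) n))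
          (≤-by ((maximum n ℚ.- (seq t n ℚ.+ e)) ℚ.+ (maximum M₁ ℚ.+ δ M₁ ℚ.- maximum n))
            (0≤+ (x≤y⇒0≤y-x (gap n M≤n)) (x≤y⇒0≤y-x (argmax-max M₁ (argmax n) (argmax∈⟦⟧ n))))
            (solve 5 (λ t e d m m′ → m′ := t :+ (e :- d) :+ ((m :- (t :+ e)) :+ (m′ :+ d :- m))) refl
              (seq t n) e (δ M₁) (maximum n) (maximum M₁))))
      where x = argmax M₁

private
  0≤square : ∀ x → 0ℚ ℚ.≤ x ℚ.* x
  0≤square x with ℚ.≤-total 0ℚ x
  ... | inj₁ 0≤x = 0≤* 0≤x 0≤x
  ... | inj₂ x≤0 = subst (0ℚ ℚ.≤_) (solve 1 (λ x → (con 0ℚ :- x) :* (con 0ℚ :- x) := x :* x) refl x)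
    (0≤* (x≤y⇒0≤y-x x≤0) (x≤y⇒0≤y-x x≤0))

-- With q = 1 - p the difference of rates is p (1 + p) q⁴, whose maximum
-- 0.0994… is attained near p = 23/100.  Dividing 101/1000 - p (1 + p) q⁴ by
-- (p - 23/100)² leaves a quartic with positive Bernstein coefficients and a
-- linear remainder with positive coefficients.
growthRate≤ : ∀ {p} → ⟦0,1⟧ p → birthRate p ℚ.- mergerRate p ℚ.≤ + 101 / 1000
growthRate≤ {p} (0≤p , p≤1) = ≤-by
  ((p ℚ.- + 23 / 100) ℚ.* (p ℚ.- + 23 / 100) ℚ.*
    (b₀ ℚ.* (q ℚ.* q ℚ.* (q ℚ.* q)) ℚ.+ b₁ ℚ.* (p ℚ.* q ℚ.* (q ℚ.* q)) ℚ.+ b₂ ℚ.* (p ℚ.* p ℚ.* (q ℚ.* q))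
      ℚ.+ b₃ ℚ.* (p ℚ.* p ℚ.* (p ℚ.* q)) ℚ.+ b₄ ℚ.* (p ℚ.* p ℚ.* (p ℚ.* p)))
    ℚ.+ (r₀ ℚ.+ r₁ ℚ.* p))
  (0≤+ (0≤* (0≤square (p ℚ.- + 23 / 100))
      (0≤+ (0≤+ (0≤+ (0≤+ (0≤* 0≤b₀ (0≤* (0≤* 0≤q 0≤q) (0≤* 0≤q 0≤q))) (0≤* 0≤b₁ (0≤* (0≤* 0≤p 0≤q) (0≤* 0≤q 0≤q))))
        (0≤* 0≤b₂ (0≤* (0≤* 0≤p 0≤p) (0≤* 0≤q 0≤q)))) (0≤* 0≤b₃ (0≤* (0≤* 0≤p 0≤p) (0≤* 0≤p 0≤q))))
        (0≤* 0≤b₄ (0≤* (0≤* 0≤p 0≤p) (0≤* 0≤p 0≤p)))))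
    (0≤+ 0≤r₀ (0≤* 0≤r₁ 0≤p)))
  (identity p)
  where
  q = 1ℚ ℚ.- p
  0≤q = x≤y⇒0≤y-x p≤1
  b₀ b₁ b₂ b₃ b₄ r₀ r₁ : ℚ
  b₀ = + 37892239 / 20000000
  b₁ = + 25429399 / 5000000
  b₂ = + 31112677 / 10000000
  b₃ = + 5416719 / 5000000
  b₄ = + 3266879 / 20000000
  r₀ = + 775027845 / 1000000000000
  r₁ = + 33783442 / 10000000000
  0≤b₀ = from-yes (0ℚ ℚ.≤? b₀)
  0≤b₁ = from-yes (0ℚ ℚ.≤? b₁)
  0≤b₂ = from-yes (0ℚ ℚ.≤? b₂)
  0≤b₃ = from-yes (0ℚ ℚ.≤? b₃)
  0≤b₄ = from-yes (0ℚ ℚ.≤? b₄)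
  0≤r₀ = from-yes (0ℚ ℚ.≤? r₀)
  0≤r₁ = from-yes (0ℚ ℚ.≤? r₁)
  identity : ∀ p → + 101 / 1000 ≡ (birthRate p ℚ.- mergerRate p) ℚ.+
    ((p ℚ.- + 23 / 100) ℚ.* (p ℚ.- + 23 / 100) ℚ.*
      (b₀ ℚ.* ((1ℚ ℚ.- p) ℚ.* (1ℚ ℚ.- p) ℚ.* ((1ℚ ℚ.- p) ℚ.* (1ℚ ℚ.- p)))
        ℚ.+ b₁ ℚ.* (p ℚ.* (1ℚ ℚ.- p) ℚ.* ((1ℚ ℚ.- p) ℚ.* (1ℚ ℚ.- p)))
        ℚ.+ b₂ ℚ.* (p ℚ.* p ℚ.* ((1ℚ ℚ.- p) ℚ.* (1ℚ ℚ.- p)))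
        ℚ.+ b₃ ℚ.* (p ℚ.* p ℚ.* (p ℚ.* (1ℚ ℚ.- p))) ℚ.+ b₄ ℚ.* (p ℚ.* p ℚ.* (p ℚ.* p)))
      ℚ.+ (r₀ ℚ.+ r₁ ℚ.* p))
  identity = solve 1 (λ p → let q = con 1ℚ :- p in con (+ 101 / 1000) :=
    (p :* (q :* (q :* (q :* con 1ℚ))) :- p :* (q :* (p :* (p :* (q :* (q :* con 1ℚ)))))) :+
    ((p :- con (+ 23 / 100)) :* (p :- con (+ 23 / 100)) :*
      (con b₀ :* (q :* q :* (q :* q)) :+ con b₁ :* (p :* q :* (q :* q)) :+ con b₂ :* (p :* p :* (q :* q))
        :+ con b₃ :* (p :* p :* (p :* q)) :+ con b₄ :* (p :* p :* (p :* p)))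
      :+ (con r₀ :+ con r₁ :* p))) refl

-- Densities of the lattice boxes and their maxima

numComponents≤order : ∀ (G : Graph) S → numComponents G S ≤ Graph.order G
numComponents≤order G S = subst₂ _≤_ (#reps (components G S)) (List.length-tabulate {n = Graph.order G} id)
  (independent≤covering (Connected-sym G S) _◅◅_ (allFin (Graph.order G)) (independent (components G S))
    (All.tabulate (λ {u} _ → Any.map (λ { refl → ε }) (∈ˡ.∈-allFin u))))

meanClusters-lipschitz : ∀ (G : Graph) {p q d} → ⟦0,1⟧ p → ⟦0,1⟧ q → p ℚ.≤ q ℚ.+ d → q ℚ.≤ p ℚ.+ d →
  meanClusters G p ℚ.≤ meanClusters G q ℚ.+ ⟪ Graph.order G * Graph.order G ⟫ ℚ.* d
meanClusters-lipschitz G {p} {q} {d} p∈ q∈ p≤ q≤ = subst (λ z → meanClusters G p ℚ.≤ meanClusters G q ℚ.+ z)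
  (trans (sym (ℚ.*-assoc N N d)) (cong (ℚ._* d) (sym (⟪⟫-* (Graph.order G) (Graph.order G)))))
  (E-lipschitz p∈ q∈ p≤ q≤ (λ S → ⟪ numComponents G S ⟫)
    (λ S → 0≤⟪⟫ (numComponents G S) , ⟪⟫-mono (numComponents≤order G S)))
  where N = ⟪ Graph.order G ⟫

module Maximum (k : ℕ) = ApproximateMaximum (meanClusters (triangularLattice (suc k)))
  ((suc k * suc k) * (suc k * suc k)) (meanClusters-lipschitz (triangularLattice (suc k)))

1/N : ℕ → ℚ
1/N k = + 1 / (suc k * suc k)

private
  A : ℕ → ℚ → ℚ
  A k = meanClusters (triangularLattice (suc k))

  N*1/N≡1 : ∀ k → ⟪ suc k * suc k ⟫ ℚ.* 1/N k ≡ 1ℚ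
  N*1/N≡1 k = ⟪⟫*1/ (k + k * suc k)

  n*1/N≡δ : ∀ k → ⟪ suc k ⟫ ℚ.* 1/N k ≡ δ k
  n*1/N≡δ k = begin
    ⟪ suc k ⟫ ℚ.* 1/N k                                   ≡⟨ ℚ.*-identityˡ (⟪ suc k ⟫ ℚ.* 1/N k) ⟨
    1ℚ ℚ.* (⟪ suc k ⟫ ℚ.* 1/N k)                          ≡⟨ cong (ℚ._* (⟪ suc k ⟫ ℚ.* 1/N k)) (⟪suc⟫*δ k) ⟨
    ⟪ suc k ⟫ ℚ.* δ k ℚ.* (⟪ suc k ⟫ ℚ.* 1/N k)           ≡⟨ solve 3 (λ n d w → n :* d :* (n :* w) := n :* n :* w :* d) refl ⟪ suc k ⟫ (δ k) (1/N k) ⟩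
    ⟪ suc k ⟫ ℚ.* ⟪ suc k ⟫ ℚ.* 1/N k ℚ.* δ k             ≡⟨ cong (λ z → z ℚ.* 1/N k ℚ.* δ k) (⟪⟫-* (suc k) (suc k)) ⟨
    ⟪ suc k * suc k ⟫ ℚ.* 1/N k ℚ.* δ k                   ≡⟨ cong (ℚ._* δ k) (N*1/N≡1 k) ⟩
    1ℚ ℚ.* δ k                                          ≡⟨ ℚ.*-identityˡ (δ k) ⟩
    δ k                                                 ∎
    where open ≡-Reasoning

  0≤1/N : ∀ k → 0ℚ ℚ.≤ 1/N k
  0≤1/N k = subst (0ℚ ℚ.≤_) (δ≡ (k + k * suc k)) (0≤δ (k + k * suc k))

  1/N≤1 : ∀ k → 1/N k ℚ.≤ 1ℚ
  1/N≤1 k = subst (ℚ._≤ 1ℚ) (δ≡ (k + k * suc k)) (δ≤1 (k + k * suc k))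

density : ℕ → ℚ → ℚ
density k q = A k q ℚ.* 1/N k

-- `square-comparison` divided by both areas. The error depends neither on `q` nor on the size of
-- the second box, which is what lets the comparison pass to suprema.
density-comparison : ∀ k l {q} → ⟦0,1⟧ q → density k q ℚ.≤ density l q ℚ.+ ⟪ 4 ⟫ ℚ.* δ k
density-comparison k l {q} q∈ = ≤-by (1/N k ℚ.* 1/N l ℚ.* (N ℚ.* b ℚ.+ ⟪ 4 ⟫ ℚ.* (M ℚ.* n) ℚ.- M ℚ.* a))
  (0≤* (0≤* (0≤1/N k) (0≤1/N l)) (x≤y⇒0≤y-x comparison))
  (sym (begin
    a ℚ.* 1/N k ℚ.+ 1/N k ℚ.* 1/N l ℚ.* (N ℚ.* b ℚ.+ ⟪ 4 ⟫ ℚ.* (M ℚ.* n) ℚ.- M ℚ.* a)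
      ≡⟨ solve 7 (λ a b M N n x y → a :* x :+ x :* y :* (N :* b :+ con ⟪ 4 ⟫ :* (M :* n) :- M :* a) :=
           a :* x :+ (N :* x) :* (b :* y) :+ con ⟪ 4 ⟫ :* ((M :* y) :* (n :* x)) :- (M :* y) :* (a :* x)) refl
           a b M N n (1/N k) (1/N l) ⟩
    a ℚ.* 1/N k ℚ.+ (N ℚ.* 1/N k) ℚ.* (b ℚ.* 1/N l) ℚ.+ ⟪ 4 ⟫ ℚ.* ((M ℚ.* 1/N l) ℚ.* (n ℚ.* 1/N k)) ℚ.- (M ℚ.* 1/N l) ℚ.* (a ℚ.* 1/N k)
      ≡⟨ cong₂ (λ x y → a ℚ.* 1/N k ℚ.+ x ℚ.* (b ℚ.* 1/N l) ℚ.+ ⟪ 4 ⟫ ℚ.* ((M ℚ.* 1/N l) ℚ.* y) ℚ.- (M ℚ.* 1/N l) ℚ.* (a ℚ.* 1/N k))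
           (N*1/N≡1 k) (n*1/N≡δ k) ⟩
    a ℚ.* 1/N k ℚ.+ 1ℚ ℚ.* (b ℚ.* 1/N l) ℚ.+ ⟪ 4 ⟫ ℚ.* ((M ℚ.* 1/N l) ℚ.* δ k) ℚ.- (M ℚ.* 1/N l) ℚ.* (a ℚ.* 1/N k)
      ≡⟨ cong (λ y → a ℚ.* 1/N k ℚ.+ 1ℚ ℚ.* (b ℚ.* 1/N l) ℚ.+ ⟪ 4 ⟫ ℚ.* (y ℚ.* δ k) ℚ.- y ℚ.* (a ℚ.* 1/N k)) (N*1/N≡1 l) ⟩
    a ℚ.* 1/N k ℚ.+ 1ℚ ℚ.* (b ℚ.* 1/N l) ℚ.+ ⟪ 4 ⟫ ℚ.* (1ℚ ℚ.* δ k) ℚ.- 1ℚ ℚ.* (a ℚ.* 1/N k)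
      ≡⟨ solve 3 (λ a b d → a :+ con 1ℚ :* b :+ con ⟪ 4 ⟫ :* (con 1ℚ :* d) :- con 1ℚ :* a := b :+ con ⟪ 4 ⟫ :* d) refl
           (a ℚ.* 1/N k) (b ℚ.* 1/N l) (δ k) ⟩
    b ℚ.* 1/N l ℚ.+ ⟪ 4 ⟫ ℚ.* δ k ∎))
  where
  open ≡-Reasoning
  a b M N n : ℚ
  a = A k q
  b = A l q
  M = ⟪ suc l * suc l ⟫
  N = ⟪ suc k * suc k ⟫
  n = ⟪ suc k ⟫
  comparison : M ℚ.* a ℚ.≤ N ℚ.* b ℚ.+ ⟪ 4 ⟫ ℚ.* (M ℚ.* n)
  comparison = subst₂ (λ x y → M ℚ.* x ℚ.≤ N ℚ.* y ℚ.+ ⟪ 4 ⟫ ℚ.* (M ℚ.* n))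
    (sym (triangular≡rect (suc k) q)) (sym (triangular≡rect (suc l) q))
    (square-comparison q∈ (suc l) (suc k))

private
  perSite : ∀ k {x c y} → x ℚ.≤ ⟪ suc k * suc k ⟫ ℚ.* c ℚ.+ y → x ℚ.* 1/N k ℚ.≤ c ℚ.+ y ℚ.* 1/N k
  perSite k {x} {c} {y} h = subst (x ℚ.* 1/N k ℚ.≤_)
    (trans (solve 4 (λ N c y w → (N :* c :+ y) :* w := (N :* w) :* c :+ y :* w) refl ⟪ suc k * suc k ⟫ c y (1/N k))
      (cong (ℚ._+ y ℚ.* 1/N k) (trans (cong (ℚ._* c) (N*1/N≡1 k)) (ℚ.*-identityˡ c))))
    (ℚ.*-monoʳ-≤-nonNeg (1/N k) {{ℚ.nonNegative (0≤1/N k)}} h)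

  borderPerSite : ∀ k → ⟪ suc (5 * suc k) ⟫ ℚ.* 1/N k ℚ.≤ ⟪ 6 ⟫ ℚ.* δ k
  borderPerSite k = begin
    ⟪ suc (5 * suc k) ⟫ ℚ.* 1/N k         ≤⟨ ℚ.*-monoʳ-≤-nonNeg (1/N k) {{ℚ.nonNegative (0≤1/N k)}}
                                             (⟪⟫-mono (ℕ.+-monoˡ-≤ (5 * suc k) (s≤s (z≤n {k})))) ⟩
    ⟪ 6 * suc k ⟫ ℚ.* 1/N k               ≡⟨ cong (ℚ._* 1/N k) (⟪⟫-* 6 (suc k)) ⟩
    ⟪ 6 ⟫ ℚ.* ⟪ suc k ⟫ ℚ.* 1/N k         ≡⟨ ℚ.*-assoc ⟪ 6 ⟫ ⟪ suc k ⟫ (1/N k) ⟩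
    ⟪ 6 ⟫ ℚ.* (⟪ suc k ⟫ ℚ.* 1/N k)       ≡⟨ cong (⟪ 6 ⟫ ℚ.*_) (n*1/N≡δ k) ⟩
    ⟪ 6 ⟫ ℚ.* δ k                       ∎
    where open ℚ.≤-Reasoning

density-upper : ∀ k {q} → ⟦0,1⟧ q → density k q ℚ.≤ + 101 / 1000 ℚ.+ ⟪ 6 ⟫ ℚ.* δ k
density-upper k {q} q∈ = ℚ.≤-trans
  (perSite k (subst (ℚ._≤ ⟪ suc k * suc k ⟫ ℚ.* (+ 101 / 1000) ℚ.+ 1ℚ ℚ.* ⟪ suc (5 * suc k) ⟫)
    (sym (triangular≡rect (suc k) q))
    (meanClusters-upper (suc k) q∈ (from-yes (0ℚ ℚ.≤? + 101 / 1000)) (growthRate≤ q∈))))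
  (ℚ.+-monoʳ-≤ (+ 101 / 1000) (subst (ℚ._≤ ⟪ 6 ⟫ ℚ.* δ k)
    (cong (ℚ._* 1/N k) (sym (ℚ.*-identityˡ ⟪ suc (5 * suc k) ⟫))) (borderPerSite k)))

-- p₀ nearly maximises p q³ - p³ q + p⁶ q.
p₀ : ℚ
p₀ = + 53 / 250

p₀∈ : ⟦0,1⟧ p₀
p₀∈ = from-yes (0ℚ ℚ.≤? p₀) , from-yes (p₀ ℚ.≤? 1ℚ)

density-lower : ∀ k → + 962955 / 10000000 ℚ.≤ density k p₀ ℚ.+ ⟪ 12 ⟫ ℚ.* δ k
density-lower k = begin
  c                                                                      ≡⟨ trans (cong (ℚ._* c) (sym (N*1/N≡1 k)))
                                                                              (solve 3 (λ N w c → N :* w :* c := N :* c :* w) refl ⟪ suc k * suc k ⟫ (1/N k) c) ⟩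
  ⟪ suc k * suc k ⟫ ℚ.* c ℚ.* 1/N k                                        ≤⟨ ℚ.*-monoʳ-≤-nonNeg (1/N k) {{ℚ.nonNegative (0≤1/N k)}} total ⟩
  (A k p₀ ℚ.+ ⟪ 2 ⟫ ℚ.* ⟪ suc (5 * suc k) ⟫) ℚ.* 1/N k                     ≡⟨ solve 3 (λ a v w → (a :+ con ⟪ 2 ⟫ :* v) :* w := a :* w :+ con ⟪ 2 ⟫ :* (v :* w)) refl
                                                                              (A k p₀) ⟪ suc (5 * suc k) ⟫ (1/N k) ⟩
  density k p₀ ℚ.+ ⟪ 2 ⟫ ℚ.* (⟪ suc (5 * suc k) ⟫ ℚ.* 1/N k)               ≤⟨ ℚ.+-monoʳ-≤ (density k p₀) (*-monoˡ-≤ (0≤⟪⟫ 2) (borderPerSite k)) ⟩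
  density k p₀ ℚ.+ ⟪ 2 ⟫ ℚ.* (⟪ 6 ⟫ ℚ.* δ k)                             ≡⟨ cong (density k p₀ ℚ.+_) (ℚ.*-assoc ⟪ 2 ⟫ ⟪ 6 ⟫ (δ k)) ⟨
  density k p₀ ℚ.+ ⟪ 12 ⟫ ℚ.* δ k                                        ∎
  where
  open ℚ.≤-Reasoning
  c : ℚ
  -- The rate at `p₀` is 0.09629579...; `c` rounds it down and still exceeds 0.09629 by 0.0000055.
  c = + 962955 / 10000000
  total : ⟪ suc k * suc k ⟫ ℚ.* c ℚ.≤ A k p₀ ℚ.+ ⟪ 2 ⟫ ℚ.* ⟪ suc (5 * suc k) ⟫
  total = subst (λ x → ⟪ suc k * suc k ⟫ ℚ.* c ℚ.≤ x ℚ.+ ⟪ 2 ⟫ ℚ.* ⟪ suc (5 * suc k) ⟫) (sym (triangular≡rect (suc k) p₀))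
    (meanClusters-lower (suc k) p₀∈ (from-yes (c ℚ.≤? 1ℚ))
      (from-yes (c ℚ.≤? birthRate p₀ ℚ.+ hexagonRate p₀ ℚ.- meetingRate p₀)))

-- The limit

scaledMax : ℕ → ℕ → ℚ
scaledMax k j = Maximum.maximum k j ℚ.* 1/N k

private
  argmax∈⟦⟧ : ∀ k j → ⟦0,1⟧ (Maximum.argmax k j)
  argmax∈⟦⟧ k j = ℚ.<⇒≤ (proj₁ (Maximum.argmax∈ k j)) , ℚ.<⇒≤ (proj₂ (Maximum.argmax∈ k j))

density≤scaledMax : ∀ k j {q} → ⟦0,1⟧ q → density k q ℚ.≤ scaledMax k j ℚ.+ δ j
density≤scaledMax k j {q} q∈ = begin
  density k q                                ≤⟨ ℚ.*-monoʳ-≤-nonNeg (1/N k) {{ℚ.nonNegative (0≤1/N k)}} (Maximum.argmax-max k j q q∈) ⟩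
  (Maximum.maximum k j ℚ.+ δ j) ℚ.* 1/N k      ≡⟨ ℚ.*-distribʳ-+ (1/N k) (Maximum.maximum k j) (δ j) ⟩
  scaledMax k j ℚ.+ δ j ℚ.* 1/N k              ≤⟨ ℚ.+-monoʳ-≤ (scaledMax k j) (*-monoˡ-≤ (0≤δ j) (1/N≤1 k)) ⟩
  scaledMax k j ℚ.+ δ j ℚ.* 1ℚ               ≡⟨ cong (scaledMax k j ℚ.+_) (ℚ.*-identityʳ (δ j)) ⟩
  scaledMax k j ℚ.+ δ j                      ∎
  where open ℚ.≤-Reasoning

-- The maximiser found for box `k` is tested in box `l`: changing the box costs `4 * δ k`, and the
-- accuracy of the maximum in box `l` costs `δ j`. The stage `i` costs nothing, since `argmax` is an
-- actual point.
scaledMax-comparison : ∀ k l i j → scaledMax k i ℚ.≤ scaledMax l j ℚ.+ (⟪ 4 ⟫ ℚ.* δ k ℚ.+ δ j)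
scaledMax-comparison k l i j = begin
  scaledMax k i                                     ≤⟨ density-comparison k l (argmax∈⟦⟧ k i) ⟩
  density l (Maximum.argmax k i) ℚ.+ ⟪ 4 ⟫ ℚ.* δ k  ≤⟨ ℚ.+-monoˡ-≤ (⟪ 4 ⟫ ℚ.* δ k) (density≤scaledMax l j (argmax∈⟦⟧ k i)) ⟩
  scaledMax l j ℚ.+ δ j ℚ.+ ⟪ 4 ⟫ ℚ.* δ k           ≡⟨ solve 3 (λ x d e → x :+ d :+ e := x :+ (e :+ d)) refl
                                                         (scaledMax l j) (δ j) (⟪ 4 ⟫ ℚ.* δ k) ⟩
  scaledMax l j ℚ.+ (⟪ 4 ⟫ ℚ.* δ k ℚ.+ δ j)         ∎
  where open ℚ.≤-Reasoning

-- One estimate with two uses: `i = k` gives the Cauchy property of the diagonal, and `i = j` the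
-- convergence of the suprema to it. The hypothesis on `δ i` holds in both cases.
scaledMax-close : ∀ k i j → δ i ℚ.≤ δ k ℚ.+ δ j →
  ℚ.∣ scaledMax k i ℚ.- scaledMax j j ∣ ℚ.≤ ⟪ 5 ⟫ ℚ.* δ k ℚ.+ ⟪ 5 ⟫ ℚ.* δ j
scaledMax-close k i j δi≤ = ∣x-y∣≤
  (ℚ.≤-trans (scaledMax-comparison k j i j) (ℚ.+-monoʳ-≤ (scaledMax j j)
    (≤-by (δ k ℚ.+ ⟪ 4 ⟫ ℚ.* δ j) (0≤+ (0≤δ k) (0≤* (0≤⟪⟫ 4) (0≤δ j)))
      (solve 2 (λ x y → con ⟪ 5 ⟫ :* x :+ con ⟪ 5 ⟫ :* y := con ⟪ 4 ⟫ :* x :+ y :+ (x :+ con ⟪ 4 ⟫ :* y)) refl (δ k) (δ j)))))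
  (ℚ.≤-trans (scaledMax-comparison j k j i) (ℚ.+-monoʳ-≤ (scaledMax k i)
    (≤-by ((δ k ℚ.+ δ j ℚ.- δ i) ℚ.+ ⟪ 4 ⟫ ℚ.* δ k) (0≤+ (x≤y⇒0≤y-x δi≤) (0≤* (0≤⟪⟫ 4) (0≤δ k)))
      (solve 3 (λ x y z → con ⟪ 5 ⟫ :* x :+ con ⟪ 5 ⟫ :* y := con ⟪ 4 ⟫ :* y :+ z :+ ((x :+ y :- z) :+ con ⟪ 4 ⟫ :* x)) refl
        (δ k) (δ j) (δ i)))))

private
  0<½* : ∀ {e} → 0ℚ ℚ.< e → 0ℚ ℚ.< ½ ℚ.* e
  0<½* = 0<* (ℚ.positive⁻¹ ½)

  halves : ∀ e → ½ ℚ.* e ℚ.+ ½ ℚ.* e ≡ e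
  halves = solve 1 (λ e → con ½ :* e :+ con ½ :* e := e) refl

  limit-cauchy : Cauchy (λ j → scaledMax j j)
  limit-cauchy e 0<e = let M , small = archimedean 5 (0<½* 0<e) in M , λ i j M≤i M≤j → ℚ.≤-<-trans
    (scaledMax-close i i j (≤-by (δ j) (0≤δ j) refl))
    (subst (⟪ 5 ⟫ ℚ.* δ i ℚ.+ ⟪ 5 ⟫ ℚ.* δ j ℚ.<_) (halves e) (ℚ.+-mono-< (small i M≤i) (small j M≤j)))

-- The diagonal, along which the size of the box and the accuracy of its maximum grow together.
limit : ℝ
limit = mkℝ (λ j → scaledMax j j) limit-cauchy

scaledSup⟶limit : (λ k → Maximum.supremum k *ᵣ fromℚ (1/N k)) ⟶ limit
-- The gap `e₀` is shared out: a quarter for each of the two terms of `scaledMax-close`, and the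
-- remaining half is the uniform gap that `<ᵣ` demands.
scaledSup⟶limit e (e₀ , 0<e₀ , M₀ , e≥) = let M₁ , small = archimedean 5 (0<½* (0<½* 0<e₀)) in M₁ , λ n M₁≤n → ½ ℚ.* e₀ , 0<½* 0<e₀ , M₀ ⊔ M₁ , λ j M≤j →
  let open ℚ.≤-Reasoning in begin
    ℚ.∣ scaledMax n j ℚ.- scaledMax j j ∣ ℚ.+ ½ ℚ.* e₀
      ≤⟨ ℚ.+-monoˡ-≤ (½ ℚ.* e₀) (scaledMax-close n j j (≤-by (δ n) (0≤δ n) (ℚ.+-comm (δ n) (δ j)))) ⟩
    ⟪ 5 ⟫ ℚ.* δ n ℚ.+ ⟪ 5 ⟫ ℚ.* δ j ℚ.+ ½ ℚ.* e₀
      ≤⟨ ℚ.+-monoˡ-≤ (½ ℚ.* e₀) (ℚ.<⇒≤ (ℚ.+-mono-< (small n M₁≤n) (small j (ℕ.m⊔n≤o⇒n≤o M₀ M₁ M≤j)))) ⟩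
    ½ ℚ.* (½ ℚ.* e₀) ℚ.+ ½ ℚ.* (½ ℚ.* e₀) ℚ.+ ½ ℚ.* e₀
      ≡⟨ cong (ℚ._+ ½ ℚ.* e₀) (halves (½ ℚ.* e₀)) ⟩
    ½ ℚ.* e₀ ℚ.+ ½ ℚ.* e₀
      ≡⟨ halves e₀ ⟩
    e₀
      ≡⟨ ℚ.+-identityˡ e₀ ⟨
    0ℚ ℚ.+ e₀
      ≤⟨ e≥ j (ℕ.m⊔n≤o⇒m≤o M₀ M₁ M≤j) ⟩
    seq e j ∎

limit-lower : fromℚ (+ 9629 / 100000) <ᵣ limit
limit-lower =
  -- The surplus 0.0000055 of 0.0962955 over 0.09629 is split into a gap of 0.0000025 and 0.000003
  -- for the errors: `12 * δ j` from the border and `δ j` from the approximate maximum.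
  let M , small = archimedean 13 {+ 3 / 1000000} (from-yes (0ℚ ℚ.<? + 3 / 1000000)) in
  + 5 / 2000000 , from-yes (0ℚ ℚ.<? + 5 / 2000000) , M , λ j M≤j →
  ≤-by ((density j p₀ ℚ.+ ⟪ 12 ⟫ ℚ.* δ j ℚ.- + 962955 / 10000000) ℚ.+ (scaledMax j j ℚ.+ δ j ℚ.- density j p₀)
        ℚ.+ (+ 3 / 1000000 ℚ.- ⟪ 13 ⟫ ℚ.* δ j))
    (0≤+ (0≤+ (x≤y⇒0≤y-x (density-lower j)) (x≤y⇒0≤y-x (density≤scaledMax j j p₀∈))) (x≤y⇒0≤y-x (ℚ.<⇒≤ (small j M≤j))))
    (solve 3 (λ s x d → s := con (+ 9629 / 100000) :+ con (+ 5 / 2000000) :+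
      ((x :+ con ⟪ 12 ⟫ :* d :- con (+ 962955 / 10000000)) :+ (s :+ d :- x) :+ (con (+ 3 / 1000000) :- con ⟪ 13 ⟫ :* d))) refl
      (scaledMax j j) (density j p₀) (δ j))

limit-upper : limit <ᵣ fromℚ (+ 10107 / 100000)
limit-upper =
  -- The difference 0.00007 between 0.10107 and 0.101 is split into a gap of 0.00005 and 0.00002 for
  -- the border error `6 * δ j`.
  let M , small = archimedean 6 {+ 2 / 100000} (from-yes (0ℚ ℚ.<? + 2 / 100000)) in
  + 5 / 100000 , from-yes (0ℚ ℚ.<? + 5 / 100000) , M , λ j M≤j →
  ≤-by ((+ 101 / 1000 ℚ.+ ⟪ 6 ⟫ ℚ.* δ j ℚ.- scaledMax j j) ℚ.+ (+ 2 / 100000 ℚ.- ⟪ 6 ⟫ ℚ.* δ j))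
    (0≤+ (x≤y⇒0≤y-x (density-upper j (argmax∈⟦⟧ j j))) (x≤y⇒0≤y-x (ℚ.<⇒≤ (small j M≤j))))
    (solve 2 (λ s d → con (+ 10107 / 100000) := s :+ con (+ 5 / 100000) :+
      ((con (+ 101 / 1000) :+ con ⟪ 6 ⟫ :* d :- s) :+ (con (+ 2 / 100000) :- con ⟪ 6 ⟫ :* d))) refl (scaledMax j j) (δ j))

theorem3 : Σ[ s ∈ (ℕ → ℝ) ] Σ[ L ∈ ℝ ]
    (∀ k → IsSupremum ]0,1[ 𝔼[C triangularLattice (suc k) ] (s k)) ×
    (λ k → s k *ᵣ fromℚ (+ 1 / (suc k * suc k))) ⟶ L ×
    fromℚ (+ 9629 / 100000) <ᵣ L ×
    L <ᵣ fromℚ (+ 10107 / 100000)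
theorem3 = Maximum.supremum , limit ,
  (λ k → Maximum.isSupremum k 𝔼[C triangularLattice (suc k) ]
    (λ p n → expectation-E p n (λ S → fromℕ (numComponents (triangularLattice (suc k)) S)))) ,
  scaledSup⟶limit , limit-lower , limit-upper
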